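{- Let $q\ge 2$ be an integer and let $n\ge n_0(q)$, where $n_0(2)=37$, $n_0(3)=97$, and $n_0(q)=45q-8$ for $q\ge4$. If $G$ is an oriented graph on $n$ vertices with $\delta^0(G)\ge\lceil n/3\rceil$, then every vertex of $G$ lies on a copy of $C_{3q}$ in $G$.
   Context: An oriented graph is an orientation of a (finite) simple graph: no loops, and at most one arc on each unordered pair of vertices. For a vertex $v$, $d^+(v)$ and $d^-(v)$ are its outdegree and indegree, and $\delta^0(G)=\min_{v}\min\{d^+(v),d^-(v)\}$ is the minimum semidegree. $C_\ell$ denotes the consistently oriented (directed) cycle of length $\ell$ (with $\ell$ distinct vertices). -}

module Defs where

open import Data.Fin.Base using (Fin; toℕ)
open import Data.List.Base using (map) renaming (allFin to allFinList)
open import Data.List.Extrema.Nat using (min)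
open import Data.Nat.Base using (ℕ; suc; _+_; _*_; _∸_; _⊓_; _/_)
open import Data.Product.Base using (∃)
open import Data.Vec.Base using (count; allFin)
open import Function.Definitions using (Injective)
open import Level using (0ℓ)
open import Relation.Binary.Core using (Rel)
open import Relation.Binary.Definitions using (Irreflexive; Asymmetric; Decidable)
open import Relation.Binary.PropositionalEquality.Core using (_≡_)

-- Arcs form a decidable relation: that is what lets degrees be counted, and
-- it is no restriction on finite graphs classically.

record OrientedGraph (n : ℕ) : Set₁ where
  field
    Arc    : Rel (Fin n) 0ℓ
    arc?   : Decidable Arc
    irrefl : Irreflexive _≡_ Arc
    asym   : Asymmetric Arc

open OrientedGraph

private
  variable
    n ℓ : ℕ

d⁺ d⁻ : OrientedGraph n → Fin n → ℕ
d⁺ G v = count (λ u → arc? G v u) (allFin _)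
d⁻ G v = count (λ u → arc? G u v) (allFin _)

-- The first argument of `min` is the value on the empty list. Every degree is
-- less than n, so taking it to be n does not affect the minimum when n > 0.

δ⁰ : OrientedGraph n → ℕ
δ⁰ {n} G = min n (map (λ v → d⁺ G v ⊓ d⁻ G v) (allFinList n))

⌈_/3⌉ : ℕ → ℕ
⌈ n /3⌉ = (n + 2) / 3

-- The arcs of C_ℓ on the vertices 0, …, ℓ - 1: i → i + 1 and ℓ - 1 → 0.

data CycleArc {ℓ : ℕ} (i j : Fin ℓ) : Set where
  step : toℕ j ≡ suc (toℕ i) → CycleArc i j
  wrap : suc (toℕ i) ≡ ℓ → toℕ j ≡ 0 → CycleArc i j

-- A copy is a not necessarily induced subgraph, so arcs of C_ℓ are preserved
-- but need not be reflected.

record CycleCopy (ℓ : ℕ) (G : OrientedGraph n) : Set where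
  field
    vertex    : Fin ℓ → Fin n
    injective : Injective _≡_ _≡_ vertex
    arcs      : ∀ {i j} → CycleArc i j → Arc G (vertex i) (vertex j)

_LiesOn_ : {G : OrientedGraph n} → Fin n → CycleCopy ℓ G → Set
v LiesOn C = ∃ λ i → CycleCopy.vertex C i ≡ v

-- Only the values at q ≥ 2 are meaningful.

n₀ : ℕ → ℕ
n₀ 2 = 37
n₀ 3 = 97
n₀ q = 45 * q ∸ 8

-- Let δ be the minimum semidegree, so that n ≤ 3δ. Any two vertices s and x are
-- joined by a path of length 3, 4 or 5 avoiding a few given vertices: for suitable
-- a ∈ N⁺(s) and b ∈ N⁻(x) the sets N⁺(s) ∪ N⁺(a) and N⁻(x) ∪ N⁻(b) have about 3δ/2
-- elements each, and if no arc led from the first to the second, a vertex of small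
-- outdegree within the first would have too few out-neighbours. If both N⁺(v) and
-- N⁻(v) span an arc, there are paths through v of lengths 2, 3 and 4; one of them,
-- a path of prescribed length and a connection form the cycle of length 3q.
--
-- If N⁺(v) is independent, then n = 3δ, N⁺(v) has δ elements and each of them is
-- adjacent to every vertex outside N⁺(v). Now either an arc between vertices at
-- distance two from v plays the role of the missing arc, or G is close to a
-- blown-up triangle and the cycle is found greedily.
--
-- For q = 2 there is no room to avoid vertices: the arcs in N⁺(v) and N⁻(v) are
-- needed only for the shorter connections, so that v is the only vertex lost.

module Submission where

open import Defs
import Algebra.Properties.CommutativeMonoid.Sum
open import Data.Bool.Base using (Bool; true; false; _∧_; _∨_; not)
import Data.Bool.Properties as Bool
open import Data.Empty using (⊥; ⊥-elim)
open import Data.Fin.Base using (Fin; zero; suc; toℕ)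
import Data.Fin.Properties as Fin
open import Data.List.Base using (List; []; _∷_; _++_; _∷ʳ_; [_]; length; reverse; lookup; map)
  renaming (allFin to allFinList)
open import Data.List.Properties using (length-++; length-reverse)
open import Data.List.Extrema.Nat using (min≤v⁺)
open import Data.List.Membership.Propositional using (_∈_; _∉_; lose)
open import Data.List.Membership.Propositional.Properties
  using (∈-++⁺ˡ; ∈-++⁺ʳ; ∈-++⁻; ∈-lookup; ∈-map⁺; ∈-allFin)
open import Data.List.Relation.Binary.Permutation.Propositional using (_↭_; ↭-refl; ↭-sym; ↭-trans; prep; ↭⇒↭ₛ)
open import Data.List.Relation.Binary.Permutation.Propositional.Properties using (∈-resp-↭; ↭-length; drop-∷; ∷↭∷ʳ)
open import Data.List.Relation.Unary.All using (All)
import Data.List.Relation.Unary.All as All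
open import Data.List.Relation.Unary.All.Properties using (¬Any⇒All¬)
import Data.List.Relation.Unary.AllPairs as AllPairs
open import Data.List.Relation.Unary.Any using (here; there; any?; index)
open import Data.List.Relation.Unary.Any.Properties using (lookup-index)
open import Data.List.Relation.Unary.Unique.Propositional using (Unique)
import Data.List.Relation.Unary.Unique.Propositional.Properties as Unique
open import Data.Nat.Base using (ℕ; zero; suc; _+_; _*_; _∸_; _≤_; _≥_; _<_; _⊓_; _%_; z≤n; s≤s)
open import Data.Nat.DivMod using (m≡m%n+[m/n]*n; m%n<n)
open import Data.Nat.Properties hiding (_≟_)
open import Data.Nat.Tactic.RingSolver using (solve)
open import Data.Product.Base using (_×_; _,_; ∃; proj₁; proj₂)
open import Data.Sum.Base using (_⊎_; inj₁; inj₂; [_,_]′)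
open import Data.Vec.Base using (count; tabulate; allFin)
open import Function.Base using (_∘_; flip)
open import Relation.Binary.PropositionalEquality
  using (_≡_; _≢_; refl; sym; trans; cong; cong₂; subst; setoid; module ≡-Reasoning)
open import Relation.Nullary using (¬_; Dec; yes; no; does)
open import Relation.Nullary.Decidable using (dec-true; _×-dec_; map′; ¬?; decidable-stable)
open Algebra.Properties.CommutativeMonoid.Sum +-0-commutativeMonoid using (sum; ∑-distrib-+; ∑-comm; sum-cong-≗)
open import Algebra.Properties.Semiring.Sum +-*-semiring using (*-distribˡ-sum; *-distribʳ-sum)

-- The length of a connection, 3, 4 or 5, cannot be chosen, so the rest of the cycle must adapt. A
-- fork into `v` and a fork out of `v` each offer two lengths differing by one: both long, one of
-- each, or both short make up for the three cases. The inner vertices of a connection may therefore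
-- meet the long paths: in length 5 the short paths are taken, and in length 4 one of two disjoint
-- long paths stays free. Hence two lists of obstacles, `K` for the end vertices of a connection and
-- the smaller `H` for its inner ones.
--
-- The counting needs roughly `δ > 9 f`, where `H` has `f + 2` vertices. A path of length about
-- `3 q` inside `H` would call for `δ` near `27 q`. Choosing every other vertex of it only after the
-- connection is known brings this down to about `27 q / 2`, within the `15 q - 2` that `n₀`
-- provides.
--
-- Paths of length two from `s` to `x` are not excluded, so `N⁺(s)` and `N⁻(x)` may overlap or even
-- coincide. The bounds are weighted so that the overlap cancels.

private
  variable
    n δ : ℕ

-- Linear arithmetic: add up multiples of the hypotheses to an inequality l ≤ r
-- that the ring solver recognises as absurd, or as the goal, with slack k.

infixl 5 _⊞_
infixr 6 _⊠_

_⊞_ : ∀ {a b c d} → a ≤ b → c ≤ d → a + c ≤ b + d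
_⊞_ = +-mono-≤

_⊠_ : ∀ k {a b} → a ≤ b → k * a ≤ k * b
k ⊠ a≤b = *-monoʳ-≤ k a≤b

refute : ∀ {a} {A : Set a} {l r} k → l ≤ r → l ≡ suc k + r → A
refute {r = r} k l≤r refl = ⊥-elim (<⇒≱ (s≤s (m≤n+m r k)) l≤r)

derive : ∀ {x y l r} k → l ≤ r → l + y ≡ k + (r + x) → x ≤ y
derive {x} {y} {l} {r} k l≤r eq = +-cancelˡ-≤ r x y (begin
  r + x        ≤⟨ m≤n+m (r + x) k ⟩
  k + (r + x)  ≡⟨ eq ⟨
  l + y        ≤⟨ +-monoˡ-≤ y l≤r ⟩
  r + y        ∎)
  where open ≤-Reasoning

-- Finite sets of vertices

Sub : ℕ → Set
Sub n = Fin n → Bool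

infix 4 _∈ˢ_ _∉ˢ_
infixr 7 _∩_ _∖_
infixr 6 _∪_

_∈ˢ_ _∉ˢ_ : Fin n → Sub n → Set
i ∈ˢ A = A i ≡ true
i ∉ˢ A = ¬ i ∈ˢ A

_∩_ _∪_ _∖_ : Sub n → Sub n → Sub n
(A ∩ B) i = A i ∧ B i
(A ∪ B) i = A i ∨ B i
(A ∖ B) i = A i ∧ not (B i)

∁ : Sub n → Sub n
∁ A i = not (A i)

full : Sub n
full _ = true

elem : List (Fin n) → Sub n
elem []       i = false
elem (x ∷ xs) i = does (i Fin.≟ x) ∨ elem xs i

_∈ˢ?_ : (i : Fin n) (A : Sub n) → i ∈ˢ A ⊎ i ∉ˢ A
i ∈ˢ? A with A i
... | true  = inj₁ refl
... | false = inj₂ λ ()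

module _ (A B : Sub n) {i : Fin n} where

  ∩⁺ : i ∈ˢ A → i ∈ˢ B → i ∈ˢ A ∩ B
  ∩⁺ a b rewrite a | b = refl

  ∩⁻ : i ∈ˢ A ∩ B → i ∈ˢ A × i ∈ˢ B
  ∩⁻ p with A i | B i
  ∩⁻ p | true | true = refl , refl

  ∪⁺ˡ : i ∈ˢ A → i ∈ˢ A ∪ B
  ∪⁺ˡ a rewrite a = refl

  ∪⁺ʳ : i ∈ˢ B → i ∈ˢ A ∪ B
  ∪⁺ʳ b rewrite b = Bool.∨-zeroʳ (A i)

  ∪⁻ : i ∈ˢ A ∪ B → i ∈ˢ A ⊎ i ∈ˢ B
  ∪⁻ p with A i
  ... | true  = inj₁ refl
  ... | false = inj₂ p

  ∖⁺ : i ∈ˢ A → i ∉ˢ B → i ∈ˢ A ∖ B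
  ∖⁺ a b with A i | B i
  ... | true | true  = ⊥-elim (b refl)
  ... | true | false = refl

  ∖⁻ : i ∈ˢ A ∖ B → i ∈ˢ A × i ∉ˢ B
  ∖⁻ p with A i | B i
  ∖⁻ p | true | false = refl , λ ()

∁⁺ : (A : Sub n) {i : Fin n} → i ∉ˢ A → i ∈ˢ ∁ A
∁⁺ A {i} p with A i
... | true  = ⊥-elim (p refl)
... | false = refl

∁⁻ : (A : Sub n) {i : Fin n} → i ∈ˢ ∁ A → i ∉ˢ A
∁⁻ A {i} p q rewrite q with () ← p

elem⁺ : ∀ {xs} {i : Fin n} → i ∈ xs → i ∈ˢ elem xs
elem⁺ {xs = x ∷ xs} {i} (here i≡x) rewrite dec-true (i Fin.≟ x) i≡x = refl
elem⁺ {xs = x ∷ xs} {i} (there i∈) rewrite elem⁺ i∈ = Bool.∨-zeroʳ _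

elem⁻ : ∀ xs {i : Fin n} → i ∈ˢ elem xs → i ∈ xs
elem⁻ (x ∷ xs) {i} p with i Fin.≟ x
... | yes i≡x = here i≡x
... | no _    = there (elem⁻ xs p)

bit : Bool → ℕ
bit true  = 1
bit false = 0

opaque

  ∣_∣ : Sub n → ℕ
  ∣ A ∣ = sum (λ i → bit (A i))

  bit-≤ : ∀ a {m} → (a ≡ true → 1 ≤ m) → bit a ≤ m
  bit-≤ true  h = h refl
  bit-≤ false h = z≤n

  1≤bit : ∀ {a} → a ≡ true → 1 ≤ bit a
  1≤bit refl = s≤s z≤n

  sum-mono : ∀ {n} {f g : Fin n → ℕ} → (∀ i → f i ≤ g i) → sum f ≤ sum g
  sum-mono {zero}  f≤g = z≤n
  sum-mono {suc n} f≤g = +-mono-≤ (f≤g zero) (sum-mono (f≤g ∘ suc))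

  sum-tight : ∀ {n} {f g : Fin n → ℕ} → (∀ i → g i ≤ f i) → sum f ≤ sum g → ∀ i → f i ≤ g i
  sum-tight {suc n} {f} {g} g≤f Σf≤Σg zero =
    +-cancelʳ-≤ (sum (f ∘ suc)) _ _ (≤-trans Σf≤Σg (+-monoʳ-≤ (g zero) (sum-mono (g≤f ∘ suc))))
  sum-tight {suc n} {f} {g} g≤f Σf≤Σg (suc i) =
    sum-tight (g≤f ∘ suc) (+-cancelˡ-≤ (f zero) _ _ (≤-trans Σf≤Σg (+-monoˡ-≤ _ (g≤f zero)))) i

  cover : (A B C : Sub n) → (∀ i → i ∈ˢ A → i ∈ˢ B ⊎ i ∈ˢ C) → ∣ A ∣ ≤ ∣ B ∣ + ∣ C ∣
  cover A B C A⊆ = ≤-trans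
    (sum-mono λ i → bit-≤ (A i) λ i∈A → pointwise i (A⊆ i i∈A))
    (≤-reflexive (∑-distrib-+ (bit ∘ B) (bit ∘ C)))
    where
    pointwise : ∀ i → i ∈ˢ B ⊎ i ∈ˢ C → 1 ≤ bit (B i) + bit (C i)
    pointwise i (inj₁ b) = ≤-trans (1≤bit b) (m≤m+n _ _)
    pointwise i (inj₂ c) = ≤-trans (1≤bit c) (m≤n+m _ (bit (B i)))

  ∣∣-mono : (A B : Sub n) → (∀ i → i ∈ˢ A → i ∈ˢ B) → ∣ A ∣ ≤ ∣ B ∣
  ∣∣-mono A B A⊆B = sum-mono λ i → bit-≤ (A i) (1≤bit ∘ A⊆B i)

  pack : (A B C : Sub n) → (∀ i → i ∈ˢ A → i ∈ˢ C) → (∀ i → i ∈ˢ B → i ∈ˢ C) →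
    (∀ i → i ∈ˢ A → i ∉ˢ B) → ∣ A ∣ + ∣ B ∣ ≤ ∣ C ∣
  pack A B C A⊆C B⊆C A∥B = ≤-trans
    (≤-reflexive (sym (∑-distrib-+ (bit ∘ A) (bit ∘ B))))
    (sum-mono λ i → pointwise (A i) (B i) (A⊆C i) (B⊆C i) (A∥B i))
    where
    pointwise : ∀ a b {c} → (a ≡ true → c ≡ true) → (b ≡ true → c ≡ true) →
      (a ≡ true → ¬ b ≡ true) → bit a + bit b ≤ bit c
    pointwise false b     ac bc ab = bit-≤ b (1≤bit ∘ bc)
    pointwise true  false ac bc ab = 1≤bit (ac refl)
    pointwise true  true  ac bc ab = ⊥-elim (ab refl refl)

  ∣∪∣ : (A B : Sub n) → (∀ i → i ∈ˢ A → i ∉ˢ B) → ∣ A ∣ + ∣ B ∣ ≤ ∣ A ∪ B ∣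
  ∣∪∣ A B = pack A B (A ∪ B) (λ _ → ∪⁺ˡ A B) (λ _ → ∪⁺ʳ A B)

  ∣∣-split : (A B : Sub n) → ∣ A ∣ ≤ ∣ A ∩ B ∣ + ∣ A ∖ B ∣
  ∣∣-split A B = cover A (A ∩ B) (A ∖ B) λ i i∈A → split i i∈A (i ∈ˢ? B)
    where
    split : ∀ i → i ∈ˢ A → i ∈ˢ B ⊎ i ∉ˢ B → i ∈ˢ A ∩ B ⊎ i ∈ˢ A ∖ B
    split i i∈A (inj₁ b) = inj₁ (∩⁺ A B i∈A b)
    split i i∈A (inj₂ b) = inj₂ (∖⁺ A B i∈A b)

  ∣full∣ : ∣ full {n} ∣ ≡ n
  ∣full∣ {zero}  = refl
  ∣full∣ {suc n} = cong suc (∣full∣ {n})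

  ∣∣≤n : (A : Sub n) → ∣ A ∣ ≤ n
  ∣∣≤n A = ≤-trans (∣∣-mono A full λ _ _ → refl) (≤-reflexive ∣full∣)

  ∣∅∣ : ∣ elem {n} [] ∣ ≡ 0
  ∣∅∣ {zero}  = refl
  ∣∅∣ {suc n} = ∣∅∣ {n}

  ∣elem∣≤length : (xs : List (Fin n)) → ∣ elem xs ∣ ≤ length xs
  ∣elem∣≤length {n} []   = ≤-reflexive (∣∅∣ {n})
  ∣elem∣≤length {n} (x ∷ xs) = ≤-trans (cover (elem (x ∷ xs)) is-x (elem xs) λ i → ∪⁻ is-x (elem xs) {i})
    (+-mono-≤ (single x) (∣elem∣≤length xs))
    where
    is-x : Sub n
    is-x i = does (i Fin.≟ x)
    single : ∀ {n} (x : Fin n) → ∣ (λ i → does (i Fin.≟ x)) ∣ ≤ 1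
    single {suc n} zero    = s≤s (≤-reflexive (∣∅∣ {n}))
    single {suc n} (suc x) = single x

  1≤∣∣ : (A : Sub n) {i : Fin n} → i ∈ˢ A → 1 ≤ ∣ A ∣
  1≤∣∣ A {zero}  i∈A = ≤-trans (1≤bit i∈A) (m≤m+n _ _)
  1≤∣∣ A {suc i} i∈A = ≤-trans (1≤∣∣ (A ∘ suc) i∈A) (m≤n+m _ (bit (A zero)))

  1≤∣[_]∣ : (x : Fin n) → 1 ≤ ∣ elem [ x ] ∣
  1≤∣[ x ]∣ = 1≤∣∣ (elem [ x ]) {x} (elem⁺ {xs = [ x ]} (here refl))

  ∈[]⁻ : {x i : Fin n} → i ∈ˢ elem [ x ] → i ≡ x
  ∈[]⁻ {x = x} p with here i≡x ← elem⁻ [ x ] p = i≡x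

  insert : Fin n → Sub n → Sub n
  insert x A = A ∪ elem [ x ]

  insert⁻ : (x : Fin n) (A : Sub n) {i : Fin n} → i ∈ˢ insert x A → i ∈ˢ A ⊎ i ≡ x
  insert⁻ x A {i} i∈ with ∪⁻ A (elem [ x ]) {i} i∈
  ... | inj₁ i∈A = inj₁ i∈A
  ... | inj₂ i∈x = inj₂ (∈[]⁻ {x = x} {i} i∈x)

  insert⁺ˡ : (x : Fin n) (A : Sub n) {i : Fin n} → i ∈ˢ A → i ∈ˢ insert x A
  insert⁺ˡ x A = ∪⁺ˡ A (elem [ x ])

  insert⁺ʳ : (x : Fin n) (A : Sub n) → x ∈ˢ insert x A
  insert⁺ʳ x A = ∪⁺ʳ A (elem [ x ]) (elem⁺ {xs = [ x ]} (here refl))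

  ∣insert∣ : (x : Fin n) (A : Sub n) → x ∉ˢ A → ∣ A ∣ + 1 ≤ ∣ insert x A ∣
  ∣insert∣ x A x∉A = ≤-trans (+-monoʳ-≤ ∣ A ∣ 1≤∣[ x ]∣)
    (∣∪∣ A (elem [ x ]) λ i i∈A i∈x → x∉A (subst (_∈ˢ A) (∈[]⁻ {x = x} {i} i∈x) i∈A))

  length≤∣elem∣ : {xs : List (Fin n)} → Unique xs → length xs ≤ ∣ elem xs ∣
  length≤∣elem∣ AllPairs.[] = z≤n
  length≤∣elem∣ {xs = x ∷ xs} (x∉xs AllPairs.∷ unique) = ≤-trans
    (+-mono-≤ 1≤∣[ x ]∣ (length≤∣elem∣ unique))
    (pack (elem [ x ]) (elem xs) (elem (x ∷ xs))
      (λ i i∈ → elem⁺ {xs = x ∷ xs} (here (∈[]⁻ i∈))) (λ i i∈ → elem⁺ {xs = x ∷ xs} (there (elem⁻ xs i∈)))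
      (λ i i∈ i∈xs → All.lookup x∉xs (elem⁻ xs i∈xs) (sym (∈[]⁻ i∈))))

  -- Obstacles known to lie outside `N` cost it nothing. The savings in `loss`, `loss′`, `sizeA` and
  -- `sizeB` come from here.
  ∣∩elem∣+length≤ : (N : Sub n) (K xs : List (Fin n)) → Unique xs → (∀ {z} → z ∈ xs → z ∈ K) →
    (∀ {z} → z ∈ xs → z ∉ˢ N) → ∣ N ∩ elem K ∣ + length xs ≤ length K
  ∣∩elem∣+length≤ N K xs unique xs⊆K xs∥N = begin
    ∣ N ∩ elem K ∣ + length xs    ≤⟨ +-monoʳ-≤ _ (length≤∣elem∣ unique) ⟩
    ∣ N ∩ elem K ∣ + ∣ elem xs ∣  ≤⟨ pack (N ∩ elem K) (elem xs) (elem K) (λ _ → proj₂ ∘ ∩⁻ N (elem K))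
                                      (λ i → elem⁺ ∘ xs⊆K ∘ elem⁻ xs)
                                      (λ i i∈ i∈xs → xs∥N (elem⁻ xs i∈xs) (proj₁ (∩⁻ N (elem K) i∈))) ⟩
    ∣ elem K ∣                    ≤⟨ ∣elem∣≤length K ⟩
    length K                      ∎
    where open ≤-Reasoning

  pick : (A : Sub n) → 1 ≤ ∣ A ∣ → ∃ λ i → i ∈ˢ A
  pick {n} A 1≤A with Fin.any? (λ i → A i Bool.≟ true)
  ... | yes found = found
  ... | no none = ⊥-elim (<⇒≱ 1≤A (≤-trans (∣∣-mono A (elem []) λ i i∈A → ⊥-elim (none (i , i∈A)))
                                     (≤-reflexive (∣∅∣ {n}))))

  pickAvoiding : (A : Sub n) (xs : List (Fin n)) → length xs < ∣ A ∣ → ∃ λ i → i ∈ˢ A × i ∉ xs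
  pickAvoiding A xs few with pick (A ∖ elem xs) (+-cancelˡ-≤ (length xs) 1 _ enough)
    where
    enough : length xs + 1 ≤ length xs + ∣ A ∖ elem xs ∣
    enough = begin
      length xs + 1                    ≡⟨ +-comm (length xs) 1 ⟩
      suc (length xs)                  ≤⟨ few ⟩
      ∣ A ∣                            ≤⟨ ∣∣-split A (elem xs) ⟩
      ∣ A ∩ elem xs ∣ + ∣ A ∖ elem xs ∣ ≤⟨ +-monoˡ-≤ _ (∣∣-mono (A ∩ elem xs) (elem xs) λ _ → proj₂ ∘ ∩⁻ A (elem xs)) ⟩
      ∣ elem xs ∣ + ∣ A ∖ elem xs ∣    ≤⟨ +-monoˡ-≤ _ (∣elem∣≤length xs) ⟩
      length xs + ∣ A ∖ elem xs ∣      ∎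
      where open ≤-Reasoning
  ... | i , i∈ with ∖⁻ A (elem xs) i∈
  ... | i∈A , i∉xs = i , i∈A , i∉xs ∘ elem⁺

-- Weighted sums and double counting

⟨_⟩ : {P : Fin n → Set} → (∀ i → Dec (P i)) → Sub n
⟨ P? ⟩ i = does (P? i)

⟨⟩⁺ : {P : Fin n → Set} (P? : ∀ i → Dec (P i)) {i : Fin n} → P i → i ∈ˢ ⟨ P? ⟩
⟨⟩⁺ P? {i} = dec-true (P? i)

⟨⟩⁻ : {P : Fin n → Set} (P? : ∀ i → Dec (P i)) {i : Fin n} → i ∈ˢ ⟨ P? ⟩ → P i
⟨⟩⁻ P? {i} i∈ with P? i
... | yes p = p

opaque
  unfolding ∣_∣

  sumOver : Sub n → (Fin n → ℕ) → ℕ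
  sumOver A f = sum (λ i → bit (A i) * f i)

  sumOver-mono : (A : Sub n) {f g : Fin n → ℕ} → (∀ i → i ∈ˢ A → f i ≤ g i) → sumOver A f ≤ sumOver A g
  sumOver-mono A {f} {g} f≤g = sum-mono λ i → pointwise (A i) (f≤g i)
    where
    pointwise : ∀ a {x y} → (a ≡ true → x ≤ y) → bit a * x ≤ bit a * y
    pointwise true  x≤y = +-monoˡ-≤ 0 (x≤y refl)
    pointwise false x≤y = z≤n

  sumOver-tight : (A : Sub n) {f g : Fin n → ℕ} → (∀ i → i ∈ˢ A → g i ≤ f i) →
    sumOver A f ≤ sumOver A g → ∀ i → i ∈ˢ A → f i ≤ g i
  sumOver-tight A {f} {g} g≤f ΣA≤ i i∈A = pointwise⁻ (A i) i∈A
    (sum-tight (λ j → pointwise⁺ (A j) (g≤f j)) ΣA≤ i)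
    where
    pointwise⁺ : ∀ a {x y} → (a ≡ true → x ≤ y) → bit a * x ≤ bit a * y
    pointwise⁺ true  x≤y = +-monoˡ-≤ 0 (x≤y refl)
    pointwise⁺ false x≤y = z≤n
    pointwise⁻ : ∀ a {x y} → a ≡ true → bit a * x ≤ bit a * y → x ≤ y
    pointwise⁻ true _ x≤y = +-cancelʳ-≤ 0 _ _ x≤y

  -- Averaging: without such an `i`, `f` would dominate `g` on `A`, and the inequality between the
  -- sums would force equality.
  sumOver-min : (A : Sub n) (f g : Fin n → ℕ) → sumOver A f ≤ sumOver A g → 1 ≤ ∣ A ∣ →
    ∃ λ i → i ∈ˢ A × f i ≤ g i
  sumOver-min A f g ΣA≤ 1≤A with Fin.any? (λ i → (A i Bool.≟ true) ×-dec (f i ≤? g i))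
  ... | yes found = found
  ... | no none   = let i , i∈A = pick A 1≤A in
    ⊥-elim (none (i , i∈A , sumOver-tight A (λ j j∈A → ≰⇒≥ λ fj≤gj → none (j , j∈A , fj≤gj)) ΣA≤ i i∈A))

  sumOver-+ : (A : Sub n) (f g : Fin n → ℕ) → sumOver A (λ i → f i + g i) ≡ sumOver A f + sumOver A g
  sumOver-+ A f g = trans (sum-cong-≗ λ i → *-distribˡ-+ (bit (A i)) (f i) (g i)) (∑-distrib-+ (λ i → bit (A i) * f i) (λ i → bit (A i) * g i))

  sumOver-const : (A : Sub n) (c : ℕ) → sumOver A (λ _ → c) ≡ ∣ A ∣ * c
  sumOver-const A c = sym (*-distribʳ-sum c (bit ∘ A))

  sumOver-swap : (A B : Sub n) (R : Fin n → Fin n → Bool) →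
    sumOver A (λ i → ∣ B ∩ R i ∣) ≡ sumOver B (λ j → ∣ A ∩ flip R j ∣)
  sumOver-swap A B R = begin
    sum (λ i → bit (A i) * ∣ B ∩ R i ∣)
      ≡⟨ sum-cong-≗ (λ i → *-distribˡ-sum (bit (A i)) (bit ∘ (B ∩ R i))) ⟩
    sum (λ i → sum λ j → bit (A i) * bit (B j ∧ R i j))
      ≡⟨ ∑-comm (λ i j → bit (A i) * bit (B j ∧ R i j)) ⟩
    sum (λ j → sum λ i → bit (A i) * bit (B j ∧ R i j))
      ≡⟨ sum-cong-≗ (λ j → sum-cong-≗ λ i → exchange (A i) (B j) (R i j)) ⟩
    sum (λ j → sum λ i → bit (B j) * bit (A i ∧ R i j))
      ≡⟨ sum-cong-≗ (λ j → *-distribˡ-sum (bit (B j)) (bit ∘ (A ∩ flip R j))) ⟨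
    sum (λ j → bit (B j) * ∣ A ∩ flip R j ∣) ∎
    where
    open ≡-Reasoning
    exchange : ∀ a b r → bit a * bit (b ∧ r) ≡ bit b * bit (a ∧ r)
    exchange true  true  r = refl
    exchange true  false r = refl
    exchange false true  r = refl
    exchange false false r = refl

  count-tabulate : ∀ {m n} {P : Fin n → Set} (P? : ∀ i → Dec (P i)) (f : Fin m → Fin n) →
    count P? (tabulate f) ≡ ∣ ⟨ P? ⟩ ∘ f ∣
  count-tabulate {zero}  P? f = refl
  count-tabulate {suc m} P? f with does (P? (f zero))
  ... | true  = cong suc (count-tabulate P? (f ∘ suc))
  ... | false = count-tabulate P? (f ∘ suc)

  sumOver-⊆ : (A B : Sub n) {f : Fin n → ℕ} → (∀ i → i ∈ˢ A → i ∈ˢ B) → sumOver A f ≤ sumOver B f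
  sumOver-⊆ A B A⊆B = sum-mono λ i → *-monoˡ-≤ _ (bit-≤ (A i) (1≤bit ∘ A⊆B i))

  sumOver-cover : (A B C : Sub n) (f : Fin n → ℕ) → (∀ i → i ∈ˢ A → i ∈ˢ B ⊎ i ∈ˢ C) →
    sumOver A f ≤ sumOver B f + sumOver C f
  sumOver-cover A B C f A⊆ = ≤-trans
    (sum-mono λ i → pointwise (A i) (B i) (C i) (A⊆ i))
    (≤-reflexive (∑-distrib-+ (λ i → bit (B i) * f i) (λ i → bit (C i) * f i)))
    where
    pointwise : ∀ a b c {m} → (a ≡ true → b ≡ true ⊎ c ≡ true) → bit a * m ≤ bit b * m + bit c * m
    pointwise false b     c     h = z≤n
    pointwise true  true  c     h = m≤m+n _ _
    pointwise true  false true  h = ≤-refl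
    pointwise true  false false h with h refl
    ... | inj₁ ()
    ... | inj₂ ()

sumOver-≤ : (A : Sub n) {f : Fin n → ℕ} (c : ℕ) → (∀ i → i ∈ˢ A → f i ≤ c) → sumOver A f ≤ ∣ A ∣ * c
sumOver-≤ A c f≤c = ≤-trans (sumOver-mono A f≤c) (≤-reflexive (sumOver-const A c))

sumOver-≥ : (A : Sub n) {f : Fin n → ℕ} (c : ℕ) → (∀ i → i ∈ˢ A → c ≤ f i) → ∣ A ∣ * c ≤ sumOver A f
sumOver-≥ A c c≤f = ≤-trans (≤-reflexive (sym (sumOver-const A c))) (sumOver-mono A c≤f)

-- Oriented graphs with semidegrees at least n/3: degree counts and expansion

record Digraph (n δ : ℕ) : Set where
  field
    E    : Fin n → Sub n
    asym : ∀ {u w} → w ∈ˢ E u → u ∉ˢ E w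
    deg⁺ : ∀ u → δ ≤ ∣ E u ∣
    deg⁻ : ∀ u → δ ≤ ∣ flip E u ∣
    n≤3δ : n ≤ 3 * δ

-- All hypotheses survive the reversal of arcs, and reversing twice gives back `G` by definition, so
-- every lemma has its mirror image for free.
_ᵀ : Digraph n δ → Digraph n δ
G ᵀ = record { E = flip E ; asym = asym ; deg⁺ = deg⁻ ; deg⁻ = deg⁺ ; n≤3δ = n≤3δ }
  where open Digraph G

pack₃ : (A B C D : Sub n) → (∀ i → i ∈ˢ A → i ∈ˢ D) → (∀ i → i ∈ˢ B → i ∈ˢ D) → (∀ i → i ∈ˢ C → i ∈ˢ D) →
  (∀ i → i ∈ˢ A → i ∉ˢ B) → (∀ i → i ∈ˢ A → i ∉ˢ C) → (∀ i → i ∈ˢ B → i ∉ˢ C) →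
  ∣ A ∣ + (∣ B ∣ + ∣ C ∣) ≤ ∣ D ∣
pack₃ A B C D A⊆ B⊆ C⊆ A∥B A∥C B∥C = ≤-trans (+-monoʳ-≤ ∣ A ∣ (∣∪∣ B C B∥C))
  (pack A (B ∪ C) D A⊆ (λ i i∈ → [ B⊆ i , C⊆ i ]′ (∪⁻ B C i∈))
    λ i i∈A i∈ → [ A∥B i i∈A , A∥C i i∈A ]′ (∪⁻ B C i∈))

module Degrees (G : Digraph n δ) where

  open Digraph G

  N⁺ N⁻ : Fin n → Sub n
  N⁺ = E
  N⁻ = flip E

  infix 4 _⟶_
  _⟶_ : Fin n → Fin n → Set
  u ⟶ w = w ∈ˢ N⁺ u

  ⟶⇒≢ : ∀ {u w} → u ⟶ w → u ≢ w
  ⟶⇒≢ u⟶u refl = asym u⟶u u⟶u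

  path⇒≢ : ∀ {u w x} → u ⟶ w → w ⟶ x → u ≢ x
  path⇒≢ u⟶w w⟶u refl = asym u⟶w w⟶u

  -- Outdegrees and indegrees within `S` have the same sum, and a vertex, its in-neighbours and its
  -- out-neighbours in `S` are disjoint.
  degree-sum : (S : Sub n) → sumOver S (λ w → 2 * ∣ S ∩ N⁺ w ∣ + 1) ≤ sumOver S (λ _ → ∣ S ∣)
  degree-sum S = begin
    sumOver S (λ w → 2 * ∣ S ∩ N⁺ w ∣ + 1)
      ≤⟨ sumOver-mono S (λ w _ → ≤-reflexive (double ∣ S ∩ N⁺ w ∣)) ⟩
    sumOver S (λ w → ∣ S ∩ N⁺ w ∣ + (∣ S ∩ N⁺ w ∣ + 1))
      ≡⟨ sumOver-+ S (λ w → ∣ S ∩ N⁺ w ∣) (λ w → ∣ S ∩ N⁺ w ∣ + 1) ⟩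
    sumOver S (λ w → ∣ S ∩ N⁺ w ∣) + sumOver S (λ w → ∣ S ∩ N⁺ w ∣ + 1)
      ≡⟨ cong (_+ sumOver S (λ w → ∣ S ∩ N⁺ w ∣ + 1)) (sumOver-swap S S E) ⟩
    sumOver S (λ w → ∣ S ∩ N⁻ w ∣) + sumOver S (λ w → ∣ S ∩ N⁺ w ∣ + 1)
      ≡⟨ sumOver-+ S (λ w → ∣ S ∩ N⁻ w ∣) (λ w → ∣ S ∩ N⁺ w ∣ + 1) ⟨
    sumOver S (λ w → ∣ S ∩ N⁻ w ∣ + (∣ S ∩ N⁺ w ∣ + 1))
      ≤⟨ sumOver-mono S disjoint-parts ⟩
    sumOver S (λ _ → ∣ S ∣) ∎
    where
    open ≤-Reasoning
    double : ∀ a → 2 * a + 1 ≡ a + (a + 1)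
    double a = solve (a ∷ [])
    disjoint-parts : ∀ w → w ∈ˢ S → ∣ S ∩ N⁻ w ∣ + (∣ S ∩ N⁺ w ∣ + 1) ≤ ∣ S ∣
    disjoint-parts w w∈S = ≤-trans
      (+-monoʳ-≤ ∣ S ∩ N⁻ w ∣ (+-monoʳ-≤ ∣ S ∩ N⁺ w ∣ 1≤∣[ w ]∣))
      (pack₃ (S ∩ N⁻ w) (S ∩ N⁺ w) (elem [ w ]) S
        (λ _ → proj₁ ∘ ∩⁻ S (N⁻ w)) (λ _ → proj₁ ∘ ∩⁻ S (N⁺ w))
        (λ i i∈ → subst (_∈ˢ S) (sym (∈[]⁻ i∈)) w∈S)
        (λ i i∈ i∈′ → asym (proj₂ (∩⁻ S (N⁻ w) i∈)) (proj₂ (∩⁻ S (N⁺ w) i∈′)))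
        (λ i i∈ i∈′ → ⟶⇒≢ (proj₂ (∩⁻ S (N⁻ w) i∈)) (∈[]⁻ i∈′))
        (λ i i∈ i∈′ → ⟶⇒≢ (proj₂ (∩⁻ S (N⁺ w) i∈)) (sym (∈[]⁻ i∈′))))

  min-degree : (S : Sub n) → 1 ≤ ∣ S ∣ → ∃ λ w → w ∈ˢ S × 2 * ∣ S ∩ N⁺ w ∣ + 1 ≤ ∣ S ∣
  min-degree S = sumOver-min S _ _ (degree-sum S)

  -- Equality is forced at every vertex of `degree-sum`, so that `S` spans a regular tournament.
  regular : (S : Sub n) → (∀ w → w ∈ˢ S → ∣ S ∣ ≤ 2 * ∣ S ∩ N⁺ w ∣ + 1) →
    ∀ w → w ∈ˢ S → 2 * ∣ S ∩ N⁺ w ∣ + 1 ≤ ∣ S ∣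
  regular S = λ ≥half → sumOver-tight S ≥half (degree-sum S)

  -- A vertex `u` of least outdegree within `U ∖ Z` has fewer than `∣ U ∖ Z ∣ / 2` out-neighbours
  -- there and none in `Z`; the others need room outside `U ∪ Z`.
  separated : (U Z : Sub n) → (∀ u z → u ∈ˢ U → z ∈ˢ Z → ¬ u ⟶ z) → 1 ≤ ∣ U ∖ Z ∣ →
    2 * δ + 1 + ∣ U ∖ Z ∣ + 2 * ∣ Z ∣ ≤ 2 * n
  separated U Z no-arc 1≤ with min-degree (U ∖ Z) 1≤
  ... | u , u∈ , few = arith δ (∣ S ∩ N⁺ u ∣) (∣ rest ∣) (∣ S ∣) (∣ Z ∣) n
          (≤-trans (deg⁺ u) (cover (N⁺ u) (S ∩ N⁺ u) rest split)) few
          (≤-trans (pack₃ S Z rest full (λ _ _ → refl) (λ _ _ → refl) (λ _ _ → refl)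
             (λ _ → proj₂ ∘ ∖⁻ U Z) (λ i i∈S → λ i∈r → ∁⁻ (S ∪ Z) i∈r (∪⁺ˡ S Z i∈S))
             (λ i i∈Z → λ i∈r → ∁⁻ (S ∪ Z) i∈r (∪⁺ʳ S Z i∈Z))) (∣∣≤n full))
    where
    S rest : Sub n
    S = U ∖ Z
    rest = ∁ (S ∪ Z)
    split : ∀ i → i ∈ˢ N⁺ u → i ∈ˢ S ∩ N⁺ u ⊎ i ∈ˢ rest
    split i u⟶i with i ∈ˢ? (S ∪ Z)
    ... | inj₂ i∉ = inj₂ (∁⁺ (S ∪ Z) i∉)
    ... | inj₁ i∈ with ∪⁻ S Z i∈
    ...   | inj₁ i∈S = inj₁ (∩⁺ S (N⁺ u) i∈S u⟶i)
    ...   | inj₂ i∈Z = ⊥-elim (no-arc u i (proj₁ (∖⁻ U Z u∈)) i∈Z u⟶i)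
    arith : ∀ δ k c s z n → δ ≤ k + c → 2 * k + 1 ≤ s → s + (z + c) ≤ n → 2 * δ + 1 + s + 2 * z ≤ 2 * n
    arith δ k c s z n h₁ h₂ h₃ =
      derive 0 (2 ⊠ h₁ ⊞ h₂ ⊞ 2 ⊠ h₃) (solve (δ ∷ k ∷ c ∷ s ∷ z ∷ n ∷ []))

  -- Cleared of fractions: adding `N⁺ a ∖ H` to `A` gives at least
  -- `∣ A ∣ / 2 + δ - f + 1/2 + ∣ A ∩ B ∣ / 3` vertices. The last term pays for the overlap in
  -- `fill`.
  Expands : Sub n → Sub n → Sub n → ℕ → Fin n → Set
  Expands A B H f a = 6 * δ + 3 + 2 * ∣ A ∩ B ∣ ≤ 6 * ∣ (N⁺ a ∖ H) ∖ A ∣ + 6 * f + 3 * ∣ A ∣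

  -- If A ⊈ B the bound even holds with 3 ∣A ∩ B∣; the smaller coefficient gives
  -- both alternatives the same form, 9 ≤ ∣A∣ making up for the larger
  -- loss f + 1 in the second.
  expanding-vertex : (A B H : Sub n) (f : ℕ) → 9 ≤ ∣ A ∣ →
    (∀ a b → a ∈ˢ A → b ∈ˢ B → ¬ a ⟶ b) →
    (∀ a → a ∈ˢ A → ∣ N⁺ a ∩ H ∣ ≤ f + 1) →
    (∀ a → a ∈ˢ A → a ∉ˢ B → ∣ N⁺ a ∩ H ∣ ≤ f) →
    (∃ λ a → a ∈ˢ A ∖ B × Expands A B H f a) ⊎
    ((∀ a → a ∈ˢ A → a ∈ˢ B) × (∀ a → a ∈ˢ A → Expands A B H f a))
  expanding-vertex A B H f 9≤A no-arc loss loss′ with 1 ≤? ∣ A ∖ B ∣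
  ... | yes 1≤ with min-degree (A ∖ B) 1≤
  -- As no arc leads from `A` to `B`, the out-neighbours of `a` in `A` lie in `A ∖ B`, where at most
  -- half of the vertices are out-neighbours of `a`.
  ...   | a , a∈ , few = inj₁ (a , a∈ , arith δ (∣ N⁺ a ∩ H ∣) (∣ N⁺ a ∖ H ∣) (∣ (N⁺ a ∖ H) ∖ A ∣)
              (∣ (A ∖ B) ∩ N⁺ a ∣) (∣ A ∖ B ∣) (∣ A ∩ B ∣) (∣ A ∣)
            (≤-trans (deg⁺ a) (∣∣-split (N⁺ a) H)) (loss′ a (proj₁ (∖⁻ A B a∈)) (proj₂ (∖⁻ A B a∈)))
            (cover (N⁺ a ∖ H) ((N⁺ a ∖ H) ∖ A) ((A ∖ B) ∩ N⁺ a) split) few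
            (pack (A ∩ B) (A ∖ B) A (λ _ → proj₁ ∘ ∩⁻ A B) (λ _ → proj₁ ∘ ∖⁻ A B)
              λ i i∈ i∈′ → proj₂ (∖⁻ A B i∈′) (proj₂ (∩⁻ A B i∈))))
    where
    split : ∀ i → i ∈ˢ N⁺ a ∖ H → i ∈ˢ (N⁺ a ∖ H) ∖ A ⊎ i ∈ˢ (A ∖ B) ∩ N⁺ a
    split i i∈ with i ∈ˢ? A
    ... | inj₂ i∉A = inj₁ (∖⁺ (N⁺ a ∖ H) A i∈ i∉A)
    ... | inj₁ i∈A = inj₂ (∩⁺ (A ∖ B) (N⁺ a) (∖⁺ A B i∈A λ i∈B → no-arc a i (proj₁ (∖⁻ A B a∈)) i∈B a⟶i) a⟶i)
      where a⟶i = proj₁ (∖⁻ (N⁺ a) H i∈)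
    arith : ∀ δ h o w k α′ d α → δ ≤ h + o → h ≤ f → o ≤ w + k → 2 * k + 1 ≤ α′ → d + α′ ≤ α →
      6 * δ + 3 + 2 * d ≤ 6 * w + 6 * f + 3 * α
    arith δ h o w k α′ d α h₁ h₂ h₃ h₄ h₅ =
      derive 0 (6 ⊠ h₁ ⊞ 6 ⊠ h₂ ⊞ 6 ⊠ h₃ ⊞ 3 ⊠ h₄ ⊞ 3 ⊠ h₅ ⊞ z≤n {d})
        (solve (δ ∷ h ∷ o ∷ w ∷ k ∷ α′ ∷ d ∷ α ∷ f ∷ []))
  expanding-vertex A B H f 9≤A no-arc loss loss′ | no none = inj₂ (A⊆B , λ a a∈A → arith δ (∣ N⁺ a ∩ H ∣) (∣ N⁺ a ∖ H ∣) (∣ (N⁺ a ∖ H) ∖ A ∣) (∣ A ∩ B ∣) (∣ A ∣)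
      (≤-trans (deg⁺ a) (∣∣-split (N⁺ a) H)) (loss a a∈A)
      (∣∣-mono (N⁺ a ∖ H) ((N⁺ a ∖ H) ∖ A) λ i i∈ → ∖⁺ (N⁺ a ∖ H) A i∈ λ i∈A →
        no-arc a i a∈A (A⊆B i i∈A) (proj₁ (∖⁻ (N⁺ a) H i∈)))
      9≤A (∣∣-mono (A ∩ B) A λ _ → proj₁ ∘ ∩⁻ A B))
    where
    A⊆B : ∀ a → a ∈ˢ A → a ∈ˢ B
    A⊆B a a∈A with a ∈ˢ? B
    ... | inj₁ a∈B = a∈B
    ... | inj₂ a∉B = ⊥-elim (none (1≤∣∣ (A ∖ B) {a} (∖⁺ A B a∈A a∉B)))
    arith : ∀ δ h o w d α → δ ≤ h + o → h ≤ f + 1 → o ≤ w → 9 ≤ α → d ≤ α →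
      6 * δ + 3 + 2 * d ≤ 6 * w + 6 * f + 3 * α
    arith δ h o w d α h₁ h₂ h₃ h₄ h₅ =
      derive 0 (6 ⊠ h₁ ⊞ 6 ⊠ h₂ ⊞ 6 ⊠ h₃ ⊞ h₄ ⊞ 2 ⊠ h₅)
        (solve (δ ∷ h ∷ o ∷ w ∷ d ∷ α ∷ f ∷ []))

private

  loss-bound : ∀ l m f → l + 1 ≤ m → m ≤ 2 + f → l ≤ f + 1
  loss-bound l m f h₁ h₂ = derive 0 (h₁ ⊞ h₂) (solve (l ∷ m ∷ f ∷ []))

  loss′-bound : ∀ l m f → l + 2 ≤ m → m ≤ 2 + f → l ≤ f
  loss′-bound l m f h₁ h₂ = derive 0 (h₁ ⊞ h₂) (solve (l ∷ m ∷ f ∷ []))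

-- The end vertices of a connection avoid `K`, its inner vertices only `H`, so `H` alone limits the
-- expansion. Of the `2 + f` places in `H`, a vertex of `A` has no arc to `s`, and if it is outside
-- `B` none to `x` either.
module Ends (G : Digraph n δ) (s x : Fin n) (s≢x : s ≢ x) (H K : List (Fin n))
  (s∈H : s ∈ H) (x∈H : x ∈ H) (H⊆K : ∀ {z} → z ∈ H → z ∈ K) (f : ℕ) (∣H∣≤ : length H ≤ 2 + f) where

  open Degrees G

  A B : Sub n
  A = N⁺ s ∖ elem K
  B = N⁻ x ∖ elem K

  loss : ∀ a → a ∈ˢ A → ∣ N⁺ a ∩ elem H ∣ ≤ f + 1
  loss a a∈A = loss-bound (∣ N⁺ a ∩ elem H ∣) (length H) f
    (∣∩elem∣+length≤ (N⁺ a) H [ s ] (All.[] AllPairs.∷ AllPairs.[]) (λ { (here refl) → s∈H })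
      λ { (here refl) → Digraph.asym G (proj₁ (∖⁻ (N⁺ s) (elem K) a∈A)) })
    ∣H∣≤

  loss′ : ∀ a → a ∈ˢ A → a ∉ˢ B → ∣ N⁺ a ∩ elem H ∣ ≤ f
  loss′ a a∈A a∉B = loss′-bound (∣ N⁺ a ∩ elem H ∣) (length H) f
    (∣∩elem∣+length≤ (N⁺ a) H (s ∷ x ∷ []) ((s≢x All.∷ All.[]) AllPairs.∷ All.[] AllPairs.∷ AllPairs.[])
      (λ { (here refl) → s∈H ; (there (here refl)) → x∈H })
      λ { (here refl) → Digraph.asym G (proj₁ (∖⁻ (N⁺ s) (elem K) a∈A))
        ; (there (here refl)) a⟶x → a∉B (∖⁺ (N⁻ x) (elem K) a⟶x (proj₂ (∖⁻ (N⁺ s) (elem K) a∈A))) })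
    ∣H∣≤

-- Two sets expanding from s and towards x would fill the whole graph.

module Connection (G : Digraph n δ) (s x : Fin n) (s≢x : s ≢ x) (H K : List (Fin n))
  (s∈H : s ∈ H) (x∈H : x ∈ H) (H⊆K : ∀ {z} → z ∈ H → z ∈ K) (f : ℕ) (∣H∣≤ : length H ≤ 2 + f) where

  open Degrees G
  open Digraph G using (asym; deg⁺; n≤3δ)
  open Ends G s x s≢x H K s∈H x∈H H⊆K f ∣H∣≤ public
  private
    module Gᵀ = Degrees (G ᵀ)
    module Endsᵀ = Ends (G ᵀ) x s (s≢x ∘ sym) H K x∈H s∈H H⊆K f ∣H∣≤

  private
   module _ (c₃ : ∀ a b → a ∈ˢ A → b ∈ˢ B → ¬ a ⟶ b)
    (c₄ : ∀ a u b → a ∈ˢ A → b ∈ˢ B → u ∉ H → a ⟶ u → ¬ u ⟶ b)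
    (c₅ : ∀ a u w b → a ∈ˢ A → b ∈ˢ B → u ∉ H → w ∉ H → a ≢ b → a ⟶ u → u ⟶ w → ¬ w ⟶ b)
    (f+2≤δ : f + 2 ≤ δ) where

    module _ (a b : Fin n) (a∈A : a ∈ˢ A) (b∈B : b ∈ˢ B) (a≢b : a ≢ b) where

      X Y U Z : Sub n
      X = N⁺ a ∖ elem H
      Y = N⁻ b ∖ elem H
      U = A ∪ X
      Z = B ∪ Y

      X⁻ : ∀ {i} → i ∈ˢ X → a ⟶ i × i ∉ H
      X⁻ i∈ = let p , q = ∖⁻ (N⁺ a) (elem H) i∈ in p , q ∘ elem⁺

      Y⁻ : ∀ {i} → i ∈ˢ Y → i ⟶ b × i ∉ H
      Y⁻ i∈ = let p , q = ∖⁻ (N⁻ b) (elem H) i∈ in p , q ∘ elem⁺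

      -- Any other common vertex would yield a connection of length three or four. A vertex of
      -- `A ∩ B` gives only a path of length two, which no hypothesis excludes.
      meet : ∀ i → i ∈ˢ U → i ∈ˢ Z → i ∈ˢ A ∩ B
      meet i i∈U i∈Z with ∪⁻ A X i∈U | ∪⁻ B Y i∈Z
      ... | inj₁ i∈A | inj₁ i∈B = ∩⁺ A B i∈A i∈B
      ... | inj₁ i∈A | inj₂ i∈Y = ⊥-elim (c₃ i b i∈A b∈B (proj₁ (Y⁻ i∈Y)))
      ... | inj₂ i∈X | inj₁ i∈B = ⊥-elim (c₃ a i a∈A i∈B (proj₁ (X⁻ i∈X)))
      ... | inj₂ i∈X | inj₂ i∈Y = ⊥-elim (c₄ a i b a∈A b∈B (proj₂ (X⁻ i∈X)) (proj₁ (X⁻ i∈X)) (proj₁ (Y⁻ i∈Y)))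

      no-arc : ∀ u z → u ∈ˢ U → z ∈ˢ Z → ¬ u ⟶ z
      no-arc u z u∈U z∈Z u⟶z with ∪⁻ A X u∈U | ∪⁻ B Y z∈Z
      ... | inj₁ u∈A | inj₁ z∈B = c₃ u z u∈A z∈B u⟶z
      ... | inj₁ u∈A | inj₂ z∈Y = c₄ u z b u∈A b∈B (proj₂ (Y⁻ z∈Y)) u⟶z (proj₁ (Y⁻ z∈Y))
      ... | inj₂ u∈X | inj₁ z∈B = c₄ a u z a∈A z∈B (proj₂ (X⁻ u∈X)) (proj₁ (X⁻ u∈X)) u⟶z
      ... | inj₂ u∈X | inj₂ z∈Y = c₅ a u z b a∈A b∈B (proj₂ (X⁻ u∈X)) (proj₂ (Y⁻ z∈Y)) a≢b
              (proj₁ (X⁻ u∈X)) u⟶z (proj₁ (Y⁻ z∈Y))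

    nonempty : ∀ d l o → δ ≤ d → d ≤ l + o → l ≤ f + 1 → 1 ≤ o
    nonempty d l o h₁ h₂ h₃ = derive 0 (f+2≤δ ⊞ h₁ ⊞ h₂ ⊞ h₃) (solve (d ∷ l ∷ o ∷ f ∷ δ ∷ []))

    -- With `n ≤ 3 δ`, the two bounds of `separated` add up to `3 (u + z) ≤ 8 δ - 2 + 2 d`, while
    -- the expansions give `3 (u + z) ≥ 3/2 (α + β) + 6 δ - 6 f + 3 + 2 d`. The overlap `d` cancels.
    fill : ∀ n α β W V d d′ e u′ z′ u z →
      6 * δ + 3 + 2 * d ≤ 6 * W + 6 * f + 3 * α → 6 * δ + 3 + 2 * d′ ≤ 6 * V + 6 * f + 3 * β →
      2 * δ + 1 + u′ + 2 * z ≤ 2 * n → 2 * δ + 1 + z′ + 2 * u ≤ 2 * n →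
      u ≤ d + u′ → z ≤ e + z′ → d ≤ d′ → e ≤ d → α + W ≤ u → β + V ≤ z → n ≤ 3 * δ →
      3 * (α + β) + 10 ≤ 4 * δ + 12 * f
    fill n α β W V d d′ e u′ z′ u z h₁ h₂ h₃ h₄ h₅ h₆ h₇ h₈ h₉ h₁₀ h₁₁ =
      derive 0 (h₁ ⊞ h₂ ⊞ 2 ⊠ h₃ ⊞ 2 ⊠ h₄ ⊞ 2 ⊠ h₅ ⊞ 2 ⊠ h₆ ⊞ 2 ⊠ h₇ ⊞ 2 ⊠ h₈ ⊞ 6 ⊠ h₉ ⊞ 6 ⊠ h₁₀ ⊞ 8 ⊠ h₁₁)
        (solve (δ ∷ f ∷ n ∷ α ∷ β ∷ W ∷ V ∷ d ∷ d′ ∷ e ∷ u′ ∷ z′ ∷ u ∷ z ∷ []))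

    bound : ∀ a b → a ∈ˢ A → b ∈ˢ B → a ≢ b →
      Expands A B (elem H) f a → Gᵀ.Expands B A (elem H) f b → 3 * (∣ A ∣ + ∣ B ∣) + 10 ≤ 4 * δ + 12 * f
    bound a b a∈A b∈B a≢b expA expB = fill n (∣ A ∣) (∣ B ∣) (∣ X′ ∖ A ∣) (∣ Y′ ∖ B ∣) (∣ A ∩ B ∣) (∣ B ∩ A ∣)
      (∣ Z′ ∩ U′ ∣) (∣ U′ ∖ Z′ ∣) (∣ Z′ ∖ U′ ∣) (∣ U′ ∣) (∣ Z′ ∣) expA expB
      (separated U′ Z′ (no-arc a b a∈A b∈B a≢b)
        -- A vertex of `X′` in `Z′` would lie in `B` by `meet`, and `a` would have an arc to `B`.
        (let i , i∈X = pick X′ (nonempty (∣ N⁺ a ∣) _ _ (deg⁺ a) (∣∣-split (N⁺ a) (elem H)) (loss a a∈A)) in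
         1≤∣∣ (U′ ∖ Z′) {i} (∖⁺ U′ Z′ (∪⁺ʳ A X′ i∈X) λ i∈Z →
           c₃ a i a∈A (proj₂ (∩⁻ A B (meet a b a∈A b∈B a≢b i (∪⁺ʳ A X′ i∈X) i∈Z))) (proj₁ (∖⁻ (N⁺ a) (elem H) i∈X)))))
      (Gᵀ.separated Z′ U′ (λ z u z∈Z u∈U → no-arc a b a∈A b∈B a≢b u z u∈U z∈Z)
        (let i , i∈Y = pick Y′ (nonempty (∣ N⁻ b ∣) _ _ (Digraph.deg⁻ G b) (∣∣-split (N⁻ b) (elem H)) (Endsᵀ.loss b b∈B)) in
         1≤∣∣ (Z′ ∖ U′) {i} (∖⁺ Z′ U′ (∪⁺ʳ B Y′ i∈Y) λ i∈U →
           c₃ i b (proj₁ (∩⁻ A B (meet a b a∈A b∈B a≢b i i∈U (∪⁺ʳ B Y′ i∈Y)))) b∈B (proj₁ (∖⁻ (N⁻ b) (elem H) i∈Y)))))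
      (≤-trans (∣∣-split U′ Z′) (+-monoˡ-≤ _ (∣∣-mono (U′ ∩ Z′) (A ∩ B) λ i i∈ →
        meet a b a∈A b∈B a≢b i (proj₁ (∩⁻ U′ Z′ i∈)) (proj₂ (∩⁻ U′ Z′ i∈)))))
      (∣∣-split Z′ U′)
      (∣∣-mono (A ∩ B) (B ∩ A) λ i i∈ → ∩⁺ B A (proj₂ (∩⁻ A B i∈)) (proj₁ (∩⁻ A B i∈)))
      (∣∣-mono (Z′ ∩ U′) (A ∩ B) λ i i∈ → meet a b a∈A b∈B a≢b i (proj₂ (∩⁻ Z′ U′ i∈)) (proj₁ (∩⁻ Z′ U′ i∈)))
      (pack A (X′ ∖ A) U′ (λ _ → ∪⁺ˡ A X′) (λ i i∈ → ∪⁺ʳ A X′ (proj₁ (∖⁻ X′ A i∈))) λ i i∈A i∈ → proj₂ (∖⁻ X′ A i∈) i∈A)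
      (pack B (Y′ ∖ B) Z′ (λ _ → ∪⁺ˡ B Y′) (λ i i∈ → ∪⁺ʳ B Y′ (proj₁ (∖⁻ Y′ B i∈))) λ i i∈B i∈ → proj₂ (∖⁻ Y′ B i∈) i∈B)
      n≤3δ
      where
      X′ Y′ U′ Z′ : Sub n
      X′ = X a b a∈A b∈B a≢b
      Y′ = Y a b a∈A b∈B a≢b
      U′ = U a b a∈A b∈B a≢b
      Z′ = Z a b a∈A b∈B a≢b

  connection : f + 2 ≤ δ → 9 ≤ ∣ A ∣ → 9 ≤ ∣ B ∣ → 4 * δ + 12 * f < 3 * (∣ A ∣ + ∣ B ∣) + 10 →
    (∀ a b → a ∈ˢ A → b ∈ˢ B → ¬ a ⟶ b) →
    (∀ a u b → a ∈ˢ A → b ∈ˢ B → u ∉ H → a ⟶ u → ¬ u ⟶ b) →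
    ¬ (∀ a u w b → a ∈ˢ A → b ∈ˢ B → u ∉ H → w ∉ H → a ≢ b → a ⟶ u → u ⟶ w → ¬ w ⟶ b)
  connection f+2≤δ 9≤A 9≤B large c₃ c₄ c₅
    with expanding-vertex A B (elem H) f 9≤A c₃ loss loss′
       | Gᵀ.expanding-vertex B A (elem H) f 9≤B (λ b a b∈B a∈A → c₃ a b a∈A b∈B) Endsᵀ.loss Endsᵀ.loss′
  ... | inj₁ (a , a∈ , expA) | inj₁ (b , b∈ , expB) =
    <⇒≱ large (bound c₃ c₄ c₅ f+2≤δ a b (proj₁ (∖⁻ A B a∈)) (proj₁ (∖⁻ B A b∈))
      (λ { refl → proj₂ (∖⁻ A B a∈) (proj₁ (∖⁻ B A b∈)) }) expA expB)
  ... | inj₁ (a , a∈ , expA) | inj₂ (_ , expB) with pick B (≤-trans (s≤s z≤n) 9≤B)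
  ...   | b , b∈B = <⇒≱ large (bound c₃ c₄ c₅ f+2≤δ a b (proj₁ (∖⁻ A B a∈)) b∈B
                      (λ { refl → proj₂ (∖⁻ A B a∈) b∈B }) expA (expB b b∈B))
  connection f+2≤δ 9≤A 9≤B large c₃ c₄ c₅ | inj₂ (_ , expA) | inj₁ (b , b∈ , expB) with pick A (≤-trans (s≤s z≤n) 9≤A)
  ...   | a , a∈A = <⇒≱ large (bound c₃ c₄ c₅ f+2≤δ a b a∈A (proj₁ (∖⁻ B A b∈))
                      (λ { refl → proj₂ (∖⁻ B A b∈) a∈A }) (expA a a∈A) expB)
  connection f+2≤δ 9≤A 9≤B large c₃ c₄ c₅ | inj₂ (_ , expA) | inj₂ (_ , expB) with pick A (≤-trans (s≤s z≤n) 9≤A)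
  -- Here `A` and `B` coincide, so `a ≢ b` must be arranged; in the other cases one of the two
  -- vertices lies outside the other set.
  ...   | a , a∈A with pickAvoiding B [ a ] (≤-trans (s≤s (s≤s z≤n)) 9≤B)
  ...     | b , b∈B , b∉ = <⇒≱ large (bound c₃ c₄ c₅ f+2≤δ a b a∈A b∈B
                      (λ { refl → b∉ (here refl) }) (expA a a∈A) (expB b b∈B))

-- Paths and cycles

-- The list of Path E u xs w holds the vertices after u, so that it ends in w
-- and the vertices of a closed path are listed once.

data Path (E : Fin n → Sub n) : Fin n → List (Fin n) → Fin n → Set where
  ε   : ∀ {u} → Path E u [] u
  _◅_ : ∀ {u x xs w} → x ∈ˢ E u → Path E x xs w → Path E u (x ∷ xs) w

infixr 5 _◅_ _◅◅_

_◅◅_ : ∀ {E : Fin n → Sub n} {u v w xs ys} → Path E u xs v → Path E v ys w → Path E u (xs ++ ys) w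
ε       ◅◅ q = q
(e ◅ p) ◅◅ q = e ◅ (p ◅◅ q)

path? : ∀ (E : Fin n → Sub n) u xs w → Dec (Path E u xs w)
path? E u []       w = map′ (λ { refl → ε }) (λ { ε → refl }) (u Fin.≟ w)
path? E u (x ∷ xs) w = map′ (λ (e , p) → e ◅ p) (λ { (e ◅ p) → e , p }) ((E u x Bool.≟ true) ×-dec path? E x xs w)

-- The closed path may start anywhere, so that placing `v` on it never calls for a rotation.
Cycle : (Fin n → Sub n) → ℕ → Fin n → Set
Cycle {n} E ℓ v = ∃ λ xs → length xs ≡ ℓ × (∃ λ u → Path E u xs u) × Unique xs × v ∈ xs

listOfLength? : ∀ ℓ {P : List (Fin n) → Set} → (∀ xs → Dec (P xs)) → Dec (∃ λ xs → length xs ≡ ℓ × P xs)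
listOfLength? zero    P? = map′ (λ p → [] , refl , p) (λ { ([] , _ , p) → p }) (P? [])
listOfLength? (suc ℓ) P? = map′
  (λ (x , xs , len , p) → x ∷ xs , cong suc len , p)
  (λ { (x ∷ xs , len , p) → x , xs , suc-injective len , p })
  (Fin.any? λ x → listOfLength? ℓ λ xs → P? (x ∷ xs))

_∈?_ : (x : Fin n) (xs : List (Fin n)) → Dec (x ∈ xs)
x ∈? xs = any? (x Fin.≟_) xs

-- The counting refutes the absence of a cycle without exhibiting one; exhaustive search turns the
-- refutation into a cycle.
cycle? : ∀ (E : Fin n → Sub n) ℓ v → Dec (Cycle E ℓ v)
cycle? E ℓ v = listOfLength? ℓ λ xs →
  Fin.any? (λ u → path? E u xs u) ×-dec (unique? xs ×-dec (v ∈? xs))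
  where
  open import Data.List.Relation.Unary.Unique.DecPropositional Fin._≟_ using (unique?)

Path-reverse : ∀ {E : Fin n → Sub n} {u xs w} → Path (flip E) u xs w → ∃ λ ys → Path E w ys u × (u ∷ xs ↭ w ∷ ys)
Path-reverse ε = [] , ε , ↭-refl
Path-reverse {u = u} (e ◅ p) with Path-reverse p
... | ys , q , x∷xs↭w∷ys =
  ys ∷ʳ u , q ◅◅ e ◅ ε , ↭-trans (prep u x∷xs↭w∷ys) (∷↭∷ʳ u (_ ∷ ys))

Cycle-reverse : ∀ {E : Fin n → Sub n} {ℓ v} → Cycle (flip E) ℓ v → Cycle E ℓ v
Cycle-reverse {n} (xs , len , (u , p) , unique , v∈) with Path-reverse p
... | ys , q , perm = ys , trans (↭-length (↭-sym xs↭ys)) len , (u , q) ,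
    Unique-resp-↭ (↭⇒↭ₛ xs↭ys) unique , ∈-resp-↭ xs↭ys v∈
  where
  open import Data.List.Relation.Binary.Permutation.Setoid.Properties (setoid (Fin n)) using (Unique-resp-↭)
  xs↭ys = drop-∷ perm

lookup-step : ∀ {E : Fin n → Sub n} {u xs w} → Path E u xs w → ∀ i j → toℕ j ≡ suc (toℕ i) →
  lookup xs j ∈ˢ E (lookup xs i)
lookup-step (_ ◅ e ◅ _) zero    (suc zero) _  = e
lookup-step (_ ◅ p)     (suc i) (suc j)    eq = lookup-step p i j (suc-injective eq)

lookup-first : ∀ {E : Fin n → Sub n} {u xs w} → Path E u xs w → ∀ j → toℕ j ≡ 0 → lookup xs j ∈ˢ E u
lookup-first (e ◅ _) zero _ = e

lookup-last : ∀ {E : Fin n → Sub n} {u xs w} → Path E u xs w → ∀ i → suc (toℕ i) ≡ length xs → lookup xs i ≡ w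
lookup-last (_ ◅ ε)     zero    _  = refl
lookup-last (_ ◅ e ◅ p) (suc i) eq = lookup-last (e ◅ p) i (suc-injective eq)

lookup-injective : ∀ {xs : List (Fin n)} → Unique xs → ∀ {i j} → lookup xs i ≡ lookup xs j → i ≡ j
lookup-injective (_  AllPairs.∷ _) {zero}  {zero}  _  = refl
lookup-injective (x≢ AllPairs.∷ _) {zero}  {suc j} eq = ⊥-elim (All.lookup x≢ (∈-lookup j) eq)
lookup-injective (x≢ AllPairs.∷ _) {suc i} {zero}  eq = ⊥-elim (All.lookup x≢ (∈-lookup i) (sym eq))
lookup-injective (_  AllPairs.∷ u) {suc i} {suc j} eq = cong suc (lookup-injective u eq)

fresh : ∀ {x : Fin n} {xs} → x ∉ xs → All (x ≢_) xs
fresh x∉xs = ¬Any⇒All¬ _ x∉xs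

-- A path of given length whose end and a few further vertices are fixed while
-- the others are chosen only once the obstacles are known. This halves the
-- number of vertices that the rest of the cycle has to avoid.

record Stem (E : Fin n → Sub n) (y : Fin n) (W : List (Fin n)) (j m k : ℕ) : Set where
  field
    fixed       : List (Fin n)
    end         : Fin n
    ∣fixed∣     : length fixed ≡ j
    end∈        : end ∈ y ∷ fixed
    fixed∉      : ∀ {z} → z ∈ fixed → z ∉ W
    route       : ∀ O → length O ≤ k → (∀ {z} → z ∈ fixed → z ∉ O) →
      ∃ λ st → Path E y st end × Unique st × length st ≡ m ×
        (∀ {z} → z ∈ st → z ∉ W) × (∀ {z} → z ∈ st → z ∉ O)

-- Construction of stems

private

  many-common-absurd : ∀ δ c → δ * (1 + 3 * c) ≤ 3 * δ * c → 1 ≤ δ → ⊥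
  many-common-absurd δ c h₁ h₂ = refute 0 (h₁ ⊞ h₂) (solve (δ ∷ c ∷ []))

  many-outside : ∀ c δ d e l o → 3 * c + l < δ → δ ≤ d → d ≤ o + e → e ≤ l → 1 + 3 * c ≤ o
  many-outside c δ d e l o h₁ h₂ h₃ h₄ = derive 0 (h₁ ⊞ h₂ ⊞ h₃ ⊞ h₄) (solve (d ∷ e ∷ l ∷ o ∷ c ∷ δ ∷ []))

  flexible-budget : ∀ k l δ → 3 * k + 4 * l < δ → 3 * (k + l) + l < δ
  flexible-budget k l δ h = derive 0 h (solve (k ∷ l ∷ δ ∷ []))

  stem-length : ∀ h ρ → 2 + (2 * h + ρ) ≡ 2 * suc h + ρ
  stem-length h ρ = solve (h ∷ ρ ∷ [])

  inner-budget : ∀ h ρ k w δ → 6 * suc h + 3 * k + 4 * (w + ρ) ≤ δ + 5 → 6 * h + 3 * (2 + k) + 4 * (w + ρ) ≤ δ + 5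
  inner-budget h ρ k w δ h₁ = derive 0 h₁ (solve (h ∷ ρ ∷ k ∷ w ∷ δ ∷ []))

  outer-budget : ∀ h ρ k w δ → 6 * suc h + 3 * k + 4 * (w + ρ) ≤ δ + 5 → 3 * k + 4 * (w + (h + ρ)) < δ
  outer-budget h ρ k w δ h₁ = derive 0 (h₁ ⊞ 2 ⊠ z≤n {h}) (solve (h ∷ ρ ∷ k ∷ w ∷ δ ∷ []))

module Stems (G : Digraph n δ) (y : Fin n) (W : List (Fin n)) where

  open Degrees G
  open Digraph G

  trivial-stem : ∀ k → Stem E y W 0 0 k
  trivial-stem k = record
    { fixed = [] ; end = y ; ∣fixed∣ = refl ; end∈ = here refl ; fixed∉ = λ ()
    ; route = λ _ _ _ → [] , ε , AllPairs.[] , refl , (λ ()) , λ () }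

  private
    append : ∀ {O} st ds {u w} → Path E u (st ++ ds) w → Unique st → Unique ds →
      (∀ {z} → z ∈ st → z ∉ W) → (∀ {z} → z ∈ st → z ∉ ds) → (∀ {z} → z ∈ st → z ∉ O) →
      (∀ {z} → z ∈ ds → z ∉ W) → (∀ {z} → z ∈ ds → z ∉ O) → ∀ {m} → length st + length ds ≡ m →
      ∃ λ st → Path E u st w × Unique st × length st ≡ m ×
        (∀ {z} → z ∈ st → z ∉ W) × (∀ {z} → z ∈ st → z ∉ O)
    append st ds p ust uds st∉W st∉ds st∉O ds∉W ds∉O len =
      st ++ ds , p , Unique.++⁺ ust uds (λ (z∈st , z∈ds) → st∉ds z∈st z∈ds) ,
      trans (length-++ st) len ,
      (λ z∈ → [ st∉W , ds∉W ]′ (∈-++⁻ st z∈)) , (λ z∈ → [ st∉O , ds∉O ]′ (∈-++⁻ st z∈))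

  fixed-step : ∀ {j m k} → Stem E y W j m (suc k) → length W + j < δ → Stem E y W (suc j) (suc m) k
  fixed-step {j} {m} {k} S few with pickAvoiding (N⁺ (Stem.end S)) (W ++ Stem.fixed S)
    (≤-trans (s≤s (≤-reflexive (trans (length-++ W) (cong (length W +_) (Stem.∣fixed∣ S))))) (≤-trans few (deg⁺ _)))
  ... | p , s⟶p , p∉ = record
    { fixed = p ∷ fixed ; end = p ; ∣fixed∣ = cong suc ∣fixed∣ ; end∈ = there (here refl)
    ; fixed∉ = λ { (here refl) → p∉ ∘ ∈-++⁺ˡ ; (there z∈) → fixed∉ z∈ }
    ; route = λ O len O∉ →
        let st , path , unique , ∣st∣ , st∉W , st∉O = route (p ∷ O) (s≤s len)
              λ { z∈ (here refl) → p∉ (∈-++⁺ʳ W z∈) ; z∈ (there z∈O) → O∉ (there z∈) z∈O }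
        in append st [ p ] (path ◅◅ s⟶p ◅ ε) unique (All.[] AllPairs.∷ AllPairs.[]) st∉W
             (λ { z∈ (here refl) → st∉O z∈ (here refl) }) (λ z∈ → st∉O z∈ ∘ there)
             (λ { (here refl) → p∉ ∘ ∈-++⁺ˡ }) (λ { (here refl) → O∉ (here refl) })
             (trans (+-comm (length st) 1) (cong suc ∣st∣)) }
    where open Stem S

  -- Each vertex of `N⁺ s` has at least `3 c + 1` out-neighbours outside `L`. At most `3 δ` vertices
  -- share these arcs, so one of them receives more than `c`.
  many-common : ∀ s (L : List (Fin n)) c → 3 * c + length L < δ → ∃ λ p → p ∉ L × c < ∣ N⁺ s ∩ N⁻ p ∣
  many-common s L c few = decide (Fin.any? λ p → (F p Bool.≟ true) ×-dec (suc c ≤? ∣ N⁺ s ∩ N⁻ p ∣))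
    where
    F : Sub n
    F = ∁ (elem L)
    outside : ∀ d → 1 + 3 * c ≤ ∣ F ∩ N⁺ d ∣
    outside d = many-outside c δ (∣ N⁺ d ∣) (∣ elem L ∣) (length L) (∣ F ∩ N⁺ d ∣) few (deg⁺ d)
      (cover (N⁺ d) (F ∩ N⁺ d) (elem L) split) (∣elem∣≤length L)
      where
      split : ∀ i → i ∈ˢ N⁺ d → i ∈ˢ F ∩ N⁺ d ⊎ i ∈ˢ elem L
      split i d⟶i with i ∈ˢ? elem L
      ... | inj₁ i∈L = inj₂ i∈L
      ... | inj₂ i∉L = inj₁ (∩⁺ F (N⁺ d) (∁⁺ (elem L) i∉L) d⟶i)
    total : (∀ p → p ∈ˢ F → ¬ c < ∣ N⁺ s ∩ N⁻ p ∣) → δ * (1 + 3 * c) ≤ 3 * δ * c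
    total none = begin
      δ * (1 + 3 * c)                        ≤⟨ *-monoˡ-≤ _ (deg⁺ s) ⟩
      ∣ N⁺ s ∣ * (1 + 3 * c)                 ≡⟨ sumOver-const (N⁺ s) (1 + 3 * c) ⟨
      sumOver (N⁺ s) (λ _ → 1 + 3 * c)       ≤⟨ sumOver-mono (N⁺ s) (λ d _ → outside d) ⟩
      sumOver (N⁺ s) (λ d → ∣ F ∩ N⁺ d ∣)    ≡⟨ sumOver-swap (N⁺ s) F E ⟩
      sumOver F (λ p → ∣ N⁺ s ∩ N⁻ p ∣)      ≤⟨ sumOver-mono F (λ p p∈ → ≮⇒≥ (none p p∈)) ⟩
      sumOver F (λ _ → c)                    ≡⟨ sumOver-const F c ⟩
      ∣ F ∣ * c                              ≤⟨ *-monoˡ-≤ c (≤-trans (∣∣≤n F) n≤3δ) ⟩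
      3 * δ * c                              ∎
      where open ≤-Reasoning
    decide : Dec (∃ λ p → p ∈ˢ F × c < ∣ N⁺ s ∩ N⁻ p ∣) → ∃ λ p → p ∉ L × c < ∣ N⁺ s ∩ N⁻ p ∣
    decide (yes (p , p∈F , many)) = p , ∁⁻ (elem L) p∈F ∘ elem⁺ , many
    decide (no none) = ⊥-elim (many-common-absurd δ c
      (total λ p p∈ many → none (p , p∈ , many)) (≤-trans (s≤s z≤n) few))

  -- Only `p` is fixed. More than `k + length W + j` vertices `d` lie between the old end and `p`,
  -- so one survives whatever obstacles are revealed later. Then `d` and `p` become obstacles for
  -- the earlier part, hence `2 + k`.
  flexible-step : ∀ {j m k} → Stem E y W j m (2 + k) → 3 * k + 4 * (length W + j) < δ → Stem E y W (suc j) (2 + m) k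
  flexible-step {j} {m} {k} S few with many-common (Stem.end S) (W ++ Stem.fixed S) (k + (length W + j))
    (subst (λ l → 3 * (k + (length W + j)) + l < δ)
      (sym (trans (length-++ W) (cong (length W +_) (Stem.∣fixed∣ S)))) (flexible-budget k (length W + j) δ few))
  ... | p , p∉ , many = record
    { fixed = p ∷ fixed ; end = p ; ∣fixed∣ = cong suc ∣fixed∣ ; end∈ = there (here refl)
    ; fixed∉ = λ { (here refl) → p∉ ∘ ∈-++⁺ˡ ; (there z∈) → fixed∉ z∈ }
    ; route = via }
    where
    open Stem S
    via : ∀ O → length O ≤ k → (∀ {z} → z ∈ p ∷ fixed → z ∉ O) →
      ∃ λ st → Path E y st p × Unique st × length st ≡ 2 + m ×
        (∀ {z} → z ∈ st → z ∉ W) × (∀ {z} → z ∈ st → z ∉ O)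
    via O len O∉ with pickAvoiding (N⁺ end ∩ N⁻ p) (O ++ W ++ fixed) (≤-trans (s≤s
        (≤-trans (≤-reflexive (length-++ O)) (+-mono-≤ len
          (≤-reflexive (trans (length-++ W) (cong (length W +_) ∣fixed∣)))))) many)
    ... | d , d∈ , d∉ =
      let s⟶d , d⟶p = ∩⁻ (N⁺ end) (N⁻ p) d∈
          st , path , unique , ∣st∣ , st∉W , st∉O = route (d ∷ p ∷ O) (s≤s (s≤s len))
            λ { z∈ (here refl) → d∉ (∈-++⁺ʳ O (∈-++⁺ʳ W z∈))
              ; z∈ (there (here refl)) → p∉ (∈-++⁺ʳ W z∈)
              ; z∈ (there (there z∈O)) → O∉ (there z∈) z∈O }
      in append st (d ∷ p ∷ []) (path ◅◅ s⟶d ◅ d⟶p ◅ ε) unique ((⟶⇒≢ d⟶p All.∷ All.[]) AllPairs.∷ All.[] AllPairs.∷ AllPairs.[]) st∉W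
           (λ { z∈ (here refl) → st∉O z∈ (here refl) ; z∈ (there (here refl)) → st∉O z∈ (there (here refl)) })
           (λ z∈ → st∉O z∈ ∘ there ∘ there)
           (λ { (here refl) → d∉ ∘ ∈-++⁺ʳ O ∘ ∈-++⁺ˡ ; (there (here refl)) → p∉ ∘ ∈-++⁺ˡ })
           (λ { (here refl) → d∉ ∘ ∈-++⁺ˡ ; (there (here refl)) → O∉ (here refl) })
           (trans (+-comm (length st) 2) (cong (2 +_) ∣st∣))

  greedy-stem : ∀ ρ k → length W + ρ ≤ δ → Stem E y W ρ ρ k
  greedy-stem zero    k few = trivial-stem k
  greedy-stem (suc ρ) k few = fixed-step (greedy-stem ρ (suc k) (≤-trans (n≤1+n _) few′)) few′
    where few′ = subst (_≤ δ) (+-suc (length W) ρ) few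

  -- The budget is that of the first flexible step, which has to tolerate two vertices from each of
  -- the `h - 1` later ones besides the final `k` obstacles.
  stem : ∀ ρ h k → length W + ρ ≤ δ → 6 * h + 3 * k + 4 * (length W + ρ) ≤ δ + 5 → Stem E y W (h + ρ) (2 * h + ρ) k
  stem ρ zero    k few few′ = greedy-stem ρ k few
  stem ρ (suc h) k few few′ = subst (λ m → Stem E y W (suc (h + ρ)) m k) (stem-length h ρ)
    (flexible-step (stem ρ h (2 + k) few (inner-budget h ρ k (length W) δ few′)) (outer-budget h ρ k (length W) δ few′))

-- Vertices reachable by two paths whose lengths differ by one

data Fork (E : Fin n → Sub n) (v : Fin n) : Fin n → List (Fin n) → List (Fin n) → Set where
  near : ∀ {y b} → y ∈ˢ E v → b ∈ˢ E v → y ∈ˢ E b → Fork E v y [] [ b ]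
  far  : ∀ {y i j b} → i ∈ˢ E v → y ∈ˢ E i → j ∈ˢ E v → b ∈ˢ E j → y ∈ˢ E b → i ≢ b →
    Fork E v y [ i ] (j ∷ b ∷ [])

module _ where

  private
    variable
      v x y : Fin n
      is il os ol : List (Fin n)

  shortPath : ∀ {E : Fin n → Sub n} → Fork E v y os ol → Path E v (os ∷ʳ y) y
  shortPath (near vy _ _)        = vy ◅ ε
  shortPath (far vi iy _ _ _ _)  = vi ◅ iy ◅ ε

  longPath : ∀ {E : Fin n → Sub n} → Fork E v y os ol → Path E v (ol ∷ʳ y) y
  longPath (near _ vb by)        = vb ◅ by ◅ ε
  longPath (far _ _ vj jb by _)  = vj ◅ jb ◅ by ◅ ε

  shortPathᵀ : ∀ {E : Fin n → Sub n} → Fork (flip E) v x is il → Path E x (reverse is ∷ʳ v) v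
  shortPathᵀ (near xv _ _)       = xv ◅ ε
  shortPathᵀ (far iv xi _ _ _ _) = xi ◅ iv ◅ ε

  longPathᵀ : ∀ {E : Fin n → Sub n} → Fork (flip E) v x is il → Path E x (reverse il ∷ʳ v) v
  longPathᵀ (near _ bv xb)       = xb ◅ bv ◅ ε
  longPathᵀ (far _ _ jv bj xb _) = xb ◅ bj ◅ jv ◅ ε

  ∣long∣ : ∀ {E : Fin n → Sub n} → Fork E v y os ol → length ol ≡ suc (length os)
  ∣long∣ (near _ _ _)        = refl
  ∣long∣ (far _ _ _ _ _ _)   = refl

  -- Two distinct in-neighbours of `y` that are obstacles anyway; they take nothing from its
  -- out-neighbourhood. The condition `i ≢ b` in `far` is there for this.
  Fork-ends : ∀ {E : Fin n → Sub n} → (∀ {u} → u ∉ˢ E u) → Fork E v y os ol →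
    ∃ λ p → ∃ λ q → p ∈ v ∷ os × q ∈ ol × y ∈ˢ E p × y ∈ˢ E q × p ≢ q
  Fork-ends irr (near vy vb by)         = _ , _ , here refl , here refl , vy , by , λ { refl → irr vb }
  Fork-ends irr (far vi iy vj jb by i≢b) = _ , _ , there (here refl) , there (here refl) , iy , by , i≢b

  ∈-∷ʳ⁻ : ∀ (xs : List (Fin n)) {y z} → z ∈ xs ∷ʳ y → z ∈ y ∷ xs
  ∈-∷ʳ⁻ xs z∈ with ∈-++⁻ xs z∈
  ... | inj₁ z∈xs       = there z∈xs
  ... | inj₂ (here z≡y) = here z≡y

  reverse-∈ : ∀ {E : Fin n → Sub n} → Fork E v x is il →
    (∀ {z} → z ∈ reverse is → z ∈ is) × (∀ {z} → z ∈ reverse il → z ∈ il)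
  reverse-∈ (near _ _ _) = (λ ()) , λ z∈ → z∈
  reverse-∈ (far _ _ _ _ _ _) = (λ z∈ → z∈) , λ where
    (here z≡)         → there (here z≡)
    (there (here z≡)) → here z≡

module ForkProperties (G : Digraph n δ) where

  open Degrees G
  open Digraph G

  private
    variable
      v x y : Fin n
      is il os ol : List (Fin n)

    irr : ∀ {u} → ¬ u ⟶ u
    irr u⟶u = asym u⟶u u⟶u

    unique₂ : ∀ {a b : Fin n} → a ≢ b → Unique (a ∷ b ∷ [])
    unique₂ a≢b = (a≢b All.∷ All.[]) AllPairs.∷ All.[] AllPairs.∷ AllPairs.[]

    unique₃ : ∀ {a b c : Fin n} → a ≢ b → a ≢ c → b ≢ c → Unique (a ∷ b ∷ c ∷ [])
    unique₃ a≢b a≢c b≢c = (a≢b All.∷ a≢c All.∷ All.[]) AllPairs.∷ unique₂ b≢c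

  short-unique : Fork E v y os ol → Unique (os ∷ʳ y)
  short-unique (near _ _ _)         = All.[] AllPairs.∷ AllPairs.[]
  short-unique (far _ iy _ _ _ _)   = unique₂ (⟶⇒≢ iy)

  long-unique : Fork E v y os ol → Unique (ol ∷ʳ y)
  long-unique (near _ _ by)         = unique₂ (⟶⇒≢ by)
  long-unique (far _ _ _ jb by _)   = unique₃ (⟶⇒≢ jb) (λ { refl → asym jb by }) (⟶⇒≢ by)

  centre∉ : Fork E v y os ol → v ∉ y ∷ os ++ ol
  centre∉ (near vy vb by)          (here refl)                         = irr vy
  centre∉ (near vy vb by)          (there (here refl))                 = irr vb
  centre∉ (far vi iy vj jb by _)   (here refl)                         = asym vi iy
  centre∉ (far vi iy vj jb by _)   (there (here refl))                 = irr vi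
  centre∉ (far vi iy vj jb by _)   (there (there (here refl)))         = irr vj
  centre∉ (far vi iy vj jb by _)   (there (there (there (here refl)))) = asym vj jb

  end∉ : Fork E v y os ol → y ∉ os ++ ol
  end∉ (near vy vb by)         (here refl)                 = irr by
  end∉ (far vi iy vj jb by _)  (here refl)                 = irr iy
  end∉ (far vi iy vj jb by _)  (there (here refl))         = asym jb by
  end∉ (far vi iy vj jb by _)  (there (there (here refl))) = irr by

  short-uniqueᵀ : Fork N⁻ v x is il → Unique (reverse is ∷ʳ v)
  short-uniqueᵀ (near _ _ _)        = All.[] AllPairs.∷ AllPairs.[]
  short-uniqueᵀ (far iv _ _ _ _ _)  = unique₂ (⟶⇒≢ iv)

  long-uniqueᵀ : Fork N⁻ v x is il → Unique (reverse il ∷ʳ v)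
  long-uniqueᵀ (near _ bv _)        = unique₂ (⟶⇒≢ bv)
  long-uniqueᵀ (far _ _ jv bj _ _)  = unique₃ (⟶⇒≢ bj) (λ { refl → asym bj jv }) (⟶⇒≢ jv)

private

  size-bound : ∀ δ d c α κ k → δ ≤ d → d ≤ c + α → c + κ ≤ k → δ + κ ≤ k + α
  size-bound δ d c α κ k h₁ h₂ h₃ = derive 0 (h₁ ⊞ h₂ ⊞ h₃) (solve (δ ∷ d ∷ c ∷ α ∷ κ ∷ k ∷ []))

  nine : ∀ δ α κ f e k → δ + κ ≤ k + α → 1 ≤ κ → k ≤ f + e + 4 → f + e + 12 ≤ δ → 9 ≤ α
  nine δ α κ f e k h₁ h₂ h₃ h₄ = derive 0 (h₁ ⊞ h₂ ⊞ h₃ ⊞ h₄) (solve (δ ∷ α ∷ κ ∷ f ∷ e ∷ k ∷ []))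

  -- Removing `K` leaves `α + β ≥ 2 δ - 2 f - 2 e - 4`, and the claim becomes
  -- `2 δ > 18 f + 6 e + 2`.
  large-bound : ∀ δ α β f e k → δ + 1 ≤ k + α → δ + 3 ≤ k + β → k ≤ f + e + 4 → 9 * f + 3 * e + 1 < δ →
    4 * δ + 12 * f < 3 * (α + β) + 10
  large-bound δ α β f e k h₁ h₂ h₃ h₄ = derive 1 (3 ⊠ h₁ ⊞ 3 ⊠ h₂ ⊞ 6 ⊠ h₃ ⊞ 2 ⊠ h₄)
    (solve (δ ∷ α ∷ β ∷ f ∷ e ∷ k ∷ []))

  large-bound′ : ∀ δ α β f e k → δ + 2 ≤ k + α → δ + 3 ≤ k + β → k ≤ f + e + 4 → 9 * f + 3 * e ≤ δ →
    4 * δ + 12 * f < 3 * (α + β) + 10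
  large-bound′ δ α β f e k h₁ h₂ h₃ h₄ = derive 0 (3 ⊠ h₁ ⊞ 3 ⊠ h₂ ⊞ 6 ⊠ h₃ ⊞ 2 ⊠ h₄)
    (solve (δ ∷ α ∷ β ∷ f ∷ e ∷ k ∷ []))

  hard-length : ∀ a b j → 3 + (a + (b + j)) ≡ 2 + (1 + (a + b) + j)
  hard-length a b j = solve (a ∷ b ∷ j ∷ [])

  soft-length : ∀ a b j → 3 + (a + (b + j)) + (suc a + suc b) ≡ 1 + (a + b) + j + (a + b) + 4
  soft-length a b j = solve (a ∷ b ∷ j ∷ [])

  length₃ : ∀ a b m → suc a + 1 + (suc b + 1 + (m + 3)) ≡ m + 7 + (a + b)
  length₃ a b m = solve (a ∷ b ∷ m ∷ [])

  length₄ : ∀ a b m → suc a + 1 + (b + 1 + (m + 4)) ≡ m + 7 + (a + b)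
  length₄ a b m = solve (a ∷ b ∷ m ∷ [])

  length₄′ : ∀ a b m → a + 1 + (suc b + 1 + (m + 4)) ≡ m + 7 + (a + b)
  length₄′ a b m = solve (a ∷ b ∷ m ∷ [])

  length₅ : ∀ a b m → a + 1 + (b + 1 + (m + 5)) ≡ m + 7 + (a + b)
  length₅ a b m = solve (a ∷ b ∷ m ∷ [])

-- A fork towards v and one away from v give paths of three consecutive lengths
-- through v; continued by a stem, they are closed by a connection of length
-- three, four or five.

gadgetVertices : (x v y : Fin n) (is il os ol : List (Fin n)) → List (Fin n)
gadgetVertices x v y is il os ol = x ∷ v ∷ y ∷ is ++ os ++ il ++ ol

module Gadget (G : Digraph n δ) {v x y : Fin n} {is il os ol : List (Fin n)}
  (into : Fork (flip (Digraph.E G)) v x is il) (from : Fork (Digraph.E G) v y os ol)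
  (disjoint : ∀ {z} → z ∈ x ∷ is ++ il → z ∉ y ∷ os ++ ol)
  {j m : ℕ} (S : Stem (Digraph.E G) y (gadgetVertices x v y is il os ol) j m 4) where

  open Degrees G
  open Digraph G
  open ForkProperties G
  private module Fᵀ = ForkProperties (G ᵀ)
  open Stem S

  private
    e f : ℕ
    e = length is + length os
    f = 1 + e + j

    W H K : List (Fin n)
    W = gadgetVertices x v y is il os ol
    H = x ∷ v ∷ y ∷ is ++ os ++ fixed
    K = H ++ il ++ ol

    H⊆K : ∀ {z} → z ∈ H → z ∈ K
    H⊆K = ∈-++⁺ˡ

    s∈H : end ∈ H
    s∈H with end∈
    ... | here refl = there (there (here refl))
    ... | there s∈  = there (there (there (∈-++⁺ʳ is (∈-++⁺ʳ os s∈))))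

    x≢y : x ≢ y
    x≢y refl = disjoint (here refl) (here refl)

    s≢x : end ≢ x
    s≢x refl with end∈
    ... | here refl = x≢y refl
    ... | there s∈  = fixed∉ s∈ (here refl)

    ∣H∣ : length H ≡ 2 + f
    ∣H∣ rewrite length-++ is {os ++ fixed} | length-++ os {fixed} | ∣fixed∣ = hard-length (length is) (length os) j

    ∣K∣ : length K ≡ f + e + 4
    ∣K∣ rewrite length-++ H {il ++ ol} | length-++ is {os ++ fixed} | length-++ os {fixed} | ∣fixed∣
      | length-++ il {ol} | ∣long∣ into | ∣long∣ from = soft-length (length is) (length os) j

    open Connection G end x s≢x H K s∈H (here refl) H⊆K f (≤-reflexive ∣H∣)

    is⊆H : ∀ {z} → z ∈ is → z ∈ H
    is⊆H z∈ = there (there (there (∈-++⁺ˡ z∈)))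

    os⊆H : ∀ {z} → z ∈ os → z ∈ H
    os⊆H z∈ = there (there (there (∈-++⁺ʳ is (∈-++⁺ˡ z∈))))

    fixed⊆H : ∀ {z} → z ∈ fixed → z ∈ H
    fixed⊆H z∈ = there (there (there (∈-++⁺ʳ is (∈-++⁺ʳ os z∈))))

    il⊆K : ∀ {z} → z ∈ il → z ∈ K
    il⊆K z∈ = ∈-++⁺ʳ H (∈-++⁺ˡ z∈)

    ol⊆K : ∀ {z} → z ∈ ol → z ∈ K
    ol⊆K z∈ = ∈-++⁺ʳ H (∈-++⁺ʳ il z∈)

    -- `x` itself and its two out-neighbours on the fork lie in `K` but not in `N⁻ x`.
    sizeB : δ + 3 ≤ length K + ∣ B ∣
    sizeB with Fork-ends (λ u⟶u → asym u⟶u u⟶u) into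
    ... | p , q , p∈ , q∈ , xp , xq , p≢q = size-bound δ (∣ N⁻ x ∣) (∣ N⁻ x ∩ elem K ∣) (∣ B ∣) 3 (length K)
      (deg⁻ x) (∣∣-split (N⁻ x) (elem K))
      (∣∩elem∣+length≤ (N⁻ x) K (x ∷ p ∷ q ∷ [])
        ((⟶⇒≢ xp All.∷ ⟶⇒≢ xq All.∷ All.[]) AllPairs.∷ (p≢q All.∷ All.[]) AllPairs.∷ All.[] AllPairs.∷ AllPairs.[])
        (λ { (here refl) → here refl
           ; (there (here refl)) → H⊆K (v∷is⊆H p∈)
           ; (there (there (here refl))) → il⊆K q∈ })
        λ { (here refl) xx → asym xx xx ; (there (here refl)) → asym xp ; (there (there (here refl))) → asym xq })
      where
      v∷is⊆H : ∀ {z} → z ∈ v ∷ is → z ∈ H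
      v∷is⊆H (here refl) = there (here refl)
      v∷is⊆H (there z∈)  = is⊆H z∈

    sizeA : δ + 1 ≤ length K + ∣ A ∣
    sizeA = size-bound δ (∣ N⁺ end ∣) (∣ N⁺ end ∩ elem K ∣) (∣ A ∣) 1 (length K)
      (deg⁺ end) (∣∣-split (N⁺ end) (elem K))
      (∣∩elem∣+length≤ (N⁺ end) K [ end ] (All.[] AllPairs.∷ AllPairs.[])
        (λ { (here refl) → H⊆K s∈H }) λ { (here refl) ss → asym ss ss })

    -- If no stem vertex is fixed, the connection starts at `y`, and the in-neighbour of `y` on the
    -- long path is saved too. This lowers the threshold for `δ` by two, as nine-cycles through two
    -- far forks require.
    sizeA′ : j ≡ 0 → δ + 2 ≤ length K + ∣ A ∣
    sizeA′ j≡0 with Fork-ends (λ u⟶u → asym u⟶u u⟶u) from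
    ... | _ , q , _ , q∈ , _ , qy , _ = size-bound δ (∣ N⁺ end ∣) (∣ N⁺ end ∩ elem K ∣) (∣ A ∣) 2 (length K)
      (deg⁺ end) (∣∣-split (N⁺ end) (elem K))
      (∣∩elem∣+length≤ (N⁺ end) K (end ∷ q ∷ [])
        (((λ { refl → asym q⟶s q⟶s }) All.∷ All.[]) AllPairs.∷ All.[] AllPairs.∷ AllPairs.[])
        (λ { (here refl) → H⊆K s∈H ; (there (here refl)) → ol⊆K q∈ })
        λ { (here refl) ss → asym ss ss ; (there (here refl)) → asym q⟶s })
      where
      s≡y : ∀ {xs} → length xs ≡ j → end ∈ y ∷ xs → end ≡ y
      s≡y {[]}     _   (here refl) = refl
      s≡y {_ ∷ _}  len _ with () ← trans len j≡0
      q⟶s : q ⟶ end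
      q⟶s = subst (q ⟶_) (sym (s≡y ∣fixed∣ end∈)) qy

    large : 9 * f + 3 * e + 1 < δ ⊎ (j ≡ 0 × 9 * f + 3 * e ≤ δ) → 4 * δ + 12 * f < 3 * (∣ A ∣ + ∣ B ∣) + 10
    large (inj₁ h)         = large-bound δ (∣ A ∣) (∣ B ∣) f e (length K) sizeA sizeB (≤-reflexive ∣K∣) h
    large (inj₂ (j≡0 , h)) = large-bound′ δ (∣ A ∣) (∣ B ∣) f e (length K) (sizeA′ j≡0) sizeB (≤-reflexive ∣K∣) h

  module _ {ℓ : ℕ} (ℓ≡ : m + 7 + e ≡ ℓ) where

    private
      close : ∀ {gi go} O → Path E x (gi ∷ʳ v) v → Path E v (go ∷ʳ y) y → Unique (gi ∷ʳ v) → Unique (go ∷ʳ y) →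
        (∀ {z} → z ∈ gi → z ∈ is ++ il) → (∀ {z} → z ∈ go → z ∈ os ++ ol) →
        Path E end (O ∷ʳ x) x → Unique O → length O ≤ 4 →
        (∀ {z} → z ∈ O → z ∉ H) → (∀ {z} → z ∈ O → z ∉ gi) → (∀ {z} → z ∈ O → z ∉ go) →
        length gi + 1 + (length go + 1 + (m + suc (length O))) ≡ ℓ → Cycle E ℓ v
      close {gi} {go} O pi po ui uo gi⊆ go⊆ pc uc ∣O∣≤4 O∉H O∉gi O∉go len
        with route O ∣O∣≤4 (λ z∈ z∈O → O∉H z∈O (fixed⊆H z∈))
      ... | st , ps , us , ∣st∣ , st∉W , st∉O =
        (gi ∷ʳ v) ++ (go ∷ʳ y) ++ st ++ (O ∷ʳ x) , trans total len , (x , pi ◅◅ po ◅◅ ps ◅◅ pc) ,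
        Unique.++⁺ ui (Unique.++⁺ uo (Unique.++⁺ us (Unique.++⁺ uc (All.[] AllPairs.∷ AllPairs.[]) O∥x) st∥O)
          go∥) gi∥ ,
        ∈-++⁺ˡ (∈-++⁺ʳ gi (here refl))
        where
        total : length ((gi ∷ʳ v) ++ (go ∷ʳ y) ++ st ++ (O ∷ʳ x)) ≡ length gi + 1 + (length go + 1 + (m + suc (length O)))
        total rewrite length-++ (gi ∷ʳ v) {(go ∷ʳ y) ++ st ++ (O ∷ʳ x)} | length-++ (go ∷ʳ y) {st ++ (O ∷ʳ x)}
          | length-++ st {O ∷ʳ x} | length-++ gi {[ v ]} | length-++ go {[ y ]} | length-++ O {[ x ]} | ∣st∣
          | +-comm (length O) 1 = refl
        in⊆W : ∀ {z} → z ∈ v ∷ gi → z ∈ W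
        in⊆W (here refl) = there (here refl)
        in⊆W (there z∈) with ∈-++⁻ is (gi⊆ z∈)
        ... | inj₁ z∈is = there (there (there (∈-++⁺ˡ z∈is)))
        ... | inj₂ z∈il = there (there (there (∈-++⁺ʳ is (∈-++⁺ʳ os (∈-++⁺ˡ z∈il)))))
        out⊆W : ∀ {z} → z ∈ y ∷ go → z ∈ W
        out⊆W (here refl) = there (there (here refl))
        out⊆W (there z∈) with ∈-++⁻ os (go⊆ z∈)
        ... | inj₁ z∈os = there (there (there (∈-++⁺ʳ is (∈-++⁺ˡ z∈os))))
        ... | inj₂ z∈ol = there (there (there (∈-++⁺ʳ is (∈-++⁺ʳ os (∈-++⁺ʳ il z∈ol)))))
        out⊆ : ∀ {z} → z ∈ y ∷ go → z ∈ y ∷ os ++ ol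
        out⊆ (here refl) = here refl
        out⊆ (there z∈)  = there (go⊆ z∈)
        O∥x : ∀ {z} → z ∈ O × z ∈ [ x ] → ⊥
        O∥x (z∈O , here refl) = O∉H z∈O (here refl)
        st∥O : ∀ {z} → z ∈ st × z ∈ O ∷ʳ x → ⊥
        st∥O (z∈st , z∈) with ∈-∷ʳ⁻ O z∈
        ... | here refl = st∉W z∈st (here refl)
        ... | there z∈O = st∉O z∈st z∈O
        go∥ : ∀ {z} → z ∈ go ∷ʳ y × z ∈ st ++ (O ∷ʳ x) → ⊥
        go∥ (z∈go , z∈) with ∈-++⁻ st z∈
        ... | inj₁ z∈st = st∉W z∈st (out⊆W (∈-∷ʳ⁻ go z∈go))
        ... | inj₂ z∈Ox with ∈-∷ʳ⁻ O z∈Ox | ∈-∷ʳ⁻ go z∈go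
        ...   | here refl | z∈′       = disjoint (here refl) (out⊆ z∈′)
        ...   | there z∈O | here refl = O∉H z∈O (there (there (here refl)))
        ...   | there z∈O | there z∈′ = O∉go z∈O z∈′
        gi∥ : ∀ {z} → z ∈ gi ∷ʳ v × z ∈ (go ∷ʳ y) ++ st ++ (O ∷ʳ x) → ⊥
        gi∥ (z∈gi , z∈) with ∈-∷ʳ⁻ gi z∈gi | ∈-++⁻ (go ∷ʳ y) z∈
        ... | here refl  | inj₁ z∈go = centre∉ from (out⊆ (∈-∷ʳ⁻ go z∈go))
        ... | there z∈gi | inj₁ z∈go = disjoint (there (gi⊆ z∈gi)) (out⊆ (∈-∷ʳ⁻ go z∈go))
        ... | z∈′        | inj₂ z∈r with ∈-++⁻ st z∈r
        ...   | inj₁ z∈st = st∉W z∈st (in⊆W z∈′)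
        ...   | inj₂ z∈Ox with ∈-∷ʳ⁻ O z∈Ox | z∈′
        ...     | here refl | here refl  = Fᵀ.centre∉ into (here refl)
        ...     | here refl | there z∈gi = Fᵀ.end∉ into (gi⊆ z∈gi)
        ...     | there z∈O | here refl  = O∉H z∈O (there (here refl))
        ...     | there z∈O | there z∈gi = O∉gi z∈O z∈gi

    through-gadget : f + e + 12 ≤ δ → 9 * f + 3 * e + 1 < δ ⊎ (j ≡ 0 × 9 * f + 3 * e ≤ δ) → Cycle E ℓ v
    through-gadget room budget = decidable-stable (cycle? E ℓ v) λ none → connection
      (≤-trans (+-monoʳ-≤ f (≤-trans (s≤s (s≤s z≤n)) (m≤n+m 12 e))) (≤-trans (≤-reflexive (sym (+-assoc f e 12))) room))
      (nine δ (∣ A ∣) 1 f e (length K) sizeA (s≤s z≤n) (≤-reflexive ∣K∣) room)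
      (nine δ (∣ B ∣) 3 f e (length K) sizeB (s≤s z≤n) (≤-reflexive ∣K∣) room)
      (large budget)
      (λ a b a∈ b∈ ab → none (connect₃ a b a∈ b∈ ab))
      (λ a u b a∈ b∈ u∉ au ub → none (connect₄ a u b a∈ b∈ u∉ au ub))
      (λ a u w b a∈ b∈ u∉ w∉ a≢b au uw wb → none (connect₅ a u w b a∈ b∈ u∉ w∉ a≢b au uw wb))
      where
      A⁻ : ∀ {a} → a ∈ˢ A → end ⟶ a × a ∉ K
      A⁻ a∈ = let p , q = ∖⁻ (N⁺ end) (elem K) a∈ in p , q ∘ elem⁺

      B⁻ : ∀ {b} → b ∈ˢ B → b ⟶ x × b ∉ K
      B⁻ b∈ = let p , q = ∖⁻ (N⁻ x) (elem K) b∈ in p , q ∘ elem⁺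

      ris⊆ : ∀ {z} → z ∈ reverse is → z ∈ is ++ il
      ris⊆ z∈ = ∈-++⁺ˡ (proj₁ (reverse-∈ into) z∈)

      ril⊆ : ∀ {z} → z ∈ reverse il → z ∈ is ++ il
      ril⊆ z∈ = ∈-++⁺ʳ is (proj₂ (reverse-∈ into) z∈)

      connect₃ : ∀ a b → a ∈ˢ A → b ∈ˢ B → a ⟶ b → Cycle E ℓ v
      connect₃ a b a∈ b∈ ab = close (a ∷ b ∷ []) (longPathᵀ into) (longPath from)
        (long-uniqueᵀ into) (long-unique from) ril⊆ (∈-++⁺ʳ os)
        (proj₁ (A⁻ a∈) ◅ ab ◅ proj₁ (B⁻ b∈) ◅ ε)
        ((⟶⇒≢ ab All.∷ All.[]) AllPairs.∷ All.[] AllPairs.∷ AllPairs.[]) (s≤s (s≤s z≤n))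
        (λ z∈ → O∉K z∈ ∘ H⊆K) (λ z∈ → O∉K z∈ ∘ il⊆K ∘ proj₂ (reverse-∈ into)) (λ z∈ → O∉K z∈ ∘ ol⊆K)
        (trans (cong₂ (λ g h → g + 1 + (h + 1 + (m + 3))) (trans (length-reverse il) (∣long∣ into)) (∣long∣ from))
          (trans (length₃ (length is) (length os) m) ℓ≡))
        where
        O∉K : ∀ {z} → z ∈ a ∷ b ∷ [] → z ∉ K
        O∉K (here refl)         = proj₂ (A⁻ a∈)
        O∉K (there (here refl)) = proj₂ (B⁻ b∈)

      module _ (a u b : Fin n) (a∈ : a ∈ˢ A) (b∈ : b ∈ˢ B) (u∉ : u ∉ H) (au : a ⟶ u) (ub : u ⟶ b) where

        private
          O : List (Fin n)
          O = a ∷ u ∷ b ∷ []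

          O-path : Path E end (O ∷ʳ x) x
          O-path = proj₁ (A⁻ a∈) ◅ au ◅ ub ◅ proj₁ (B⁻ b∈) ◅ ε

          O-unique : Unique O
          O-unique = (⟶⇒≢ au All.∷ (λ { refl → asym au ub }) All.∷ All.[]) AllPairs.∷
            (⟶⇒≢ ub All.∷ All.[]) AllPairs.∷ All.[] AllPairs.∷ AllPairs.[]

          O∉ : ∀ {z L} → (∀ {z} → z ∈ L → z ∈ K) → u ∉ L → z ∈ O → z ∉ L
          O∉ L⊆K u∉L (here refl)                 = proj₂ (A⁻ a∈) ∘ L⊆K
          O∉ L⊆K u∉L (there (here refl))         = u∉L
          O∉ L⊆K u∉L (there (there (here refl))) = proj₂ (B⁻ b∈) ∘ L⊆K

        connect₄ : Cycle E ℓ v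
        -- `u` may lie on one of the long paths but not on both, the forks being disjoint; the cycle
        -- takes one that misses `u`.
        connect₄ with u ∈? il
        ... | no u∉il = close O (longPathᵀ into) (shortPath from) (long-uniqueᵀ into) (short-unique from)
          ril⊆ ∈-++⁺ˡ O-path O-unique (s≤s (s≤s (s≤s z≤n)))
          (O∉ H⊆K u∉) (O∉ (il⊆K ∘ proj₂ (reverse-∈ into)) (u∉il ∘ proj₂ (reverse-∈ into))) (O∉ (H⊆K ∘ os⊆H) (u∉ ∘ os⊆H))
          (trans (cong (λ g → g + 1 + (length os + 1 + (m + 4))) (trans (length-reverse il) (∣long∣ into)))
            (trans (length₄ (length is) (length os) m) ℓ≡))
        ... | yes u∈il = close O (shortPathᵀ into) (longPath from) (short-uniqueᵀ into) (long-unique from)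
          ris⊆ (∈-++⁺ʳ os) O-path O-unique (s≤s (s≤s (s≤s z≤n)))
          (O∉ H⊆K u∉) (O∉ (H⊆K ∘ is⊆H ∘ proj₁ (reverse-∈ into)) (u∉ ∘ is⊆H ∘ proj₁ (reverse-∈ into)))
          (O∉ ol⊆K λ u∈ol → disjoint (there (∈-++⁺ʳ is u∈il)) (there (∈-++⁺ʳ os u∈ol)))
          (trans (cong₂ (λ g h → g + 1 + (h + 1 + (m + 4))) (length-reverse is) (∣long∣ from))
            (trans (length₄′ (length is) (length os) m) ℓ≡))

      connect₅ : ∀ a u w b → a ∈ˢ A → b ∈ˢ B → u ∉ H → w ∉ H → a ≢ b → a ⟶ u → u ⟶ w → w ⟶ b → Cycle E ℓ v
      connect₅ a u w b a∈ b∈ u∉ w∉ a≢b au uw wb = close (a ∷ u ∷ w ∷ b ∷ []) (shortPathᵀ into) (shortPath from)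
        (short-uniqueᵀ into) (short-unique from) ris⊆ ∈-++⁺ˡ
        (proj₁ (A⁻ a∈) ◅ au ◅ uw ◅ wb ◅ proj₁ (B⁻ b∈) ◅ ε)
        ((⟶⇒≢ au All.∷ (λ { refl → asym au uw }) All.∷ a≢b All.∷ All.[]) AllPairs.∷
          (⟶⇒≢ uw All.∷ (λ { refl → asym uw wb }) All.∷ All.[]) AllPairs.∷
          (⟶⇒≢ wb All.∷ All.[]) AllPairs.∷ All.[] AllPairs.∷ AllPairs.[])
        ≤-refl O∉H (λ z∈ → O∉H z∈ ∘ is⊆H ∘ proj₁ (reverse-∈ into)) (λ z∈ → O∉H z∈ ∘ os⊆H)
        (trans (cong (λ g → g + 1 + (length os + 1 + (m + 5))) (length-reverse is))
          (trans (length₅ (length is) (length os) m) ℓ≡))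
        where
        O∉H : ∀ {z} → z ∈ a ∷ u ∷ w ∷ b ∷ [] → z ∉ H
        O∉H (here refl)                         = proj₂ (A⁻ a∈) ∘ H⊆K
        O∉H (there (here refl))                 = u∉
        O∉H (there (there (here refl)))         = w∉
        O∉H (there (there (there (here refl)))) = proj₂ (B⁻ b∈) ∘ H⊆K

-- Cycles from two disjoint forks

private

  halve : ∀ m → ∃ λ h → ∃ λ ρ → 2 * h + ρ ≡ m × ρ ≤ 1
  halve zero    = 0 , 0 , refl , z≤n
  halve (suc m) with halve m
  ... | h , zero        , eq , _ = h , 1 , trans (+-suc (2 * h) 0) (cong suc eq) , ≤-refl
  ... | h , suc zero    , eq , _ = suc h , 0 , trans (carry h) (cong suc eq) , z≤n
    where
    carry : ∀ h → 2 * suc h + 0 ≡ suc (2 * h + 1)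
    carry h = solve (h ∷ [])
  ... | h , suc (suc ρ) , _  , s≤s ()

  stem-room : ∀ q δ a b w → 4 ≤ q → 15 * q ≤ δ + 2 → a ≤ 1 → b ≤ 1 → ∀ ρ → ρ ≤ 1 → w ≤ 2 * (a + b) + 5 → w + ρ ≤ δ
  stem-room q δ a b w h₁ h₂ h₃ h₄ ρ h₅ h₆ =
    derive 48 (15 ⊠ h₁ ⊞ h₂ ⊞ 2 ⊠ h₃ ⊞ 2 ⊠ h₄ ⊞ h₅ ⊞ h₆) (solve (q ∷ δ ∷ a ∷ b ∷ w ∷ ρ ∷ []))

  stem-budget : ∀ q δ a b w ρ h m → 4 ≤ q → 15 * q ≤ δ + 2 → a ≤ 1 → b ≤ 1 → ρ ≤ 1 → w ≤ 2 * (a + b) + 5 →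
    2 * h + ρ ≤ m → m + (7 + (a + b)) ≤ 3 * q → 6 * h + 3 * 4 + 4 * (w + ρ) ≤ δ + 5
  stem-budget q δ a b w ρ h m h₁ h₂ h₃ h₄ h₅ h₆ h₇ h₈ =
    derive 5 (6 ⊠ h₁ ⊞ h₂ ⊞ 5 ⊠ h₃ ⊞ 5 ⊠ h₄ ⊞ h₅ ⊞ 4 ⊠ h₆ ⊞ 3 ⊠ h₇ ⊞ 3 ⊠ h₈)
      (solve (q ∷ δ ∷ a ∷ b ∷ w ∷ ρ ∷ h ∷ m ∷ []))

  gadget-room : ∀ q δ a b ρ h m → 4 ≤ q → 15 * q ≤ δ + 2 → a ≤ 1 → b ≤ 1 →
    2 * h + ρ ≤ m → m + (7 + (a + b)) ≤ 3 * q → 1 + (a + b) + (h + ρ) + (a + b) + 12 ≤ δ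
  gadget-room q δ a b ρ h m h₁ h₂ h₃ h₄ h₅ h₆ =
    derive 38 (12 ⊠ h₁ ⊞ h₂ ⊞ h₃ ⊞ h₄ ⊞ h₅ ⊞ h₆ ⊞ z≤n {h}) (solve (q ∷ δ ∷ a ∷ b ∷ ρ ∷ h ∷ m ∷ []))

  gadget-budget : ∀ q δ a b ρ h m → 15 * q ≤ δ + 2 → a ≤ 1 → b ≤ 1 → ρ ≤ 1 → 4 ≤ q →
    2 * h + ρ ≤ m → m + (7 + (a + b)) ≤ 3 * q →
    9 * (1 + (a + b) + (h + ρ)) + 3 * (a + b) + 1 < δ
  gadget-budget q δ a b ρ h m h₁ h₂ h₃ h₄ h₅ h₆ h₇ = ≰⇒> λ lt → absurd lt
    where
    absurd : δ ≤ 9 * (1 + (a + b) + (h + ρ)) + 3 * (a + b) + 1 → ⊥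
    absurd lt = refute 11 (2 ⊠ h₁ ⊞ 15 ⊠ h₂ ⊞ 15 ⊠ h₃ ⊞ 9 ⊠ h₄ ⊞ 3 ⊠ h₅ ⊞ 9 ⊠ h₆ ⊞ 9 ⊠ h₇ ⊞ 2 ⊠ lt)
      (solve (q ∷ δ ∷ a ∷ b ∷ ρ ∷ h ∷ m ∷ []))

  9+2≤3q : ∀ q a b → 4 ≤ q → a ≤ 1 → b ≤ 1 → 7 + (a + b) ≤ 3 * q
  9+2≤3q q a b h₁ h₂ h₃ = derive 3 (3 ⊠ h₁ ⊞ h₂ ⊞ h₃) (solve (q ∷ a ∷ b ∷ []))

  ∣short∣≤1 : ∀ {E : Fin n → Sub n} {v y os ol} → Fork E v y os ol → length os ≤ 1
  ∣short∣≤1 (near _ _ _)       = z≤n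
  ∣short∣≤1 (far _ _ _ _ _ _)  = ≤-refl

  ∣gadgetVertices∣ : ∀ (x v y : Fin n) is il os ol → length il ≡ suc (length is) → length ol ≡ suc (length os) →
    length (gadgetVertices x v y is il os ol) ≤ 2 * (length is + length os) + 5
  ∣gadgetVertices∣ x v y is il os ol eq eq′ rewrite length-++ is {os ++ il ++ ol} | length-++ os {il ++ ol}
    | length-++ il {ol} | eq | eq′ = ≤-reflexive (tally (length is) (length os))
    where
    tally : ∀ a b → 3 + (a + (b + (suc a + suc b))) ≡ 2 * (a + b) + 5
    tally a b = solve (a ∷ b ∷ [])

module _ (G : Digraph n δ) {v x y : Fin n} {is il os ol : List (Fin n)}
  (into : Fork (flip (Digraph.E G)) v x is il) (from : Fork (Digraph.E G) v y os ol)
  (disjoint : ∀ {z} → z ∈ x ∷ is ++ il → z ∉ y ∷ os ++ ol) where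

  open Digraph G using (E)

  private
    a b e : ℕ
    a = length is
    b = length os
    e = a + b
    W : List (Fin n)
    W = gadgetVertices x v y is il os ol

    ∣W∣ : length W ≤ 2 * e + 5
    ∣W∣ = ∣gadgetVertices∣ x v y is il os ol (∣long∣ into) (∣long∣ from)

  forks⇒cycle : ∀ q → 4 ≤ q → 15 * q ≤ δ + 2 → Cycle E (3 * q) v
  forks⇒cycle q 4≤q large with halve (3 * q ∸ (7 + e))
  ... | h , ρ , 2h+ρ≡m , ρ≤1 = through-gadget length-eq
        (gadget-room q δ a b ρ h (2 * h + ρ) 4≤q large a≤1 b≤1 ≤-refl total)
        (inj₁ (gadget-budget q δ a b ρ h (2 * h + ρ) large a≤1 b≤1 ρ≤1 4≤q ≤-refl total))
    where
    a≤1 = ∣short∣≤1 into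
    b≤1 = ∣short∣≤1 from
    total≡ : 2 * h + ρ + (7 + e) ≡ 3 * q
    total≡ = trans (cong (_+ (7 + e)) 2h+ρ≡m) (m∸n+n≡m (9+2≤3q q a b 4≤q a≤1 b≤1))
    total : 2 * h + ρ + (7 + e) ≤ 3 * q
    total = ≤-reflexive total≡
    length-eq : 2 * h + ρ + 7 + e ≡ 3 * q
    length-eq = trans (+-assoc (2 * h + ρ) 7 e) total≡
    open Gadget G into from disjoint
      (Stems.stem G y W ρ h 4 (stem-room q δ a b (length W) 4≤q large a≤1 b≤1 ρ ρ≤1 ∣W∣)
        (stem-budget q δ a b (length W) ρ h (2 * h + ρ) 4≤q large a≤1 b≤1 ρ≤1 ∣W∣ ≤-refl total))

  -- A nine-cycle leaves `2 - e` vertices for the stem, all of them fixed. Two far forks without a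
  -- stem are the extreme case: `f = 3` and `e = 2` give `9 * 3 + 3 * 2 = 33`.
  forks⇒9-cycle : 33 ≤ δ → Cycle E 9 v
  forks⇒9-cycle 33≤δ with e in e≡ | +-mono-≤ (∣short∣≤1 into) (∣short∣≤1 from) | ∣W∣
  ... | 0 | _ | w = Gadget.through-gadget G into from disjoint
        (Stems.greedy-stem G y W 2 4 (≤-trans (+-monoˡ-≤ 2 w) (≤-trans (m≤m+n 7 26) 33≤δ)))
        (cong (9 +_) e≡) (subst (λ e → 1 + e + 2 + e + 12 ≤ δ) (sym e≡) (≤-trans (m≤m+n 15 18) 33≤δ))
        (inj₁ (subst (λ e → 9 * (1 + e + 2) + 3 * e + 1 < δ) (sym e≡) (≤-trans (m≤m+n 29 4) 33≤δ)))
  ... | 1 | _ | w = Gadget.through-gadget G into from disjoint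
        (Stems.greedy-stem G y W 1 4 (≤-trans (+-monoˡ-≤ 1 w) (≤-trans (m≤m+n 8 25) 33≤δ)))
        (cong (8 +_) e≡) (subst (λ e → 1 + e + 1 + e + 12 ≤ δ) (sym e≡) (≤-trans (m≤m+n 16 17) 33≤δ))
        (inj₁ (subst (λ e → 9 * (1 + e + 1) + 3 * e + 1 < δ) (sym e≡) (≤-trans (m≤m+n 32 1) 33≤δ)))
  ... | 2 | _ | w = Gadget.through-gadget G into from disjoint
        (Stems.greedy-stem G y W 0 4 (≤-trans (+-monoˡ-≤ 0 w) (≤-trans (m≤m+n 9 24) 33≤δ)))
        (cong (7 +_) e≡) (subst (λ e → 1 + e + 0 + e + 12 ≤ δ) (sym e≡) (≤-trans (m≤m+n 17 16) 33≤δ))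
        (inj₂ (refl , subst (λ e → 9 * (1 + e + 0) + 3 * e ≤ δ) (sym e≡) 33≤δ))
  ... | suc (suc (suc _)) | s≤s (s≤s ()) | _

-- Vertices whose out-neighbourhood is independent

private

  one-third : ∀ j a b n δ → δ ≤ a → δ ≤ b → j + (a + b) ≤ n → n ≤ 3 * δ → j ≤ δ
  one-third j a b n δ h₁ h₂ h₃ h₄ = derive 0 (h₁ ⊞ h₂ ⊞ h₃ ⊞ h₄) (solve (j ∷ a ∷ b ∷ n ∷ δ ∷ []))

  full-adjacency : ∀ i i′ a b n δ → δ ≤ i → i + 1 ≤ i′ → δ ≤ a → δ ≤ b →
    i′ + (a + b) ≤ n → n ≤ 3 * δ → ⊥
  full-adjacency i i′ a b n δ h₁ h₂ h₃ h₄ h₅ h₆ =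
    refute 0 (h₁ ⊞ h₂ ⊞ h₃ ⊞ h₄ ⊞ h₅ ⊞ h₆) (solve (i ∷ i′ ∷ a ∷ b ∷ n ∷ δ ∷ []))

  return-count : ∀ i i′ a b c d n δ → δ ≤ i → i + 1 ≤ i′ → δ ≤ a → δ ≤ b → b ≤ c + d →
    a + (d + i′) ≤ n → n ≤ 3 * δ → 1 ≤ c
  return-count i i′ a b c d n δ h₁ h₂ h₃ h₄ h₅ h₆ h₇ =
    derive 0 (h₁ ⊞ h₂ ⊞ h₃ ⊞ h₄ ⊞ h₅ ⊞ h₆ ⊞ h₇) (solve (i ∷ i′ ∷ a ∷ b ∷ c ∷ d ∷ n ∷ δ ∷ []))

  exit-count : ∀ δ d i α o t s σ → δ ≤ d → d ≤ i + o → o ≤ t + σ → σ ≤ s → s ≤ 4 → i + α ≤ δ → α ≤ t + 4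
  exit-count δ d i α o t s σ h₁ h₂ h₃ h₄ h₅ h₆ = derive 0 (h₁ ⊞ h₂ ⊞ h₃ ⊞ h₄ ⊞ h₅ ⊞ h₆)
    (solve (δ ∷ d ∷ i ∷ α ∷ o ∷ t ∷ s ∷ σ ∷ []))

  outside-count : ∀ t i n δ → δ ≤ i → t + i ≤ n → n ≤ 3 * δ → t ≤ 2 * δ
  outside-count t i n δ h₁ h₂ h₃ = derive 0 (h₁ ⊞ h₂ ⊞ h₃) (solve (t ∷ i ∷ n ∷ δ ∷ []))

  in-sum-bound : ∀ σ s₁ s₂ s₃ s₄ s₅ r₁ r₂ r₃ → σ ≤ s₁ + r₁ → r₁ ≤ s₂ + r₂ → r₂ ≤ s₃ + r₃ → r₃ ≤ s₄ + s₅ →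
    σ ≤ s₁ + s₂ + s₃ + s₄ + s₅
  in-sum-bound σ s₁ s₂ s₃ s₄ s₅ r₁ r₂ r₃ h₁ h₂ h₃ h₄ = derive 0 (h₁ ⊞ h₂ ⊞ h₃ ⊞ h₄)
    (solve (σ ∷ s₁ ∷ s₂ ∷ s₃ ∷ s₄ ∷ s₅ ∷ r₁ ∷ r₂ ∷ r₃ ∷ []))

  many-fat : ∀ q δ φ s m t i → φ * δ ≤ 3 * q * δ → s * δ ≤ 4 * δ →
    m * (3 * q + 4) ≤ δ * (3 * q + 4) → t * 2 ≤ 2 * δ * 2 →
    δ * δ ≤ φ * δ + s * δ + m * (3 * q + 4) + t * 2 + i * 0 → (6 * q + 13) * δ ≤ δ * δ → 1 ≤ δ → ⊥
  many-fat q δ φ s m t i h₂ h₃ h₄ h₅ h₆ h₇ h₈ =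
    refute 0 (h₂ ⊞ h₃ ⊞ h₄ ⊞ h₅ ⊞ h₆ ⊞ h₇ ⊞ h₈) (solve (q ∷ δ ∷ φ ∷ s ∷ m ∷ t ∷ i ∷ []))

  link-count : ∀ l a c d t q → l ≤ 3 * q → 3 * q + 5 ≤ a → a ≤ c + d → c ≤ t → t ≤ 2 → l < d
  link-count l a c d t q h₁ h₂ h₃ h₄ h₅ = derive 2 (h₁ ⊞ h₂ ⊞ h₃ ⊞ h₄ ⊞ h₅) (solve (l ∷ a ∷ c ∷ d ∷ t ∷ q ∷ []))

  exit-room : ∀ l a t q → l ≤ 3 * q → 3 * q + 5 ≤ a → a ≤ t + 4 → l < t
  exit-room l a t q h₁ h₂ h₃ = derive 0 (h₁ ⊞ h₂ ⊞ h₃) (solve (l ∷ a ∷ t ∷ q ∷ []))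

  positive : ∀ i a δ → 3 ≤ δ → δ ≤ i + a → a ≤ 2 → 1 ≤ i
  positive i a δ h₁ h₂ h₃ = derive 0 (h₁ ⊞ h₂ ⊞ h₃) (solve (i ∷ a ∷ δ ∷ []))

  prepended : ∀ k l → 3 + (3 * k + l) ≡ 3 * suc k + l
  prepended k l = solve (k ∷ l ∷ [])

  direct-few : ∀ q → 3 * suc q + 1 ≤ 2 + 3 * suc (suc q)
  direct-few q = derive 4 (z≤n {0}) (solve (q ∷ []))

  direct-length : ∀ q → 2 + (3 * suc q + 1) ≡ 3 * suc (suc q)
  direct-length q = solve (q ∷ [])

  detour-few : ∀ q → 3 * q + 4 ≤ 2 + 3 * suc (suc q)
  detour-few q = derive 4 (z≤n {0}) (solve (q ∷ []))

  detour-length : ∀ q → 2 + (3 * q + 4) ≡ 3 * suc (suc q)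
  detour-length q = solve (q ∷ [])

module OutIndependent (G : Digraph n δ) (v : Fin n)
  (independent : ∀ {i j} → i ∈ˢ Digraph.E G v → j ∈ˢ Digraph.E G v → j ∉ˢ Digraph.E G i) (1≤δ : 1 ≤ δ) where

  open Degrees G
  open Digraph G

  -- `J` is disjoint from the out- and in-neighbours of any of its vertices, which take at least
  -- `2 δ` of at most `3 δ` places.
  independent-≤δ : (J : Sub n) → (∀ i j → i ∈ˢ J → j ∈ˢ J → ¬ i ⟶ j) → ∣ J ∣ ≤ δ
  independent-≤δ J indep with 1 ≤? ∣ J ∣
  ... | no  empty = ≤-trans (≤-reflexive (n<1⇒n≡0 (≰⇒> empty))) z≤n
  ... | yes 1≤J with pick J 1≤J
  ...   | i , i∈ = one-third (∣ J ∣) (∣ N⁺ i ∣) (∣ N⁻ i ∣) n δ (deg⁺ i) (deg⁻ i)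
          (≤-trans (pack₃ J (N⁺ i) (N⁻ i) full (λ _ _ → refl) (λ _ _ → refl) (λ _ _ → refl)
            (λ j j∈ → indep i j i∈ j∈) (λ j j∈ → indep j i j∈ i∈) (λ j → asym)) (∣∣≤n full)) n≤3δ

  I : Sub n
  I = N⁺ v

  α : Fin n → ℕ
  α r = ∣ I ∩ N⁻ r ∣

  ∣I∣≤δ : ∣ I ∣ ≤ δ
  ∣I∣≤δ = independent-≤δ I λ i j → independent

  -- Otherwise `I` together with `u` would be disjoint from both neighbourhoods of `i`, making at
  -- least `3 δ + 1` vertices.
  adjacent : ∀ {i u} → i ∈ˢ I → u ∉ˢ I → i ⟶ u ⊎ u ⟶ i
  adjacent {i} {u} i∈ u∉ = decide (u ∈ˢ? N⁺ i) (u ∈ˢ? N⁻ i)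
    where
    out : ∀ j → j ∈ˢ I ⊎ j ≡ u → u ∉ˢ N⁺ i → ¬ i ⟶ j
    out j (inj₁ j∈)   _   = independent i∈ j∈
    out j (inj₂ refl) u∉⁺ = u∉⁺
    into : ∀ j → j ∈ˢ I ⊎ j ≡ u → u ∉ˢ N⁻ i → ¬ j ⟶ i
    into j (inj₁ j∈)   _   = independent j∈ i∈
    into j (inj₂ refl) u∉⁻ = u∉⁻
    decide : u ∈ˢ N⁺ i ⊎ u ∉ˢ N⁺ i → u ∈ˢ N⁻ i ⊎ u ∉ˢ N⁻ i → i ⟶ u ⊎ u ⟶ i
    decide (inj₁ i⟶u) _          = inj₁ i⟶u
    decide (inj₂ _)   (inj₁ u⟶i) = inj₂ u⟶i
    decide (inj₂ u∉⁺) (inj₂ u∉⁻) = ⊥-elim (full-adjacency (∣ I ∣) (∣ insert u I ∣) (∣ N⁺ i ∣) (∣ N⁻ i ∣) n δ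
      (deg⁺ v) (∣insert∣ u I u∉) (deg⁺ i) (deg⁻ i) total n≤3δ)
      where
      total : ∣ insert u I ∣ + (∣ N⁺ i ∣ + ∣ N⁻ i ∣) ≤ n
      total = ≤-trans (pack₃ (insert u I) (N⁺ i) (N⁻ i) full (λ _ _ → refl) (λ _ _ → refl) (λ _ _ → refl)
        (λ j j∈ → out j (insert⁻ u I {j} j∈) u∉⁺) (λ j j∈ → into j (insert⁻ u I {j} j∈) u∉⁻) (λ j → asym))
        (∣∣≤n full)

  ∣N⁺∣≤δ : ∀ i → i ∈ˢ I → ∣ N⁺ i ∣ ≤ δ
  ∣N⁺∣≤δ i i∈ = one-third (∣ N⁺ i ∣) (∣ N⁻ i ∣) (∣ I ∣) n δ (deg⁻ i) (deg⁺ v)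
    (≤-trans (pack₃ (N⁺ i) (N⁻ i) I full (λ _ _ → refl) (λ _ _ → refl) (λ _ _ → refl)
      (λ j → asym) (λ j i⟶j j∈ → independent i∈ j∈ i⟶j) (λ j j⟶i j∈ → independent j∈ i∈ j⟶i)) (∣∣≤n full)) n≤3δ

  α-total : sumOver I (λ i → ∣ N⁺ i ∣) ≡ sumOver full α
  α-total = sumOver-swap I full E

  -- Exactly `δ` arcs leave each of the `δ` vertices of `I`; `α` counts them by their heads.
  δ²≤α-total : δ * δ ≤ sumOver full α
  δ²≤α-total = ≤-trans (≤-trans (*-monoˡ-≤ δ (deg⁺ v)) (sumOver-≥ I δ λ i _ → deg⁺ i)) (≤-reflexive α-total)

  α-total≤δ² : sumOver full α ≤ δ * δ
  α-total≤δ² = ≤-trans (≤-reflexive (sym α-total)) (≤-trans (sumOver-≤ I δ ∣N⁺∣≤δ) (*-monoˡ-≤ δ ∣I∣≤δ))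

  α≤δ : ∀ r → α r ≤ δ
  α≤δ r = ≤-trans (∣∣-mono (I ∩ N⁻ r) I λ _ → proj₁ ∘ ∩⁻ I (N⁻ r)) ∣I∣≤δ

  1≤α⇒∉I : ∀ {r} → 1 ≤ α r → r ∉ˢ I
  1≤α⇒∉I {r} 1≤α r∈I with pick (I ∩ N⁻ r) 1≤α
  ... | i , i∈ = independent (proj₁ (∩⁻ I (N⁻ r) i∈)) r∈I (proj₂ (∩⁻ I (N⁻ r) i∈))

  1≤α⇒≢v : ∀ {r} → 1 ≤ α r → r ≢ v
  1≤α⇒≢v {r} 1≤α refl with pick (I ∩ N⁻ r) 1≤α
  ... | i , i∈ = asym (proj₁ (∩⁻ I (N⁻ r) i∈)) (proj₂ (∩⁻ I (N⁻ r) i∈))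

  α-complement : ∀ {r} → r ∉ˢ I → δ ≤ ∣ I ∩ N⁺ r ∣ + α r
  α-complement {r} r∉I = ≤-trans (deg⁺ v) (cover I (I ∩ N⁺ r) (I ∩ N⁻ r) λ i i∈ →
    [ (λ i⟶r → inj₂ (∩⁺ I (N⁻ r) i∈ i⟶r)) , (λ r⟶i → inj₁ (∩⁺ I (N⁺ r) i∈ r⟶i)) ]′ (adjacent i∈ r∉I))

  α-complement′ : ∀ r → ∣ I ∩ N⁺ r ∣ + α r ≤ δ
  α-complement′ r = ≤-trans (pack (I ∩ N⁺ r) (I ∩ N⁻ r) I (λ _ → proj₁ ∘ ∩⁻ I (N⁺ r)) (λ _ → proj₁ ∘ ∩⁻ I (N⁻ r))
    λ i i∈ i∈′ → asym (proj₂ (∩⁻ I (N⁺ r) i∈)) (proj₂ (∩⁻ I (N⁻ r) i∈′))) ∣I∣≤δ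

  -- Otherwise `N⁺ i`, `N⁻ v` and `I` together with `v` would be disjoint, making at least `3 δ + 1`
  -- vertices.
  return : ∀ {i} → i ∈ˢ I → ∃ λ r → i ⟶ r × r ⟶ v
  return {i} i∈ with pick (N⁻ v ∩ N⁺ i)
    (return-count (∣ I ∣) (∣ insert v I ∣) (∣ N⁺ i ∣) (∣ N⁻ v ∣) (∣ N⁻ v ∩ N⁺ i ∣) (∣ N⁻ v ∖ N⁺ i ∣) n δ
      (deg⁺ v) (∣insert∣ v I (λ v⟶v → asym v⟶v v⟶v)) (deg⁺ i) (deg⁻ v) (∣∣-split (N⁻ v) (N⁺ i))
      (≤-trans (pack₃ (N⁺ i) (N⁻ v ∖ N⁺ i) (insert v I) full (λ _ _ → refl) (λ _ _ → refl) (λ _ _ → refl)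
        (λ j i⟶j j∈ → proj₂ (∖⁻ (N⁻ v) (N⁺ i) j∈) i⟶j)
        (λ j i⟶j j∈ → out j i⟶j (insert⁻ v I {j} j∈))
        (λ j j∈ j∈′ → into j (proj₁ (∖⁻ (N⁻ v) (N⁺ i) j∈)) (insert⁻ v I {j} j∈′)))
        (∣∣≤n full)) n≤3δ)
    where
    out : ∀ j → i ⟶ j → ¬ (j ∈ˢ I ⊎ j ≡ v)
    out j i⟶j (inj₁ j∈)   = independent i∈ j∈ i⟶j
    out j i⟶j (inj₂ refl) = asym i∈ i⟶j
    into : ∀ j → j ⟶ v → ¬ (j ∈ˢ I ⊎ j ≡ v)
    into j j⟶v (inj₁ j∈)   = asym j⟶v j∈
    into j j⟶v (inj₂ refl) = asym j⟶v j⟶v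
  ... | r , r∈ = r , proj₂ (∩⁻ (N⁻ v) (N⁺ i) r∈) , proj₁ (∩⁻ (N⁻ v) (N⁺ i) r∈)

  -- If the vertices with at least three in-neighbours in I span almost no arc,
  -- then G is close to a blown-up triangle in which I is followed by Φ and Φ by
  -- T, and the cycle is traced backwards from v block by block.

  module Layered (q : ℕ) (S : List (Fin n)) (∣S∣≤4 : length S ≤ 4) (large : 6 * q + 13 ≤ δ)
    (no-arc : ∀ b y → 3 ≤ α b → 3 ≤ α y → b ∉ S → y ∉ S → ¬ b ⟶ y) where

    Φ? : ∀ r → Dec (3 * q + 5 ≤ α r × r ∉ S)
    Φ? r = (3 * q + 5 ≤? α r) ×-dec ¬? (r ∈? S)

    M? : ∀ r → Dec (3 ≤ α r × α r ≤ 3 * q + 4 × r ∉ S)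
    M? r = (3 ≤? α r) ×-dec ((α r ≤? 3 * q + 4) ×-dec ¬? (r ∈? S))

    T? : ∀ r → Dec (α r ≤ 2 × r ∉ˢ I)
    T? r = (α r ≤? 2) ×-dec ¬? (E v r Bool.≟ true)

    Φ M T : Sub n
    Φ = ⟨ Φ? ⟩
    M = ⟨ M? ⟩
    T = ⟨ T? ⟩

    module _ {r : Fin n} (r∈Φ : r ∈ˢ Φ) where
      Φ-α : 3 * q + 5 ≤ α r
      Φ-α = proj₁ (⟨⟩⁻ Φ? r∈Φ)
      Φ-1≤α : 1 ≤ α r
      Φ-1≤α = ≤-trans (≤-trans (s≤s z≤n) (m≤n+m 5 (3 * q))) Φ-α

    M-independent : ∀ i j → i ∈ˢ M → j ∈ˢ M → ¬ i ⟶ j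
    M-independent i j i∈ j∈ =
      let 3≤αi , _ , i∉S = ⟨⟩⁻ M? i∈
          3≤αj , _ , j∉S = ⟨⟩⁻ M? j∈
      in no-arc i j 3≤αi 3≤αj i∉S j∉S

    ∣T∣≤2δ : ∣ T ∣ ≤ 2 * δ
    ∣T∣≤2δ = outside-count (∣ T ∣) (∣ I ∣) n δ (deg⁺ v) (≤-trans (pack T I full (λ _ _ → refl) (λ _ _ → refl)
      λ r r∈ r∈I → proj₂ (⟨⟩⁻ T? r∈) r∈I) (∣∣≤n full)) n≤3δ

    -- Of the `δ²` arcs leaving `I`, the vertices of `S`, of the independent set `M` and of `T`
    -- receive at most `4 δ`, `(3 q + 4) δ` and `4 δ`. If `Φ` had at most `3 q` vertices,
    -- `δ ≤ 6 q + 12` would follow.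
    many-Φ : 3 * q < ∣ Φ ∣
    many-Φ = ≰⇒> λ few → many-fat q δ (∣ Φ ∣) (∣ elem S ∣) (∣ M ∣) (∣ T ∣) (∣ I ∣)
      (*-monoˡ-≤ δ few) (*-monoˡ-≤ δ (≤-trans (∣elem∣≤length S) ∣S∣≤4))
      (*-monoˡ-≤ (3 * q + 4) (independent-≤δ M M-independent)) (*-monoˡ-≤ 2 ∣T∣≤2δ)
      (≤-trans δ²≤α-total (≤-trans
        (in-sum-bound (sumOver full α) (sumOver Φ α) (sumOver (elem S) α) (sumOver M α) (sumOver T α) (sumOver I α)
          (sumOver R₁ α) (sumOver R₂ α) (sumOver R₃ α)
          (sumOver-cover full Φ R₁ α (λ i _ → split full Φ i refl))
          (sumOver-cover R₁ (elem S) R₂ α (split R₁ (elem S)))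
          (sumOver-cover R₂ M R₃ α (split R₂ M))
          (sumOver-cover R₃ T I α last))
        (sumOver-≤ Φ δ (λ i _ → α≤δ i) ⊞ sumOver-≤ (elem S) δ (λ i _ → α≤δ i)
          ⊞ sumOver-≤ M (3 * q + 4) (λ i i∈ → proj₁ (proj₂ (⟨⟩⁻ M? i∈)))
          ⊞ sumOver-≤ T 2 (λ i i∈ → proj₁ (⟨⟩⁻ T? i∈))
          ⊞ sumOver-≤ I 0 (λ i i∈ → ≮⇒≥ λ 1≤α → 1≤α⇒∉I 1≤α i∈))))
      (*-monoˡ-≤ δ large) 1≤δ
      where
      R₁ R₂ R₃ : Sub n
      R₁ = full ∖ Φ
      R₂ = R₁ ∖ elem S
      R₃ = R₂ ∖ M
      split : ∀ A B i → i ∈ˢ A → i ∈ˢ B ⊎ i ∈ˢ A ∖ B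
      split A B i i∈A with i ∈ˢ? B
      ... | inj₁ i∈B = inj₁ i∈B
      ... | inj₂ i∉B = inj₂ (∖⁺ A B i∈A i∉B)
      last : ∀ i → i ∈ˢ R₃ → i ∈ˢ T ⊎ i ∈ˢ I
      last i i∈R₃ with i ∈ˢ? I | α i ≤? 2 | 3 * q + 5 ≤? α i
      ... | inj₁ i∈I | _       | _      = inj₂ i∈I
      ... | inj₂ i∉I | yes α≤2 | _      = inj₁ (⟨⟩⁺ T? (α≤2 , i∉I))
      ... | inj₂ i∉I | no  2<α | p      =
        let i∈R₂ , i∉M = ∖⁻ R₂ M i∈R₃
            i∈R₁ , i∉S = ∖⁻ R₁ (elem S) i∈R₂
        in ⊥-elim (contra (proj₂ (∖⁻ full Φ i∈R₁)) (i∉S ∘ elem⁺) i∉M p)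
        where
        contra : i ∉ˢ Φ → i ∉ S → i ∉ˢ M → Dec (3 * q + 5 ≤ α i) → ⊥
        contra i∉Φ i∉S i∉M (yes fat) = i∉Φ (⟨⟩⁺ Φ? (fat , i∉S))
        contra i∉Φ i∉S i∉M (no thin) = i∉M (⟨⟩⁺ M? (≰⇒> 2<α ,
          ≤-pred (subst (suc (α i) ≤_) (+-suc (3 * q) 4) (≰⇒> thin)) , i∉S))

    -- All but two vertices of I come after t, hence more than 3q of those before m.
    link : ∀ {m t} (L : List (Fin n)) → m ∈ˢ Φ → t ∈ˢ T → length L ≤ 3 * q →
      ∃ λ i → i ∈ˢ I × t ⟶ i × i ⟶ m × i ∉ L
    link {m} {t} L m∈ t∈ few with pickAvoiding ((I ∩ N⁻ m) ∖ N⁻ t) L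
      (link-count (length L) (α m) (∣ (I ∩ N⁻ m) ∩ N⁻ t ∣) (∣ (I ∩ N⁻ m) ∖ N⁻ t ∣) (α t) q few (Φ-α m∈)
        (∣∣-split (I ∩ N⁻ m) (N⁻ t))
        (∣∣-mono ((I ∩ N⁻ m) ∩ N⁻ t) (I ∩ N⁻ t) λ i i∈ →
          ∩⁺ I (N⁻ t) (proj₁ (∩⁻ I (N⁻ m) (proj₁ (∩⁻ (I ∩ N⁻ m) (N⁻ t) i∈)))) (proj₂ (∩⁻ (I ∩ N⁻ m) (N⁻ t) i∈)))
        (proj₁ (⟨⟩⁻ T? t∈)))
    ... | i , i∈ , i∉L with ∖⁻ (I ∩ N⁻ m) (N⁻ t) i∈
    ...   | i∈′ , i↛t with ∩⁻ I (N⁻ m) i∈′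
    ...     | i∈I , i⟶m with adjacent i∈I (proj₂ (⟨⟩⁻ T? t∈))
    ...       | inj₁ i⟶t = ⊥-elim (i↛t i⟶t)
    ...       | inj₂ t⟶i = i , i∈I , t⟶i , i⟶m , i∉L

    -- `m` has at most `δ - α m` out-neighbours in `I`, hence at least `α m` outside. Of these at
    -- most four, in `S`, are not in `T`, so `3 q + 5` leaves more than `3 q` choices.
    exit : ∀ {m} (L : List (Fin n)) → m ∈ˢ Φ → length L ≤ 3 * q → ∃ λ t → m ⟶ t × t ∈ˢ T × t ∉ L
    exit {m} L m∈ few =
      let t , t∈ , t∉L = pickAvoiding (N⁺ m ∩ T) L (exit-room (length L) (α m) (∣ N⁺ m ∩ T ∣) q few (Φ-α m∈) many)
          m⟶t , t∈T = ∩⁻ (N⁺ m) T t∈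
      in t , m⟶t , t∈T , t∉L
      where
      outcome : ∀ r → m ⟶ r × r ∉ˢ I → Dec (α r ≤ 2) → Dec (r ∈ S) → r ∈ˢ N⁺ m ∩ T ⊎ r ∈ˢ elem S
      outcome r (m⟶r , r∉I) (yes α≤2) _         = inj₁ (∩⁺ (N⁺ m) T m⟶r (⟨⟩⁺ T? (α≤2 , r∉I)))
      outcome r (m⟶r , r∉I) (no _)    (yes r∈S) = inj₂ (elem⁺ r∈S)
      outcome r (m⟶r , r∉I) (no 2<α)  (no r∉S)  = ⊥-elim (no-arc m r
        (≤-trans (≤-trans (s≤s (s≤s (s≤s z≤n))) (m≤n+m 5 (3 * q))) (Φ-α m∈)) (≰⇒> 2<α)
        (proj₂ (⟨⟩⁻ Φ? m∈)) r∉S m⟶r)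
      many : α m ≤ ∣ N⁺ m ∩ T ∣ + 4
      many = exit-count δ (∣ N⁺ m ∣) (∣ I ∩ N⁺ m ∣) (α m) (∣ N⁺ m ∖ I ∣) (∣ N⁺ m ∩ T ∣) (length S) (∣ elem S ∣) (deg⁺ m)
        (cover (N⁺ m) (I ∩ N⁺ m) (N⁺ m ∖ I) λ r m⟶r →
          [ (λ r∈I → inj₁ (∩⁺ I (N⁺ m) r∈I m⟶r)) , (λ r∉I → inj₂ (∖⁺ (N⁺ m) I m⟶r r∉I)) ]′ (r ∈ˢ? I))
        (cover (N⁺ m ∖ I) (N⁺ m ∩ T) (elem S) λ r r∈ → outcome r (∖⁻ (N⁺ m) I r∈) (α r ≤? 2) (r ∈? S))
        (∣elem∣≤length S) ∣S∣≤4 (α-complement′ m)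

    Φ≢I : ∀ {m i} → m ∈ˢ Φ → i ∈ˢ I → m ≢ i
    Φ≢I m∈ i∈ refl = 1≤α⇒∉I (Φ-1≤α m∈) i∈

    Tail : ℕ → Set
    Tail len = ∃ λ m → ∃ λ xs → m ∈ˢ Φ × Path E m xs v × Unique (m ∷ xs) × length xs ≡ len × v ∈ xs

    prepend : ∀ {len} → Tail len → suc len ≤ 3 * q → Tail (3 + len)
    prepend {len} (m , xs , m∈ , path , unique , ∣xs∣ , v∈) few =
      let few′ = subst (λ l → suc l ≤ 3 * q) (sym ∣xs∣) few
          m′ , m′∈ , m′∉ = pickAvoiding Φ (m ∷ xs) (≤-trans (s≤s few′) many-Φ)
          t , m′⟶t , t∈ , t∉ = exit (m ∷ xs) m′∈ few′
          i , i∈ , t⟶i , i⟶m , i∉ = link (m ∷ xs) m∈ t∈ few′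
      in m′ , t ∷ i ∷ m ∷ xs , m′∈ , m′⟶t ◅ t⟶i ◅ i⟶m ◅ path ,
         (⟶⇒≢ m′⟶t All.∷ Φ≢I m′∈ i∈ All.∷ fresh m′∉) AllPairs.∷ (⟶⇒≢ t⟶i All.∷ fresh t∉) AllPairs.∷
           fresh i∉ AllPairs.∷ unique ,
         cong (3 +_) ∣xs∣ , there (there (there v∈))

    prependMany : ∀ k {len} → Tail len → 3 * k + len ≤ 2 + 3 * q → Tail (3 * k + len)
    prependMany zero    tail _   = tail
    prependMany (suc k) {len} tail few = subst Tail (prepended k len)
      (prepend (prependMany k tail (≤-trans (m≤n+m _ 3) few′)) (≤-pred (≤-pred few′)))
      where few′ = subst (_≤ 2 + 3 * q) (sym (prepended k len)) few

    finish : ∀ {len} → Tail len → 2 + len ≡ 3 * q → Cycle E (3 * q) v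
    finish (m , xs , m∈ , path , unique , ∣xs∣ , v∈) len =
      let i , i∈ , i∉ = pickAvoiding (I ∩ N⁻ m) (m ∷ xs) (≤-trans
            (≤-reflexive (trans (cong (2 +_) ∣xs∣) len)) (≤-trans (m≤m+n (3 * q) 5) (Φ-α m∈)))
          v⟶i , i⟶m = ∩⁻ I (N⁻ m) i∈
      in i ∷ m ∷ xs , trans (cong (2 +_) ∣xs∣) len , (v , v⟶i ◅ i⟶m ◅ path) , fresh i∉ AllPairs.∷ unique , there (there v∈)

    direct-tail : ∀ {m} → m ∈ˢ Φ → m ⟶ v → Tail 1
    direct-tail {m} m∈ m⟶v = m , [ v ] , m∈ , m⟶v ◅ ε ,
      (⟶⇒≢ m⟶v All.∷ All.[]) AllPairs.∷ All.[] AllPairs.∷ AllPairs.[] , refl , here refl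

    -- One turn longer than `direct-tail`, so the length keeps its residue modulo three. As `m` has
    -- no arc to `v`, it differs from `r`.
    detour-tail : ∀ {m} → m ∈ˢ Φ → ¬ m ⟶ v → 3 ≤ δ → 1 ≤ q → Tail 4
    detour-tail {m} m∈ m↛v 3≤δ 1≤q =
      let t , m⟶t , t∈ , t∉ = exit [ v ] m∈ (≤-trans 1≤q (m≤n*m q 3))
          α≤2 , t∉I = ⟨⟩⁻ T? t∈
          i , i∈ = pick (I ∩ N⁺ t) (positive (∣ I ∩ N⁺ t ∣) (α t) δ 3≤δ (α-complement t∉I) α≤2)
          i∈I , t⟶i = ∩⁻ I (N⁺ t) i∈
          r , i⟶r , r⟶v = return i∈I
      in m , t ∷ i ∷ r ∷ v ∷ [] , m∈ , m⟶t ◅ t⟶i ◅ i⟶r ◅ r⟶v ◅ ε ,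
         (⟶⇒≢ m⟶t All.∷ Φ≢I m∈ i∈I All.∷ m≢r r⟶v All.∷ 1≤α⇒≢v (Φ-1≤α m∈) All.∷ All.[]) AllPairs.∷
           (⟶⇒≢ t⟶i All.∷ path⇒≢ t⟶i i⟶r All.∷ (λ t≡v → t∉ (here t≡v)) All.∷ All.[]) AllPairs.∷
           (⟶⇒≢ i⟶r All.∷ (λ i≡v → ⟶⇒≢ i∈I (sym i≡v)) All.∷ All.[]) AllPairs.∷
           (⟶⇒≢ r⟶v All.∷ All.[]) AllPairs.∷ All.[] AllPairs.∷ AllPairs.[] ,
         refl , there (there (there (here refl)))
      where
      m≢r : ∀ {r} → r ⟶ v → m ≢ r
      m≢r r⟶v refl = m↛v r⟶v

  layered-cycle : ∀ q (S : List (Fin n)) → 2 ≤ q → length S ≤ 4 → 6 * q + 13 ≤ δ →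
    (∀ b y → 3 ≤ α b → 3 ≤ α y → b ∉ S → y ∉ S → ¬ b ⟶ y) → Cycle E (3 * q) v
  layered-cycle (suc zero) S (s≤s ()) _ _ _
  layered-cycle (suc (suc q)) S _ ∣S∣≤4 large no-arc =
    decide (Fin.any? λ m → (Φ m Bool.≟ true) ×-dec (E m v Bool.≟ true))
    where
    open Layered (suc (suc q)) S ∣S∣≤4 large no-arc
    3≤δ : 3 ≤ δ
    3≤δ = ≤-trans (≤-trans (m≤m+n 3 10) (m≤n+m 13 (6 * suc (suc q)))) large
    decide : Dec (∃ λ m → m ∈ˢ Φ × m ⟶ v) → Cycle E (3 * suc (suc q)) v
    decide (yes (m , m∈ , m⟶v)) = finish (prependMany (suc q) (direct-tail m∈ m⟶v) (direct-few q)) (direct-length q)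
    decide (no none) =
      let m , m∈ = pick Φ (≤-trans (s≤s z≤n) many-Φ) in
      finish (prependMany q (detour-tail m∈ (λ m⟶v → none (m , m∈ , m⟶v)) 3≤δ (s≤s z≤n)) (detour-few q)) (detour-length q)

-- Finding disjoint forks

module _ (G : Digraph n δ) (v : Fin n) where

  open Degrees G
  open Digraph G

  Independent : Sub n → Set
  Independent J = ∀ {i j} → i ∈ˢ J → j ∈ˢ J → ¬ i ⟶ j

  independent? : (J : Sub n) → (∃ λ i → ∃ λ j → i ∈ˢ J × j ∈ˢ J × i ⟶ j) ⊎ Independent J
  independent? J with Fin.any? (λ i → Fin.any? λ j → (J i Bool.≟ true) ×-dec ((J j Bool.≟ true) ×-dec (E i j Bool.≟ true)))
  ... | yes found = inj₁ found
  ... | no none   = inj₂ λ i∈ j∈ i⟶j → none (_ , _ , i∈ , j∈ , i⟶j)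

  -- All that the search for forks needs to know about closing the cycle; the stem that does so
  -- depends on `q`.
  ForksClose : ℕ → Set
  ForksClose ℓ = ∀ {x y is il os ol} → Fork N⁻ v x is il → Fork N⁺ v y os ol →
    (∀ {z} → z ∈ x ∷ is ++ il → z ∉ y ∷ os ++ ol) → Cycle E ℓ v

module FarForks (G : Digraph n δ) (v : Fin n) (independent : Independent G v (Digraph.E G v)) (1≤δ : 1 ≤ δ) where

  open Degrees G
  open Digraph G
  open OutIndependent G v independent 1≤δ

  record FarFork (S D : List (Fin n)) : Set where
    field
      {y i j b} : Fin n
      vi  : v ⟶ i
      iy  : i ⟶ y
      vj  : v ⟶ j
      jb  : j ⟶ b
      by  : b ⟶ y
      b∉I : b ∉ˢ I
      y∉  : y ∉ S
      b∉  : b ∉ S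
      i∉  : i ∉ D
      j∉  : j ∉ D

    fork : Fork E v y [ i ] (j ∷ b ∷ [])
    fork = far vi iy vj jb by λ i≡b → b∉I (subst (_∈ˢ I) i≡b vi)

  -- Without such an arc `b ⟶ y` the layered case applies. Three in-neighbours in `I` leave one
  -- outside `D`; `i` and `j` may coincide, since the cycle takes only one of the two paths.
  farFork : ∀ q S D → 2 ≤ q → length S ≤ 4 → length D ≤ 2 → 6 * q + 13 ≤ δ → Cycle E (3 * q) v ⊎ FarFork S D
  farFork q S D 2≤q ∣S∣≤4 ∣D∣≤2 large = decide (Fin.any? λ b → Fin.any? λ y → arc? b y)
    where
    Arc : Fin n → Fin n → Set
    Arc b y = 3 ≤ α b × 3 ≤ α y × b ∉ S × y ∉ S × b ⟶ y
    arc? : ∀ b y → Dec (Arc b y)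
    arc? b y = (3 ≤? α b) ×-dec ((3 ≤? α y) ×-dec (¬? (b ∈? S) ×-dec (¬? (y ∈? S) ×-dec (E b y Bool.≟ true))))
    decide : Dec (∃ λ b → ∃ λ y → Arc b y) → Cycle E (3 * q) v ⊎ FarFork S D
    decide (no none) = inj₁ (layered-cycle q S 2≤q ∣S∣≤4 large
      λ b y 3≤b 3≤y b∉ y∉ b⟶y → none (b , y , 3≤b , 3≤y , b∉ , y∉ , b⟶y))
    decide (yes (b , y , 3≤b , 3≤y , b∉ , y∉ , b⟶y)) =
      let i , i∈ , i∉ = pickAvoiding (I ∩ N⁻ y) D (≤-trans (s≤s ∣D∣≤2) 3≤y)
          j , j∈ , j∉ = pickAvoiding (I ∩ N⁻ b) D (≤-trans (s≤s ∣D∣≤2) 3≤b)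
          vi , iy = ∩⁻ I (N⁻ y) i∈
          vj , jb = ∩⁻ I (N⁻ b) j∈
      in inj₂ record { vi = vi ; iy = iy ; vj = vj ; jb = jb ; by = b⟶y ; b∉I = 1≤α⇒∉I (≤-trans (s≤s z≤n) 3≤b)
                     ; y∉ = y∉ ; b∉ = b∉ ; i∉ = i∉ ; j∉ = j∉ }

module _ (G : Digraph n δ) (v : Fin n) where

  open Degrees G
  open Digraph G

  out-independent-cycle : Independent G v (N⁺ v) → ∀ q → 2 ≤ q → 6 * q + 13 ≤ δ → ForksClose G v (3 * q) →
    Cycle E (3 * q) v
  out-independent-cycle indep q 2≤q large close = split (independent? G v (N⁻ v))
    where
    1≤δ : 1 ≤ δ
    1≤δ = ≤-trans (≤-trans (s≤s z≤n) (m≤n+m 13 (6 * q))) large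
    open FarForks G v indep 1≤δ

    from-arc : ∀ {x c} → x ⟶ v → c ⟶ v → x ⟶ c → Cycle E (3 * q) v ⊎ FarFork (x ∷ c ∷ []) [] → Cycle E (3 * q) v
    from-arc xv cv xc (inj₁ cycle) = cycle
    from-arc {x} {c} xv cv xc (inj₂ F) = close (near xv cv xc) fork disjoint
      where
      open FarFork F
      ≢out : ∀ {z w} → z ∈ x ∷ c ∷ [] → v ⟶ w → z ≢ w
      ≢out (here refl)         vw = path⇒≢ xv vw
      ≢out (there (here refl)) vw = path⇒≢ cv vw
      disjoint : ∀ {z} → z ∈ x ∷ c ∷ [] → z ∉ y ∷ i ∷ j ∷ b ∷ []
      disjoint z∈ (here refl)                         = y∉ z∈
      disjoint z∈ (there (here z≡i))                  = ≢out z∈ vi z≡i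
      disjoint z∈ (there (there (here z≡j)))          = ≢out z∈ vj z≡j
      disjoint z∈ (there (there (there (here refl)))) = b∉ z∈

    module _ (indepᵀ : Independent (G ᵀ) v (N⁻ v)) where
      private module Opposite = FarForks (G ᵀ) v indepᵀ 1≤δ

      -- The `y` and `b` of the second fork must avoid all four vertices of the first. Its `i` and
      -- `j` are out-neighbours of `v`, so they need avoid only the two not chosen among the
      -- in-neighbours. Hence the limits 4 and 2 in `farFork`.
      both : (R : Opposite.FarFork [] []) → let open Opposite.FarFork R in
        Cycle E (3 * q) v ⊎ FarFork (y ∷ i ∷ j ∷ b ∷ []) (y ∷ b ∷ []) → Cycle E (3 * q) v
      both R (inj₁ cycle) = cycle
      both R (inj₂ F) = close In.fork Out.fork disjoint
        where
        module In = Opposite.FarFork R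
        module Out = FarFork F
        ≢out : ∀ {z w} → z ∈ In.y ∷ In.i ∷ In.j ∷ In.b ∷ [] → v ⟶ w → w ∉ In.y ∷ In.b ∷ [] → z ≢ w
        ≢out (here refl)                         vw w∉ refl = w∉ (here refl)
        ≢out (there (here refl))                 vw w∉ = path⇒≢ In.vi vw
        ≢out (there (there (here refl)))         vw w∉ = path⇒≢ In.vj vw
        ≢out (there (there (there (here refl)))) vw w∉ refl = w∉ (there (here refl))
        disjoint : ∀ {z} → z ∈ In.y ∷ In.i ∷ In.j ∷ In.b ∷ [] → z ∉ Out.y ∷ Out.i ∷ Out.j ∷ Out.b ∷ []
        disjoint z∈ (here refl)                         = Out.y∉ z∈
        disjoint z∈ (there (here z≡i))                  = ≢out z∈ Out.vi Out.i∉ z≡i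
        disjoint z∈ (there (there (here z≡j)))          = ≢out z∈ Out.vj Out.j∉ z≡j
        disjoint z∈ (there (there (there (here refl)))) = Out.b∉ z∈

      from-independent : Cycle (flip E) (3 * q) v ⊎ Opposite.FarFork [] [] → Cycle E (3 * q) v
      from-independent (inj₁ cycle) = Cycle-reverse cycle
      from-independent (inj₂ R) = both R (farFork q _ _ 2≤q ≤-refl ≤-refl large)

    split : (∃ λ x → ∃ λ c → x ⟶ v × c ⟶ v × x ⟶ c) ⊎ Independent G v (N⁻ v) → Cycle E (3 * q) v
    split (inj₁ (x , c , xv , cv , xc)) =
      from-arc xv cv xc (farFork q (x ∷ c ∷ []) [] 2≤q (s≤s (s≤s z≤n)) z≤n large)
    split (inj₂ indep⁻) = from-independent (λ i∈ j∈ → indep⁻ j∈ i∈)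
      (FarForks.farFork (G ᵀ) v (λ i∈ j∈ → indep⁻ j∈ i∈) 1≤δ q [] [] 2≤q z≤n z≤n large)

long-cycle : (G : Digraph n δ) (v : Fin n) → ∀ q → 2 ≤ q → 6 * q + 13 ≤ δ →
  ForksClose G v (3 * q) → ForksClose (G ᵀ) v (3 * q) → Cycle (Digraph.E G) (3 * q) v
long-cycle G v q 2≤q large close closeᵀ = split (independent? G v (N⁺ v)) (independent? G v (N⁻ v))
  where
  open Degrees G
  open Digraph G
  split : (∃ λ b → ∃ λ y → v ⟶ b × v ⟶ y × b ⟶ y) ⊎ Independent G v (N⁺ v) →
    (∃ λ x → ∃ λ c → x ⟶ v × c ⟶ v × x ⟶ c) ⊎ Independent G v (N⁻ v) → Cycle E (3 * q) v
  split (inj₂ indep) _ = out-independent-cycle G v indep q 2≤q large close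
  split (inj₁ _) (inj₂ indep) =
    Cycle-reverse (out-independent-cycle (G ᵀ) v (λ i∈ j∈ → indep j∈ i∈) q 2≤q large closeᵀ)
  split (inj₁ (b , y , vb , vy , by)) (inj₁ (x , c , xv , cv , xc)) = close (near xv cv xc) (near vy vb by) disjoint
    where
    disjoint : ∀ {z} → z ∈ x ∷ c ∷ [] → z ∉ y ∷ b ∷ []
    disjoint (here refl)         (here z≡y)         = path⇒≢ xv vy z≡y
    disjoint (here refl)         (there (here z≡b)) = path⇒≢ xv vb z≡b
    disjoint (there (here refl)) (here z≡y)         = path⇒≢ cv vy z≡y
    disjoint (there (here refl)) (there (here z≡b)) = path⇒≢ cv vb z≡b

-- Cycles of length six

private

  expand-count : ∀ a d δ l x p k u → δ ≤ d → d ≤ l + x → x ≤ k + p → a + p ≤ u → a + δ ≤ u + l + k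
  expand-count a d δ l x p k u h₁ h₂ h₃ h₄ = derive 0 (h₁ ⊞ h₂ ⊞ h₃ ⊞ h₄)
    (solve (a ∷ d ∷ δ ∷ l ∷ x ∷ p ∷ k ∷ u ∷ []))

  half-expand : ∀ a δ u l k → a + δ ≤ u + l + k → l ≤ 1 → 2 * k + 1 ≤ a → a + 2 * δ ≤ 2 * u + 1
  half-expand a δ u l k h₁ h₂ h₃ = derive 0 (2 ⊠ h₁ ⊞ 2 ⊠ h₂ ⊞ h₃) (solve (a ∷ δ ∷ u ∷ l ∷ k ∷ []))

  half-expand-c : ∀ a a₁ δ u l k k₁ → a + δ ≤ u + l + k → k ≤ k₁ + 1 → 2 * k₁ + 2 * l ≤ a₁ → a₁ + 1 ≤ a →
    a + 2 * δ ≤ 2 * u + 1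
  half-expand-c a a₁ δ u l k k₁ h₁ h₂ h₃ h₄ = derive 0 (2 ⊠ h₁ ⊞ 2 ⊠ h₂ ⊞ h₃ ⊞ h₄)
    (solve (a ∷ a₁ ∷ δ ∷ u ∷ l ∷ k ∷ k₁ ∷ []))

  half-expand-b : ∀ a a₁ δ u l k k₁ → a + δ ≤ u + l + k → k ≤ k₁ + 1 → l ≤ 1 → 2 * k₁ + 1 ≤ a₁ → a₁ + 1 ≤ a →
    a + 2 * δ ≤ 2 * u + 2
  half-expand-b a a₁ δ u l k k₁ h₁ h₂ h₃ h₄ h₅ = derive 0 (2 ⊠ h₁ ⊞ 2 ⊠ h₂ ⊞ 2 ⊠ h₃ ⊞ h₄ ⊞ h₅)
    (solve (a ∷ a₁ ∷ δ ∷ u ∷ l ∷ k ∷ k₁ ∷ []))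

  -- The sizes give `2 (u + z) ≥ 6 δ - 5`, while three further vertices leave room for only
  -- `6 δ - 6`. With a loss of 2 in both bounds there would be no contradiction, which is why
  -- `thrifty` has to save one.
  overfull : ∀ a b u z n δ e → δ ≤ a + 1 → δ ≤ b + 1 → a + 2 * δ ≤ 2 * u + 1 → b + 2 * δ ≤ 2 * z + 2 →
    3 ≤ e → u + (z + e) ≤ n → n ≤ 3 * δ → ⊥
  overfull a b u z n δ e h₁ h₂ h₃ h₄ h₅ h₆ h₇ = refute 0 (h₁ ⊞ h₂ ⊞ h₃ ⊞ h₄ ⊞ 2 ⊠ h₅ ⊞ 2 ⊠ h₆ ⊞ 2 ⊠ h₇)
    (solve (a ∷ b ∷ u ∷ z ∷ n ∷ δ ∷ e ∷ []))

  drop-one : ∀ d a e δ → δ ≤ d → d ≤ e + a → e ≤ 1 → δ ≤ a + 1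
  drop-one d a e δ h₁ h₂ h₃ = derive 0 (h₁ ⊞ h₂ ⊞ h₃) (solve (d ∷ a ∷ e ∷ δ ∷ []))

  drop-two : ∀ a a₁ e δ → 5 ≤ δ → δ ≤ a + 1 → a ≤ e + a₁ → e ≤ 1 → 3 ≤ a₁
  drop-two a a₁ e δ h₁ h₂ h₃ h₄ = derive 0 (h₁ ⊞ h₂ ⊞ h₃ ⊞ h₄) (solve (a ∷ a₁ ∷ e ∷ δ ∷ []))

  positive-half : ∀ a k → 3 ≤ a → a ≤ 2 * k + 1 → 1 ≤ k
  positive-half a k h₁ h₂ = ≰⇒> λ k≤0 → absurd k≤0
    where
    absurd : k ≤ 0 → ⊥
    absurd h = refute 1 (h₁ ⊞ h₂ ⊞ 2 ⊠ h) (solve (a ∷ k ∷ []))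

  loss-≤ : ∀ k l a → 2 * k + 2 ≤ a → l ≤ 1 → 2 * k + 2 * l ≤ a
  loss-≤ k l a h₁ h₂ = derive 0 (h₁ ⊞ 2 ⊠ h₂) (solve (k ∷ l ∷ a ∷ []))

  loss-0 : ∀ k l a → 2 * k + 1 ≤ a → l ≤ 0 → 2 * k + 2 * l ≤ a
  loss-0 k l a h₁ h₂ = derive 1 (h₁ ⊞ 2 ⊠ h₂) (solve (k ∷ l ∷ a ∷ []))

module _ (G : Digraph n δ) where

  open Degrees G
  open Digraph G

  -- Consecutive vertices of a closed walk, and vertices two steps apart, are
  -- distinct in an oriented graph.
  six-cycle : ∀ {v a b c d e} → v ⟶ a → a ⟶ b → b ⟶ c → c ⟶ d → d ⟶ e → e ⟶ v →
    v ≢ c → a ≢ d → b ≢ e → Cycle E 6 v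
  six-cycle {v} {a} {b} {c} {d} {e} va ab bc cd de ev v≢c a≢d b≢e = a ∷ b ∷ c ∷ d ∷ e ∷ v ∷ [] , refl ,
    (v , va ◅ ab ◅ bc ◅ cd ◅ de ◅ ev ◅ ε) ,
    (⟶⇒≢ ab All.∷ path⇒≢ ab bc All.∷ a≢d All.∷ path⇒≢ ev va ∘ sym All.∷ ⟶⇒≢ va ∘ sym All.∷ All.[]) AllPairs.∷
    (⟶⇒≢ bc All.∷ path⇒≢ bc cd All.∷ b≢e All.∷ path⇒≢ va ab ∘ sym All.∷ All.[]) AllPairs.∷
    (⟶⇒≢ cd All.∷ path⇒≢ cd de All.∷ v≢c ∘ sym All.∷ All.[]) AllPairs.∷
    (⟶⇒≢ de All.∷ path⇒≢ de ev All.∷ All.[]) AllPairs.∷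
    (⟶⇒≢ ev All.∷ All.[]) AllPairs.∷ All.[] AllPairs.∷ AllPairs.[] ,
    there (there (there (there (there (here refl)))))

  expand : (A F : Sub n) (a : Fin n) → ∣ A ∣ + δ ≤ ∣ A ∪ (N⁺ a ∖ F) ∣ + ∣ N⁺ a ∩ F ∣ + ∣ A ∩ N⁺ a ∣
  expand A F a = expand-count (∣ A ∣) (∣ N⁺ a ∣) δ (∣ N⁺ a ∩ F ∣) (∣ X ∣) (∣ X ∖ A ∣) (∣ A ∩ N⁺ a ∣) (∣ A ∪ X ∣)
    (deg⁺ a) (∣∣-split (N⁺ a) F)
    (≤-trans (∣∣-split X A) (+-monoˡ-≤ _ (∣∣-mono (X ∩ A) (A ∩ N⁺ a) λ i i∈ →
      let i∈X , i∈A = ∩⁻ X A i∈ in ∩⁺ A (N⁺ a) i∈A (proj₁ (∖⁻ (N⁺ a) F i∈X)))))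
    (pack A (X ∖ A) (A ∪ X) (λ _ → ∪⁺ˡ A X) (λ i i∈ → ∪⁺ʳ A X (proj₁ (∖⁻ X A i∈)))
      λ i i∈A i∈ → proj₂ (∖⁻ X A i∈) i∈A)
    where
    X : Sub n
    X = N⁺ a ∖ F

-- The arcs x ⟶ c and b ⟶ y among the in- and out-neighbours of v turn a path from
-- y to x of length two, three or four into a six-cycle, unless it is y c b x.

module SixCycle (G : Digraph n δ) {v x c b y : Fin n} (5≤δ : 5 ≤ δ)
  (xc : c ∈ˢ Digraph.E G x) (xv : v ∈ˢ Digraph.E G x) (cv : v ∈ˢ Digraph.E G c)
  (vb : b ∈ˢ Digraph.E G v) (vy : y ∈ˢ Digraph.E G v) (by : y ∈ˢ Digraph.E G b)
  (none : ¬ Cycle (Digraph.E G) 6 v) where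

  open Degrees G
  open Digraph G
  private module Gᵀ = Degrees (G ᵀ)

  A B V : Sub n
  A = N⁺ y ∖ elem [ x ]
  B = N⁻ x ∖ elem [ y ]
  V = elem [ v ]

  A⁻ : ∀ {a} → a ∈ˢ A → y ⟶ a × a ≢ x
  A⁻ a∈ = let ya , a∉ = ∖⁻ (N⁺ y) (elem [ x ]) a∈ in ya , λ { refl → a∉ (elem⁺ {xs = [ x ]} (here refl)) }

  B⁻ : ∀ {β} → β ∈ˢ B → β ⟶ x × β ≢ y
  B⁻ β∈ = let βx , β∉ = ∖⁻ (N⁻ x) (elem [ y ]) β∈ in βx , λ { refl → β∉ (elem⁺ {xs = [ y ]} (here refl)) }

  no-two : ∀ {a} → y ⟶ a → ¬ a ⟶ x
  no-two ya ax = none (six-cycle G vb by ya ax xc cv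
    (path⇒≢ vy ya) (path⇒≢ xv vb ∘ sym) (path⇒≢ cv vy ∘ sym))

  no-three-b : ∀ {a β} → y ⟶ a → a ⟶ β → β ⟶ x → ¬ β ≢ b
  no-three-b ya aβ βx β≢b = none (six-cycle G vb by ya aβ βx xv
    (path⇒≢ vy ya) (β≢b ∘ sym) (path⇒≢ xv vy ∘ sym))

  no-three-c : ∀ {a β} → y ⟶ a → a ⟶ β → β ⟶ x → ¬ a ≢ c
  no-three-c ya aβ βx a≢c = none (six-cycle G vy ya aβ βx xc cv
    (path⇒≢ βx xv ∘ sym) (path⇒≢ xv vy ∘ sym) a≢c)

  no-four : ∀ {a u β} → a ∈ˢ A → β ∈ˢ B → a ⟶ u → u ⟶ β → ¬ u ≢ v
  no-four a∈ β∈ au uβ u≢v = none (six-cycle G vy (proj₁ (A⁻ a∈)) au uβ (proj₁ (B⁻ β∈)) xv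
    (u≢v ∘ sym) (proj₂ (B⁻ β∈) ∘ sym) (proj₂ (A⁻ a∈)))

  ∣A∣ : δ ≤ ∣ A ∣ + 1
  ∣A∣ = drop-one (∣ N⁺ y ∣) (∣ A ∣) (∣ N⁺ y ∩ elem [ x ] ∣) δ (deg⁺ y) (∣∣-split (N⁺ y) (elem [ x ]))
    (≤-trans (∣∣-mono (N⁺ y ∩ elem [ x ]) (elem [ x ]) λ i → proj₂ ∘ ∩⁻ (N⁺ y) (elem [ x ])) (∣elem∣≤length [ x ]))

  ∣B∣ : δ ≤ ∣ B ∣ + 1
  ∣B∣ = drop-one (∣ N⁻ x ∣) (∣ B ∣) (∣ N⁻ x ∩ elem [ y ] ∣) δ (deg⁻ x) (∣∣-split (N⁻ x) (elem [ y ]))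
    (≤-trans (∣∣-mono (N⁻ x ∩ elem [ y ]) (elem [ y ]) λ i → proj₂ ∘ ∩⁻ (N⁻ x) (elem [ y ])) (∣elem∣≤length [ y ]))

  ∣∩V∣≤1 : (N : Sub n) → ∣ N ∩ V ∣ ≤ 1
  ∣∩V∣≤1 N = ≤-trans (∣∣-mono (N ∩ V) V λ i → proj₂ ∘ ∩⁻ N V) (∣elem∣≤length [ v ])

  crowd : ∀ a₁ b₁ → a₁ ∈ˢ A → b₁ ∈ˢ B → (∀ β → β ∈ˢ B → ¬ a₁ ⟶ β) → (∀ a → a ∈ˢ A → ¬ a ⟶ b₁) →
    ∣ A ∣ + 2 * δ ≤ 2 * ∣ A ∪ (N⁺ a₁ ∖ V) ∣ + 1 → ∣ B ∣ + 2 * δ ≤ 2 * ∣ B ∪ (N⁻ b₁ ∖ V) ∣ + 2 → ⊥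
  crowd a₁ b₁ a₁∈ b₁∈ a₁↛ ↛b₁ sizeU sizeZ =
    overfull (∣ A ∣) (∣ B ∣) (∣ U ∣) (∣ Z ∣) n δ (∣ elem (v ∷ x ∷ y ∷ []) ∣) ∣A∣ ∣B∣ sizeU sizeZ
      (length≤∣elem∣ unique)
      (≤-trans (pack₃ U Z (elem (v ∷ x ∷ y ∷ [])) full (λ _ _ → refl) (λ _ _ → refl) (λ _ _ → refl)
        (λ i i∈U i∈Z → apart i (∪⁻ A X i∈U) (∪⁻ B Y i∈Z))
        (λ i i∈U i∈ → U∌ i (∪⁻ A X i∈U) (elem⁻ (v ∷ x ∷ y ∷ []) i∈))
        (λ i i∈Z i∈ → Z∌ i (∪⁻ B Y i∈Z) (elem⁻ (v ∷ x ∷ y ∷ []) i∈))) (∣∣≤n full)) n≤3δ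
    where
    X Y U Z : Sub n
    X = N⁺ a₁ ∖ V
    Y = N⁻ b₁ ∖ V
    U = A ∪ X
    Z = B ∪ Y
    unique : Unique (v ∷ x ∷ y ∷ [])
    unique = (⟶⇒≢ xv ∘ sym All.∷ ⟶⇒≢ vy All.∷ All.[]) AllPairs.∷ (path⇒≢ xv vy All.∷ All.[]) AllPairs.∷
      All.[] AllPairs.∷ AllPairs.[]
    X⁻ : ∀ {i} → i ∈ˢ X → a₁ ⟶ i × i ≢ v
    X⁻ i∈ = let p , q = ∖⁻ (N⁺ a₁) V i∈ in p , λ { refl → q (elem⁺ {xs = [ v ]} (here refl)) }
    Y⁻ : ∀ {i} → i ∈ˢ Y → i ⟶ b₁ × i ≢ v
    Y⁻ i∈ = let p , q = ∖⁻ (N⁻ b₁) V i∈ in p , λ { refl → q (elem⁺ {xs = [ v ]} (here refl)) }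
    apart : ∀ i → i ∈ˢ A ⊎ i ∈ˢ X → ¬ (i ∈ˢ B ⊎ i ∈ˢ Y)
    apart i (inj₁ i∈A) (inj₁ i∈B) = no-two (proj₁ (A⁻ i∈A)) (proj₁ (B⁻ i∈B))
    apart i (inj₁ i∈A) (inj₂ i∈Y) = ↛b₁ i i∈A (proj₁ (Y⁻ i∈Y))
    apart i (inj₂ i∈X) (inj₁ i∈B) = a₁↛ i i∈B (proj₁ (X⁻ i∈X))
    apart i (inj₂ i∈X) (inj₂ i∈Y) = no-four a₁∈ b₁∈ (proj₁ (X⁻ i∈X)) (proj₁ (Y⁻ i∈Y)) (proj₂ (X⁻ i∈X))
    U∌ : ∀ i → i ∈ˢ A ⊎ i ∈ˢ X → i ∉ v ∷ x ∷ y ∷ []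
    U∌ i (inj₁ i∈A) (here refl)                 = asym vy (proj₁ (A⁻ i∈A))
    U∌ i (inj₁ i∈A) (there (here refl))         = proj₂ (A⁻ i∈A) refl
    U∌ i (inj₁ i∈A) (there (there (here refl))) = ⟶⇒≢ (proj₁ (A⁻ i∈A)) refl
    U∌ i (inj₂ i∈X) (here refl)                 = proj₂ (X⁻ i∈X) refl
    U∌ i (inj₂ i∈X) (there (here refl))         = no-two (proj₁ (A⁻ a₁∈)) (proj₁ (X⁻ i∈X))
    U∌ i (inj₂ i∈X) (there (there (here refl))) = asym (proj₁ (A⁻ a₁∈)) (proj₁ (X⁻ i∈X))
    Z∌ : ∀ i → i ∈ˢ B ⊎ i ∈ˢ Y → i ∉ v ∷ x ∷ y ∷ []
    Z∌ i (inj₁ i∈B) (here refl)                 = asym xv (proj₁ (B⁻ i∈B))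
    Z∌ i (inj₁ i∈B) (there (here refl))         = ⟶⇒≢ (proj₁ (B⁻ i∈B)) refl
    Z∌ i (inj₁ i∈B) (there (there (here refl))) = proj₂ (B⁻ i∈B) refl
    Z∌ i (inj₂ i∈Y) (here refl)                 = proj₂ (Y⁻ i∈Y) refl
    Z∌ i (inj₂ i∈Y) (there (here refl))         = asym (proj₁ (Y⁻ i∈Y)) (proj₁ (B⁻ b₁∈))
    Z∌ i (inj₂ i∈Y) (there (there (here refl))) = no-two (proj₁ (Y⁻ i∈Y)) (proj₁ (B⁻ b₁∈))

  1≤∣A∣ : 1 ≤ ∣ A ∣
  1≤∣A∣ = +-cancelʳ-≤ 1 1 _ (≤-trans (≤-trans (s≤s (s≤s z≤n)) 5≤δ) ∣A∣)

  1≤∣B∣ : 1 ≤ ∣ B ∣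
  1≤∣B∣ = +-cancelʳ-≤ 1 1 _ (≤-trans (≤-trans (s≤s (s≤s z≤n)) 5≤δ) ∣B∣)

  without-exception : ¬ (∀ a β → a ∈ˢ A → β ∈ˢ B → ¬ a ⟶ β)
  without-exception no-arc =
    let a₁ , a₁∈ , fewA = min-degree A 1≤∣A∣
        b₁ , b₁∈ , fewB = Gᵀ.min-degree B 1≤∣B∣
    in crowd a₁ b₁ a₁∈ b₁∈ (λ β → no-arc a₁ β a₁∈) (λ a a∈ → no-arc a b₁ a∈ b₁∈)
      (half-expand (∣ A ∣) δ (∣ A ∪ (N⁺ a₁ ∖ V) ∣) (∣ N⁺ a₁ ∩ V ∣) (∣ A ∩ N⁺ a₁ ∣) (expand G A V a₁) (∣∩V∣≤1 (N⁺ a₁)) fewA)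
      (≤-trans (half-expand (∣ B ∣) δ (∣ B ∪ (N⁻ b₁ ∖ V) ∣) (∣ N⁻ b₁ ∩ V ∣) (∣ B ∩ N⁻ b₁ ∣) (expand (G ᵀ) B V b₁)
        (∣∩V∣≤1 (N⁻ b₁)) fewB) (+-monoʳ-≤ (2 * ∣ B ∪ (N⁻ b₁ ∖ V) ∣) (n≤1+n 1)))

module _ (G : Digraph n δ) {v : Fin n} (5≤δ : 5 ≤ δ) where

  open Degrees G
  open Digraph G
  private module Gᵀ = Degrees (G ᵀ)

  six-unless : ∀ {x c b y} → x ⟶ c → x ⟶ v → c ⟶ v → v ⟶ b → v ⟶ y → b ⟶ y →
    ¬ (y ⟶ c × c ⟶ b × b ⟶ x) → Cycle E 6 v
  six-unless {x} {c} {b} {y} xc xv cv vb vy by ¬exception = decidable-stable (cycle? E 6 v) λ none →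
    let open SixCycle G 5≤δ xc xv cv vb vy by none in
    without-exception λ a β a∈ β∈ aβ → exception none a∈ β∈ aβ (a Fin.≟ c) (β Fin.≟ b)
    where
    exception : ∀ none {a β} → let open SixCycle G 5≤δ xc xv cv vb vy by none in
      a ∈ˢ A → β ∈ˢ B → a ⟶ β → Dec (a ≡ c) → Dec (β ≡ b) → ⊥
    exception none a∈ β∈ aβ = λ
      { (yes refl) (yes refl) → ¬exception (proj₁ (A⁻ a∈) , aβ , proj₁ (B⁻ β∈))
      ; (no a≢c)   _          → no-three-c (proj₁ (A⁻ a∈)) aβ (proj₁ (B⁻ β∈)) a≢c
      ; (yes _)    (no β≢b)   → no-three-b (proj₁ (A⁻ a∈)) aβ (proj₁ (B⁻ β∈)) β≢b }
      where open SixCycle G 5≤δ xc xv cv vb vy by none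

  -- Now `c ⟶ b` is the only arc from `A` to `B`. Expanding from `A₁` and `B₁` instead costs half a
  -- vertex more at each end, and one of these halves must be regained.
  module Exception {x c b y} (xc : x ⟶ c) (xv : x ⟶ v) (cv : c ⟶ v) (vb : v ⟶ b) (vy : v ⟶ y) (by : b ⟶ y)
    (yc : y ⟶ c) (cb : c ⟶ b) (bx : b ⟶ x) (none : ¬ Cycle E 6 v) where

    open SixCycle G 5≤δ xc xv cv vb vy by none

    A₁ B₁ : Sub n
    A₁ = A ∖ elem [ c ]
    B₁ = B ∖ elem [ b ]

    A₁⁻ : ∀ {a} → a ∈ˢ A₁ → a ∈ˢ A × a ≢ c
    A₁⁻ a∈ = let p , q = ∖⁻ A (elem [ c ]) a∈ in p , λ { refl → q (elem⁺ {xs = [ c ]} (here refl)) }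

    B₁⁻ : ∀ {β} → β ∈ˢ B₁ → β ∈ˢ B × β ≢ b
    B₁⁻ β∈ = let p , q = ∖⁻ B (elem [ b ]) β∈ in p , λ { refl → q (elem⁺ {xs = [ b ]} (here refl)) }

    A₁↛B : ∀ {a} → a ∈ˢ A₁ → ∀ β → β ∈ˢ B → ¬ a ⟶ β
    A₁↛B a∈ β β∈ aβ = let a∈A , a≢c = A₁⁻ a∈ in no-three-c (proj₁ (A⁻ a∈A)) aβ (proj₁ (B⁻ β∈)) a≢c

    A↛B₁ : ∀ {β} → β ∈ˢ B₁ → ∀ a → a ∈ˢ A → ¬ a ⟶ β
    A↛B₁ β∈ a a∈ aβ = let β∈B , β≢b = B₁⁻ β∈ in no-three-b (proj₁ (A⁻ a∈)) aβ (proj₁ (B⁻ β∈B)) β≢b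

    ≢⇒∉[] : ∀ {i j : Fin n} → i ≢ j → i ∉ˢ elem [ j ]
    ≢⇒∉[] {i} {j} i≢j i∈ = i≢j (∈[]⁻ {x = j} {i} i∈)

    c∈A : c ∈ˢ A
    c∈A = ∖⁺ (N⁺ y) (elem [ x ]) yc (≢⇒∉[] (⟶⇒≢ xc ∘ sym))

    b∈B : b ∈ˢ B
    b∈B = ∖⁺ (N⁻ x) (elem [ y ]) bx (≢⇒∉[] (⟶⇒≢ by))

    ∣∖∣ : (C : Sub n) (z : Fin n) → z ∈ˢ C → ∣ C ∖ elem [ z ] ∣ + 1 ≤ ∣ C ∣
    ∣∖∣ C z z∈ = ≤-trans (+-monoʳ-≤ _ 1≤∣[ z ]∣) (pack (C ∖ elem [ z ]) (elem [ z ]) C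
      (λ i → proj₁ ∘ ∖⁻ C (elem [ z ])) (λ i i∈ → subst (_∈ˢ C) (sym (∈[]⁻ {x = z} {i} i∈)) z∈)
      λ i → proj₂ ∘ ∖⁻ C (elem [ z ]))

    ∣∩∣ : (C N : Sub n) (z : Fin n) → ∣ C ∩ N ∣ ≤ ∣ (C ∖ elem [ z ]) ∩ N ∣ + 1
    ∣∩∣ C N z = ≤-trans (cover (C ∩ N) ((C ∖ elem [ z ]) ∩ N) (elem [ z ]) λ i i∈ → split i (∩⁻ C N i∈) (i ∈ˢ? elem [ z ]))
      (+-monoʳ-≤ _ (∣elem∣≤length [ z ]))
      where
      split : ∀ i → i ∈ˢ C × i ∈ˢ N → i ∈ˢ elem [ z ] ⊎ i ∉ˢ elem [ z ] →
        i ∈ˢ (C ∖ elem [ z ]) ∩ N ⊎ i ∈ˢ elem [ z ]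
      split i _             (inj₁ i∈z) = inj₂ i∈z
      split i (i∈C , i∈N) (inj₂ i∉z) = inj₁ (∩⁺ (C ∖ elem [ z ]) N (∖⁺ C (elem [ z ]) i∈C i∉z) i∈N)

    -- Three vertices are what `positive-half` needs to find an arc within a regular `A₁`; this asks
    -- for `5 ≤ δ`.
    large : (C : Sub n) (z : Fin n) → δ ≤ ∣ C ∣ + 1 → 3 ≤ ∣ C ∖ elem [ z ] ∣
    large C z C≥ = drop-two (∣ C ∣) (∣ C ∖ elem [ z ] ∣) (∣ C ∩ elem [ z ] ∣) δ 5≤δ C≥ (∣∣-split C (elem [ z ]))
      (≤-trans (∣∣-mono (C ∩ elem [ z ]) (elem [ z ]) λ i → proj₂ ∘ ∩⁻ C (elem [ z ])) (∣elem∣≤length [ z ]))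

    3≤∣A₁∣ : 3 ≤ ∣ A₁ ∣
    3≤∣A₁∣ = large A c ∣A∣

    out : Fin n → ℕ
    out a = ∣ A₁ ∩ N⁺ a ∣

    -- Either some a has outdegree to spare, or A₁ is regular. In the latter case
    -- some a has no arc to v, or an arc within A₁ can replace x ⟶ c.
    thrifty : ∃ λ a → a ∈ˢ A₁ × 2 * out a + 2 * ∣ N⁺ a ∩ V ∣ ≤ ∣ A₁ ∣
    thrifty = sparse (Fin.any? λ a → (A₁ a Bool.≟ true) ×-dec (2 * out a + 2 ≤? ∣ A₁ ∣))
      where
      sparse : Dec (∃ λ a → a ∈ˢ A₁ × 2 * out a + 2 ≤ ∣ A₁ ∣) → ∃ λ a → a ∈ˢ A₁ × 2 * out a + 2 * ∣ N⁺ a ∩ V ∣ ≤ ∣ A₁ ∣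
      sparse (yes (a , a∈ , few)) = a , a∈ , loss-≤ (out a) (∣ N⁺ a ∩ V ∣) (∣ A₁ ∣) few (∣∩V∣≤1 (N⁺ a))
      sparse (no dense) = balanced (Fin.any? λ a → (A₁ a Bool.≟ true) ×-dec ¬? (E a v Bool.≟ true))
        where
        half : ∀ a → a ∈ˢ A₁ → ∣ A₁ ∣ ≤ 2 * out a + 1
        half a a∈ = ≤-pred (subst (suc ∣ A₁ ∣ ≤_) (+-suc (2 * out a) 1) (≰⇒> λ few → dense (a , a∈ , few)))
        balanced : Dec (∃ λ a → a ∈ˢ A₁ × ¬ a ⟶ v) → ∃ λ a → a ∈ˢ A₁ × 2 * out a + 2 * ∣ N⁺ a ∩ V ∣ ≤ ∣ A₁ ∣
        balanced (yes (a , a∈ , a↛v)) = a , a∈ , loss-0 (out a) (∣ N⁺ a ∩ V ∣) (∣ A₁ ∣) (regular A₁ half a a∈)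
          (≮⇒≥ λ 1≤ → let i , i∈ = pick (N⁺ a ∩ V) 1≤
                          ai , iv = ∩⁻ (N⁺ a) V i∈
                      in a↛v (subst (a ⟶_) (∈[]⁻ {x = v} {i} iv) ai))
        balanced (no all→v) =
          let to-v : ∀ a → a ∈ˢ A₁ → a ⟶ v
              to-v a a∈ = [ (λ av → av) , (λ a↛v → ⊥-elim (all→v (a , a∈ , a↛v))) ]′ (v ∈ˢ? N⁺ a)
              a , a∈ = pick A₁ (≤-trans (s≤s z≤n) 3≤∣A₁∣)
              a′ , a′∈ = pick (A₁ ∩ N⁺ a) (positive-half (∣ A₁ ∣) (out a) 3≤∣A₁∣ (half a a∈))
              a′∈A₁ , aa′ = ∩⁻ A₁ (N⁺ a) a′∈
          -- With `a ⟶ a′` in place of `x ⟶ c`, the exceptional path would contain `a′ ⟶ b`, an arc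
          -- from `A₁` to `B`.
          in ⊥-elim (none (six-unless aa′ (to-v a a∈) (to-v a′ a′∈A₁) vb vy by
               λ (_ , a′b , _) → A₁↛B a′∈A₁ b b∈B a′b))

    impossible : ⊥
    impossible =
      let a₁ , a₁∈ , fewA = thrifty
          b₁ , b₁∈ , fewB = Gᵀ.min-degree B₁ (≤-trans (s≤s z≤n) (large B b ∣B∣))
      in crowd a₁ b₁ (proj₁ (A₁⁻ a₁∈)) (proj₁ (B₁⁻ b₁∈)) (A₁↛B a₁∈) (A↛B₁ b₁∈)
        (half-expand-c (∣ A ∣) (∣ A₁ ∣) δ (∣ A ∪ (N⁺ a₁ ∖ V) ∣) (∣ N⁺ a₁ ∩ V ∣) (∣ A ∩ N⁺ a₁ ∣) (out a₁)
          (expand G A V a₁) (∣∩∣ A (N⁺ a₁) c) fewA (∣∖∣ A c c∈A))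
        (half-expand-b (∣ B ∣) (∣ B₁ ∣) δ (∣ B ∪ (N⁻ b₁ ∖ V) ∣) (∣ N⁻ b₁ ∩ V ∣) (∣ B ∩ N⁻ b₁ ∣) (∣ B₁ ∩ N⁻ b₁ ∣)
          (expand (G ᵀ) B V b₁) (∣∩∣ B (N⁻ b₁) b) (∣∩V∣≤1 (N⁻ b₁)) fewB (∣∖∣ B b b∈B))

  six-good : ∀ {x c b y} → x ⟶ c → x ⟶ v → c ⟶ v → v ⟶ b → v ⟶ y → b ⟶ y → Cycle E 6 v
  six-good {x} {c} {b} {y} xc xv cv vb vy by =
    decide ((E y c Bool.≟ true) ×-dec ((E c b Bool.≟ true) ×-dec (E b x Bool.≟ true)))
    where
    decide : Dec (y ⟶ c × c ⟶ b × b ⟶ x) → Cycle E 6 v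
    decide (no ¬exception) = six-unless xc xv cv vb vy by ¬exception
    decide (yes (yc , cb , bx)) = decidable-stable (cycle? E 6 v) (Exception.impossible xc xv cv vb vy by yc cb bx)

-- Six-cycles through a vertex with independent out-neighbourhood

private

  few-light : ∀ λ′ ρ δ i n → δ * δ ≤ λ′ * 1 + ρ * δ → ρ + (λ′ + i) ≤ n → δ + 1 ≤ i → n ≤ 3 * δ → λ′ ≤ δ
  few-light λ′ ρ δ i n h₁ h₂ h₃ h₄ = ≮⇒≥ absurd
    where
    remaining : δ < λ′ → ρ + 2 ≤ δ
    remaining h = derive 0 (h₂ ⊞ h₃ ⊞ h₄ ⊞ h) (solve (λ′ ∷ ρ ∷ δ ∷ i ∷ n ∷ []))
    finish : (ρ + 2) * δ ≤ δ * δ → ⊥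
    finish h = refute 0 (h₁ ⊞ h₂ ⊞ h₃ ⊞ h₄ ⊞ h ⊞ z≤n {ρ}) (solve (λ′ ∷ ρ ∷ δ ∷ i ∷ n ∷ []))
    absurd : ¬ δ < λ′
    absurd h = finish (*-monoˡ-≤ δ (remaining h))

  heavy-absurd : ∀ ρ d s t → (2 * (d + 1)) * d ≤ (ρ + 1) * d → ρ * (d + 1) ≤ s + ρ * 1 → s ≤ t → t ≤ (d + 1) * (d + 1) →
    4 * d ≤ d * d → 4 ≤ d → ⊥
  heavy-absurd ρ d s t h₁ h₂ h₃ h₄ h₅ h₆ =
    refute 2 (h₁ ⊞ h₂ ⊞ h₃ ⊞ h₄ ⊞ h₅ ⊞ h₆ ⊞ 2 ⊠ z≤n {d}) (solve (ρ ∷ d ∷ s ∷ t ∷ []))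

  heavy-absurd′ : ∀ ρ d s t → 4 ≤ d → 2 * (d + 1) ≤ ρ + 1 → ρ * (d + 1) ≤ s + ρ * 1 → s ≤ t → t ≤ (d + 1) * (d + 1) → ⊥
  heavy-absurd′ ρ d s t 4≤d h₁ h₂ h₃ h₄ = heavy-absurd ρ d s t
    (*-monoˡ-≤ d {2 * (d + 1)} {ρ + 1} h₁) h₂ h₃ h₄ (*-monoˡ-≤ d {4} {d} 4≤d) 4≤d

  all-heavy-absurd : ∀ ρ d δ s t → d + 1 ≡ δ → 5 ≤ δ → 2 * δ ≤ ρ + 1 → ρ * δ ≤ s + ρ * 1 → s ≤ t → t ≤ δ * δ → ⊥
  all-heavy-absurd ρ d δ s t refl 5≤δ = heavy-absurd′ ρ d s t (+-cancelʳ-≤ 1 4 d 5≤δ)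

  light-sources : ∀ δ d a k l σ o → 5 ≤ δ → δ ≤ d → d ≤ a + o → a ≤ 1 → o ≤ k + σ → 2 * k + 1 ≤ l → l ≤ δ → 2 ≤ σ
  light-sources δ d a k l σ o h₁ h₂ h₃ h₄ h₅ h₆ h₇ = ≰⇒> absurd
    where
    absurd : σ ≤ 1 → ⊥
    absurd h = refute 1 (h₁ ⊞ 2 ⊠ h₂ ⊞ 2 ⊠ h₃ ⊞ 2 ⊠ h₄ ⊞ 2 ⊠ h₅ ⊞ h₆ ⊞ h₇ ⊞ 2 ⊠ h)
      (solve (δ ∷ d ∷ a ∷ k ∷ l ∷ σ ∷ o ∷ []))

  heavy-sources : ∀ δ d a σ → δ ≤ d → d ≤ a + σ → a + 2 ≤ δ → 2 ≤ σ
  heavy-sources δ d a σ h₁ h₂ h₃ = derive 0 (h₁ ⊞ h₂ ⊞ h₃) (solve (δ ∷ d ∷ a ∷ σ ∷ []))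

  some-exit : ∀ δ o a → δ ≤ o + a → a + 1 ≤ δ → 1 ≤ o
  some-exit δ o a h₁ h₂ = derive 0 (h₁ ⊞ h₂) (solve (δ ∷ o ∷ a ∷ []))

  outside-size : ∀ δ p q ρ e → δ ≤ p → δ ≤ q → p + q ≤ ρ + e → e ≤ 1 → 2 * δ ≤ ρ + 1
  outside-size δ p q ρ e h₁ h₂ h₃ h₄ = derive 0 (h₁ ⊞ h₂ ⊞ h₃ ⊞ h₄) (solve (δ ∷ p ∷ q ∷ ρ ∷ e ∷ []))

module SixIndependent (G : Digraph n δ) (v : Fin n) (independent : Independent G v (Digraph.E G v)) (5≤δ : 5 ≤ δ) where

  open Degrees G
  open Digraph G
  open OutIndependent G v independent (≤-trans (s≤s z≤n) 5≤δ)

  private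
    module Gᵀ = Degrees (G ᵀ)

  heavy? : ∀ r → Dec (2 ≤ α r)
  heavy? r = 2 ≤? α r

  R L : Sub n
  R = ∁ (insert v I)
  L = R ∖ ⟨ heavy? ⟩

  sources : Fin n → Sub n
  sources s = ⟨ heavy? ⟩ ∩ N⁻ s

  -- The cycle is `v j t s i r`. Two choices for `t` keep it off `r`, and two in-neighbours of the
  -- heavy vertex `t` in `I` keep `j` off `i`.
  through : ∀ s → s ∉ˢ I → s ≢ v → 1 ≤ ∣ I ∩ N⁺ s ∣ → 2 ≤ ∣ sources s ∣ → Cycle E 6 v
  through s s∉I s≢v exits enough =
    let i , i∈ = pick (I ∩ N⁺ s) exits
        vi , si = ∩⁻ I (N⁺ s) i∈
        r , ir , rv = return vi
        t , t∈ , t∉ = pickAvoiding (sources s) [ r ] enough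
        t-heavy , ts = ∩⁻ ⟨ heavy? ⟩ (N⁻ s) t∈
        j , j∈ , j∉ = pickAvoiding (I ∩ N⁻ t) [ i ] (⟨⟩⁻ heavy? t-heavy)
        vj , jt = ∩⁻ I (N⁻ t) j∈
    in six-cycle G vj jt ts si ir rv (s≢v ∘ sym) (λ j≡i → j∉ (here j≡i)) (λ t≡r → t∉ (here t≡r))

  R⁻ : ∀ {r} → r ∈ˢ R → r ∉ˢ I × r ≢ v
  R⁻ {r} r∈ = (λ r∈I → ∁⁻ (insert v I) r∈ (insert⁺ˡ v I r∈I)) , λ { refl → ∁⁻ (insert v I) r∈ (insert⁺ʳ v I) }

  R⁺ : ∀ {r} → r ∉ˢ I → r ≢ v → r ∈ˢ R
  R⁺ {r} r∉I r≢v = ∁⁺ (insert v I) λ r∈ → [ r∉I , r≢v ]′ (insert⁻ v I {r} r∈)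

  v∉I : v ∉ˢ I
  v∉I v∈ = asym v∈ v∈

  in-outside : ∀ s → s ∉ˢ I → ∀ i → i ∈ˢ N⁻ s → i ∈ˢ I ∩ N⁻ s ⊎ i ∈ˢ R ∩ N⁻ s
  in-outside s s∉I i is = [ (λ i∈I → inj₁ (∩⁺ I (N⁻ s) i∈I is))
                          , (λ i∉I → inj₂ (∩⁺ R (N⁻ s) (R⁺ i∉I λ { refl → s∉I is }) is)) ]′ (i ∈ˢ? I)

  R-split : ∀ s i → i ∈ˢ R ∩ N⁻ s → i ∈ˢ L ∩ N⁻ s ⊎ i ∈ˢ sources s
  R-split s i i∈ = split (∩⁻ R (N⁻ s) i∈) (i ∈ˢ? ⟨ heavy? ⟩)
    where
    split : i ∈ˢ R × i ∈ˢ N⁻ s → i ∈ˢ ⟨ heavy? ⟩ ⊎ i ∉ˢ ⟨ heavy? ⟩ → i ∈ˢ L ∩ N⁻ s ⊎ i ∈ˢ sources s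
    split (i∈R , is) (inj₁ heavy) = inj₂ (∩⁺ ⟨ heavy? ⟩ (N⁻ s) heavy is)
    split (i∈R , is) (inj₂ light) = inj₁ (∩⁺ L (N⁻ s) (∖⁺ R ⟨ heavy? ⟩ i∈R light) is)

  L-α : ∀ {r} → r ∈ˢ L → α r ≤ 1
  L-α r∈ = ≮⇒≥ λ 2≤α → proj₂ (∖⁻ R ⟨ heavy? ⟩ r∈) (⟨⟩⁺ heavy? 2≤α)

  -- With more than `δ` light vertices, at most `δ - 2` others outside `I` and `v` would have to
  -- absorb nearly all of the `δ²` arcs leaving `I`, at most `δ` each.
  ∣L∣≤δ : ∣ L ∣ ≤ δ
  ∣L∣≤δ = few-light (∣ L ∣) (∣ rest ∣) δ (∣ insert v I ∣) n
    (≤-trans δ²≤α-total (≤-trans (sumOver-cover full L (∁ L) α λ i _ →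
        [ inj₁ , (λ i∉ → inj₂ (∁⁺ L i∉)) ]′ (i ∈ˢ? L))
      (+-mono-≤ (sumOver-≤ L 1 λ i → L-α) (≤-trans (sumOver-cover (∁ L) rest (insert v I) α split)
        (≤-trans (+-mono-≤ (sumOver-≤ rest δ λ i _ → α≤δ i) (≤-trans (sumOver-≤ (insert v I) 0 weightless)
          (≤-reflexive (*-zeroʳ (∣ insert v I ∣))))) (≤-reflexive (+-identityʳ (∣ rest ∣ * δ))))))))
    (≤-trans (pack₃ rest L (insert v I) full (λ _ _ → refl) (λ _ _ → refl) (λ _ _ → refl)
      (λ i i∈ → proj₂ (∖⁻ R L i∈)) (λ i i∈ → ∁⁻ (insert v I) (proj₁ (∖⁻ R L i∈)))
      (λ i i∈ → ∁⁻ (insert v I) (proj₁ (∖⁻ R ⟨ heavy? ⟩ i∈)))) (∣∣≤n full))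
    (≤-trans (+-monoˡ-≤ 1 (deg⁺ v)) (∣insert∣ v I v∉I)) n≤3δ
    where
    rest : Sub n
    rest = R ∖ L
    split : ∀ i → i ∈ˢ ∁ L → i ∈ˢ rest ⊎ i ∈ˢ insert v I
    split i i∉L = [ inj₂ , (λ i∉ → inj₁ (∖⁺ R L (∁⁺ (insert v I) i∉) (∁⁻ L i∉L))) ]′ (i ∈ˢ? insert v I)
    weightless : ∀ i → i ∈ˢ insert v I → α i ≤ 0
    weightless i i∈ = ≮⇒≥ λ 1≤α → [ 1≤α⇒∉I 1≤α , 1≤α⇒≢v 1≤α ]′ (insert⁻ v I {i} i∈)

  -- Both neighbourhoods of a vertex of `I` lie in `R`, apart from `v`.
  2δ≤∣R∣+1 : 2 * δ ≤ ∣ R ∣ + 1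
  2δ≤∣R∣+1 = via (pick I (≤-trans (≤-trans (s≤s z≤n) 5≤δ) (deg⁺ v)))
    where
    via : (∃ λ i → i ∈ˢ I) → 2 * δ ≤ ∣ R ∣ + 1
    via (i , vi) = outside-size δ (∣ N⁺ i ∣) (∣ N⁻ i ∣) (∣ R ∣) (∣ elem [ v ] ∣) (deg⁺ i) (deg⁻ i)
      (≤-trans (∣∪∣ (N⁺ i) (N⁻ i) λ j → asym) (cover (N⁺ i ∪ N⁻ i) R (elem [ v ]) λ j j∈ →
        split j ([ independent vi , (λ ji vj → independent vj vi ji) ]′′ (∪⁻ (N⁺ i) (N⁻ i) j∈)) (j Fin.≟ v)))
      (∣elem∣≤length [ v ])
      where
      [_,_]′′ : ∀ {j} → (j ∈ˢ I → ¬ i ⟶ j) → (j ⟶ i → j ∉ˢ I) → i ⟶ j ⊎ j ⟶ i → j ∉ˢ I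
      [ f , g ]′′ (inj₁ ij) j∈I = f j∈I ij
      [ f , g ]′′ (inj₂ ji) j∈I = g ji j∈I
      split : ∀ j → j ∉ˢ I → Dec (j ≡ v) → j ∈ˢ R ⊎ j ∈ˢ elem [ v ]
      split j j∉I (yes j≡v) = inj₂ (elem⁺ {xs = [ v ]} (here j≡v))
      split j j∉I (no j≢v)  = inj₁ (R⁺ j∉I j≢v)

  six-independent : Cycle E 6 v
  six-independent with 1 ≤? ∣ L ∣
  ... | yes 1≤L =
    -- At most one in-neighbour of `s` lies in `I` and fewer than `δ / 2` are light, so at least two
    -- are heavy.
    let s , s∈ , few = Gᵀ.min-degree L 1≤L
        s∉I , s≢v = R⁻ (proj₁ (∖⁻ R ⟨ heavy? ⟩ s∈))
    in through s s∉I s≢v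
      (some-exit δ (∣ I ∩ N⁺ s ∣) (α s) (α-complement s∉I) (≤-trans (+-monoˡ-≤ 1 (L-α s∈)) (≤-trans (s≤s (s≤s z≤n)) 5≤δ)))
      (light-sources δ (∣ N⁻ s ∣) (α s) (∣ L ∩ N⁻ s ∣) (∣ L ∣) (∣ sources s ∣) (∣ R ∩ N⁻ s ∣) 5≤δ (deg⁻ s)
        (cover (N⁻ s) (I ∩ N⁻ s) (R ∩ N⁻ s) (in-outside s s∉I)) (L-α s∈)
        (cover (R ∩ N⁻ s) (L ∩ N⁻ s) (sources s) (R-split s)) few ∣L∣≤δ)
  ... | no none = search (Fin.any? λ s → (R s Bool.≟ true) ×-dec (α s + 2 ≤? δ))
    where
    all-heavy : ∀ {i} → i ∉ˢ L
    all-heavy {i} i∈ = none (1≤∣∣ L {i} i∈)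
    search : Dec (∃ λ s → s ∈ˢ R × α s + 2 ≤ δ) → Cycle E 6 v
    search (yes (s , s∈R , α+2≤δ)) =
      let s∉I , s≢v = R⁻ s∈R in through s s∉I s≢v
        (some-exit δ (∣ I ∩ N⁺ s ∣) (α s) (α-complement s∉I) (≤-trans (+-monoʳ-≤ (α s) (s≤s z≤n)) α+2≤δ))
        (heavy-sources δ (∣ N⁻ s ∣) (α s) (∣ sources s ∣) (deg⁻ s)
          (cover (N⁻ s) (I ∩ N⁻ s) (sources s) λ i is → [ inj₁ , (λ i∈ →
            [ (λ i∈′ → ⊥-elim (all-heavy (proj₁ (∩⁻ L (N⁻ s) i∈′)))) , inj₂ ]′ (R-split s i i∈)) ]′ (in-outside s s∉I i is))
          α+2≤δ)
    -- Now each vertex of `R` receives at least `δ - 1` of the `δ²` arcs leaving `I`, which is too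
    -- many: `(2 δ - 1) (δ - 1) > δ²`.
    search (no dense) = ⊥-elim (all-heavy-absurd (∣ R ∣) (δ ∸ 1) δ (sumOver R α) (sumOver full α)
      (m∸n+n≡m (≤-trans (s≤s z≤n) 5≤δ)) 5≤δ 2δ≤∣R∣+1
      (≤-trans (sumOver-≥ R δ λ i i∈ → ≤-pred (≤-trans (≰⇒> λ few → dense (i , i∈ , few)) (≤-reflexive (+-suc (α i) 1))))
        (≤-trans (≤-reflexive (sumOver-+ R α (λ _ → 1))) (+-monoʳ-≤ (sumOver R α) (≤-reflexive (sumOver-const R 1)))))
      (sumOver-⊆ R full λ _ _ → refl) α-total≤δ²)

-- The three ranges of q

module _ (G : Digraph n δ) (v : Fin n) where

  open Degrees G
  open Digraph G

  has-six-cycle : 5 ≤ δ → Cycle E 6 v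
  has-six-cycle 5≤δ = split (independent? G v (N⁺ v)) (independent? G v (N⁻ v))
    where
    split : (∃ λ b → ∃ λ y → v ⟶ b × v ⟶ y × b ⟶ y) ⊎ Independent G v (N⁺ v) →
      (∃ λ x → ∃ λ c → x ⟶ v × c ⟶ v × x ⟶ c) ⊎ Independent G v (N⁻ v) → Cycle E 6 v
    split (inj₂ indep) _ = SixIndependent.six-independent G v indep 5≤δ
    split (inj₁ _) (inj₂ indep) = Cycle-reverse (SixIndependent.six-independent (G ᵀ) v (λ i∈ j∈ → indep j∈ i∈) 5≤δ)
    split (inj₁ (b , y , vb , vy , by)) (inj₁ (x , c , xv , cv , xc)) = six-good G 5≤δ xc xv cv vb vy by

  has-nine-cycle : 33 ≤ δ → Cycle E 9 v
  has-nine-cycle 33≤δ = long-cycle G v 3 (s≤s (s≤s z≤n)) (≤-trans (m≤m+n 31 2) 33≤δ)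
    (λ into from disjoint → forks⇒9-cycle G into from disjoint 33≤δ)
    (λ into from disjoint → forks⇒9-cycle (G ᵀ) into from disjoint 33≤δ)

  has-long-cycle : ∀ q → 4 ≤ q → 15 * q ≤ δ + 2 → Cycle E (3 * q) v
  has-long-cycle q 4≤q large = long-cycle G v q (≤-trans (s≤s (s≤s z≤n)) 4≤q) (layered-room q δ 4≤q large)
    (λ into from disjoint → forks⇒cycle G into from disjoint q 4≤q large)
    (λ into from disjoint → forks⇒cycle (G ᵀ) into from disjoint q 4≤q large)
    where
    layered-room : ∀ q δ → 4 ≤ q → 15 * q ≤ δ + 2 → 6 * q + 13 ≤ δ
    layered-room q δ h₁ h₂ = derive 21 (9 ⊠ h₁ ⊞ h₂) (solve (q ∷ δ ∷ []))

-- Passing between the two notions of graph and of cycle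

count-allFin : ∀ {n} {P : Fin n → Set} (P? : ∀ i → Dec (P i)) → count P? (allFin n) ≡ ∣ ⟨ P? ⟩ ∣
count-allFin P? = count-tabulate P? (λ i → i)

module _ {n : ℕ} (G : OrientedGraph n) where

  open OrientedGraph G

  private
    E : Fin n → Sub n
    E u = ⟨ arc? u ⟩

  toDigraph : ∀ {δ} → δ ≤ δ⁰ G → n ≤ 3 * δ → Digraph n δ
  toDigraph {δ} δ≤δ⁰ n≤3δ = record
    { E = E
    ; asym = λ {u} {w} uw wu → asym (⟨⟩⁻ (arc? u) uw) (⟨⟩⁻ (arc? w) wu)
    ; deg⁺ = λ u → ≤-trans (≤-trans (δ≤degrees u) (m⊓n≤m _ _)) (≤-reflexive (count-allFin (arc? u)))
    ; deg⁻ = λ u → ≤-trans (≤-trans (δ≤degrees u) (m⊓n≤n _ _)) (≤-reflexive (count-allFin (λ w → arc? w u)))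
    ; n≤3δ = n≤3δ }
    where
    degree : Fin n → ℕ
    degree u = d⁺ G u ⊓ d⁻ G u
    δ≤degrees : ∀ u → δ ≤ degree u
    δ≤degrees u = ≤-trans δ≤δ⁰ (min≤v⁺ n (map degree (allFinList n))
      (inj₂ (lose (∈-map⁺ degree (∈-allFin u)) ≤-refl)))

  toCopy : ∀ {ℓ v} → Cycle E ℓ v → ∃ λ (C : CycleCopy ℓ G) → v LiesOn C
  toCopy {v = v} (xs , refl , (u , path) , unique , v∈) = record
    { vertex = lookup xs ; injective = lookup-injective unique ; arcs = arcs } , index v∈ , sym (lookup-index v∈)
    where
    arcs : ∀ {i j} → CycleArc i j → Arc (lookup xs i) (lookup xs j)
    arcs {i} {j} (step eq)      = ⟨⟩⁻ (arc? _) (lookup-step path i j eq)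
    -- The closed path starts at its own last vertex, so its first arc is the wrapping one.
    arcs {i} {j} (wrap eq first) = ⟨⟩⁻ (arc? _)
      (subst (λ w → lookup xs j ∈ˢ E w) (sym (lookup-last path i eq)) (lookup-first path j first))

n≤3⌈n/3⌉ : ∀ n → n ≤ 3 * ⌈ n /3⌉
n≤3⌈n/3⌉ n = bound ((n + 2) % 3) ⌈ n /3⌉ (m≡m%n+[m/n]*n (n + 2) 3) (≤-pred (m%n<n (n + 2) 3))
  where
  bound : ∀ r d → n + 2 ≡ r + d * 3 → r ≤ 2 → n ≤ 3 * d
  bound r d eq h = derive 0 (≤-reflexive eq ⊞ h) (solve (n ∷ r ∷ d ∷ []))

private

  -- `⌈ n /3⌉` jumps where `n` exceeds a multiple of three by one: `97 = 3 * 32 + 1` gives `δ ≥ 33`,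
  -- and likewise `45 q - 8 = 3 (15 q - 3) + 1` gives `δ ≥ 15 q - 2`.
  at-least : ∀ k δ n → 3 * k + 1 ≤ n → n ≤ 3 * δ → k < δ
  at-least k δ n h₁ h₂ = ≰⇒> absurd
    where
    absurd : δ ≤ k → ⊥
    absurd h = refute 0 (h₁ ⊞ h₂ ⊞ 3 ⊠ h) (solve (k ∷ δ ∷ n ∷ []))

  at-least-15q : ∀ q δ n → 45 * q ≤ n + 8 → n ≤ 3 * δ → 15 * q ≤ δ + 2
  at-least-15q q δ n h₁ h₂ = ≮⇒≥ absurd
    where
    absurd : ¬ δ + 2 < 15 * q
    absurd h = refute 0 (h₁ ⊞ h₂ ⊞ 3 ⊠ h) (solve (q ∷ δ ∷ n ∷ []))

theorem1p1 : ∀ (q n : ℕ) → q ≥ 2 → n ≥ n₀ q →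
    (G : OrientedGraph n) → δ⁰ G ≥ ⌈ n /3⌉ →
    (v : Fin n) → ∃ λ (C : CycleCopy (3 * q) G) → v LiesOn C
theorem1p1 (suc zero) n (s≤s ())
theorem1p1 (suc (suc zero)) n _ n≥37 G δ⁰≥ v = toCopy G (has-six-cycle (toDigraph G δ⁰≥ (n≤3⌈n/3⌉ n)) v
  (≤-trans (m≤m+n 5 8) (at-least 12 ⌈ n /3⌉ n n≥37 (n≤3⌈n/3⌉ n))))
theorem1p1 (suc (suc (suc zero))) n _ n≥97 G δ⁰≥ v = toCopy G (has-nine-cycle (toDigraph G δ⁰≥ (n≤3⌈n/3⌉ n)) v
  (at-least 32 ⌈ n /3⌉ n n≥97 (n≤3⌈n/3⌉ n)))
theorem1p1 q@(suc (suc (suc (suc _)))) n _ n≥ G δ⁰≥ v = toCopy G (has-long-cycle (toDigraph G δ⁰≥ (n≤3⌈n/3⌉ n)) v q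
  (s≤s (s≤s (s≤s (s≤s z≤n)))) (at-least-15q q ⌈ n /3⌉ n
    (≤-trans (m≤n+m∸n (45 * q) 8) (≤-trans (+-monoʳ-≤ 8 n≥) (≤-reflexive (+-comm 8 n)))) (n≤3⌈n/3⌉ n)))
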